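{- Let $\mathbb{F}$ be a field. Given a module structure on the $n$-dimensional vector space $V$ over $\mathbb{F}$ in terms of a collection $\mathcal{S}$ of $m$ matrices of size $n\times n$ over $\mathbb{F}$, one can find the minimum number of generators of $V$ deterministically using $\mathrm{poly}(m,n)$ field operations.
   Context: The $m$ matrices in $\mathcal{S}$ act on $V\cong\mathbb{F}^n$ as linear transformations, making $V$ an $\mathcal{S}$-module. Let $\mathcal{A}$ be the smallest linear space of linear transformations of $V$ that is closed under multiplication and contains $\mathcal{S}$ and the identity, i.e. the linear span of the identity and all finite products of elements of $\mathcal{S}$. For $T\subseteq V$, $\mathcal{A}T$ denotes the linear span of $\{at: a\in\mathcal{A},t\in T\}$, which is the smallest subspace containing $T$ that is closed under the action of $\mathcal{S}$. The set $T$ is a system of generators of $V$ if $V=\mathcal{A}T$; the minimum number of generators is the smallest cardinality of a system of generators. Field operations are arithmetic operations and equality tests in $\mathbb{F}$; "$\mathrm{poly}(m,n)$" means bounded by a polynomial in $m$ and $n$. -}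

module Defs where

open import Level using (Level; _⊔_; suc)
open import Data.Bool.Base using (Bool; true; false; not; if_then_else_; _∧_)
open import Data.Fin.Base using (Fin; fromℕ<)
import Data.Fin.Properties as Fin
open import Data.Nat.Base as ℕ using (ℕ)
import Data.Nat.Properties as ℕ
open import Data.Product using (_×_; _,_; proj₁; Σ; ∃; ∃-syntax)
open import Data.Vec.Functional using (Vector)
import Data.Vec.Functional.Relation.Binary.Equality.Setoid as VecEq
open import Function.Bundles using (_⇔_)
open import Relation.Binary.Definitions using (Decidable)
open import Relation.Binary.PropositionalEquality using (_≡_)
open import Relation.Nullary.Decidable using (Dec; yes; no; does)
open import Relation.Unary using (Pred; _∈_)
open import Algebra.Bundles using (CommutativeRing)
open import Algebra.Apartness.Bundles using (HeytingField; HeytingCommutativeRing)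
import Algebra.Definitions.RawMonoid as RawMonoidDefs

------------------------------------------------------------------------
-- Fields

-- Since equality tests are among the field operations, the apartness of
-- the field is required to be decidable.  Then _#_ is the negation of
-- _≈_, and this is a field in the usual sense (1# # 0# holds because 1#
-- is invertible, and apart elements are never equal).

record DiscreteField c ℓ₁ ℓ₂ : Set (suc (c ⊔ ℓ₁ ⊔ ℓ₂)) where
  field
    heytingField : HeytingField c ℓ₁ ℓ₂

  open HeytingField heytingField public

  field
    _#?_ : Decidable _#_

  commutativeRing : CommutativeRing c ℓ₁
  commutativeRing =
    HeytingCommutativeRing.commutativeRing heytingCommutativeRing

  open CommutativeRing commutativeRing public
    using (+-rawMonoid)

  _≈ᵇ_ : Carrier → Carrier → Bool
  x ≈ᵇ y = not (does (x #? y))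

  -- The inverse of 0# is 0# by convention.
  infix 9 _⁻¹
  _⁻¹ : Carrier → Carrier
  x ⁻¹ with x #? 0#
  ... | yes x#0 = proj₁ (#⇒invertible x#0)
  ... | no _    = 0#

------------------------------------------------------------------------
-- Modules given by matrices, and their systems of generators

module MatrixModule {c ℓ₁ ℓ₂} (F : DiscreteField c ℓ₁ ℓ₂) where
  open DiscreteField F
  open RawMonoidDefs +-rawMonoid using (sum)

  V : ℕ → Set c
  V n = Vector Carrier n

  Matrix : ℕ → Set c
  Matrix n = Fin n → Fin n → Carrier

  infix 4 _≋_ _≋ᴹ_

  _≋_ : ∀ {n} → V n → V n → Set ℓ₁
  _≋_ = VecEq._≋_ setoid

  _≋ᴹ_ : ∀ {n} → Matrix n → Matrix n → Set ℓ₁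
  a ≋ᴹ b = ∀ i j → a i j ≈ b i j

  0ⱽ : ∀ {n} → V n
  0ⱽ i = 0#

  infixl 6 _+ⱽ_ _+ᴹ_
  infixl 7 _∙ⱽ_ _∙ᴹ_ _*ᴹ_ _*ⱽ_

  _+ⱽ_ : ∀ {n} → V n → V n → V n
  (v +ⱽ w) i = v i + w i

  _∙ⱽ_ : ∀ {n} → Carrier → V n → V n
  (x ∙ⱽ v) i = x * v i

  0ᴹ : ∀ {n} → Matrix n
  0ᴹ i j = 0#

  1ᴹ : ∀ {n} → Matrix n
  1ᴹ i j = if does (i Fin.≟ j) then 1# else 0#

  _+ᴹ_ : ∀ {n} → Matrix n → Matrix n → Matrix n
  (a +ᴹ b) i j = a i j + b i j

  _∙ᴹ_ : ∀ {n} → Carrier → Matrix n → Matrix n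
  (x ∙ᴹ a) i j = x * a i j

  _*ᴹ_ : ∀ {n} → Matrix n → Matrix n → Matrix n
  (a *ᴹ b) i j = sum (λ k → a i k * b k j)

  _*ⱽ_ : ∀ {n} → Matrix n → V n → V n
  (a *ⱽ v) i = sum (λ j → a i j * v j)

  -- The smallest linear space of linear transformations that is closed
  -- under multiplication and contains S and the identity.
  data 𝒜 {m n} (S : Vector (Matrix n) m) : Pred (Matrix n) (c ⊔ ℓ₁) where
    generator : ∀ k → 𝒜 S (S k)
    identity  : 𝒜 S 1ᴹ
    null      : 𝒜 S 0ᴹ
    add       : ∀ {a b} → 𝒜 S a → 𝒜 S b → 𝒜 S (a +ᴹ b)
    scale     : ∀ x {a} → 𝒜 S a → 𝒜 S (x ∙ᴹ a)
    mul       : ∀ {a b} → 𝒜 S a → 𝒜 S b → 𝒜 S (a *ᴹ b)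
    respects  : ∀ {a b} → a ≋ᴹ b → 𝒜 S a → 𝒜 S b

  data Span {ℓ n} (P : Pred (V n) ℓ) : Pred (V n) (c ⊔ ℓ₁ ⊔ ℓ) where
    member   : ∀ {v} → v ∈ P → Span P v
    null     : Span P 0ⱽ
    add      : ∀ {v w} → Span P v → Span P w → Span P (v +ⱽ w)
    scale    : ∀ x {v} → Span P v → Span P (x ∙ⱽ v)
    respects : ∀ {v w} → v ≋ w → Span P v → Span P w

  module _ {m n} (S : Vector (Matrix n) m) where

    infix 5 𝒜·_
    𝒜·_ : ∀ {ℓ} → Pred (V n) ℓ → Pred (V n) (c ⊔ ℓ₁ ⊔ ℓ)
    𝒜· T = Span λ w → ∃[ a ] ∃[ t ] (a ∈ 𝒜 S × t ∈ T × w ≋ a *ⱽ t)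

    IsSystemOfGenerators : ∀ {ℓ} → Pred (V n) ℓ → Set (c ⊔ ℓ₁ ⊔ ℓ)
    IsSystemOfGenerators T = ∀ v → v ∈ 𝒜· T

  -- T is a set of exactly k vectors, up to the equality of vectors.
  HasCardinality : ∀ {ℓ n} → Pred (V n) ℓ → ℕ → Set (c ⊔ ℓ₁ ⊔ ℓ)
  HasCardinality {n = n} T k =
    Σ (Vector (V n) k) λ t →
      (∀ {i j} → t i ≋ t j → i ≡ j) ×
      (∀ v → v ∈ T ⇔ (∃[ i ] v ≋ t i))

  -- Infinite T may be ignored: V n is generated by its standard basis.
  IsMinimumNumberOfGenerators : ∀ {m n} → Vector (Matrix n) m → ℕ →
                                Set (c ⊔ suc ℓ₁)
  IsMinimumNumberOfGenerators {n = n} S d =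
    (Σ (Pred (V n) ℓ₁) λ T → HasCardinality T d × IsSystemOfGenerators S T) ×
    (∀ (T : Pred (V n) ℓ₁) k →
       HasCardinality T k → IsSystemOfGenerators S T → d ℕ.≤ k)

------------------------------------------------------------------------
-- Algorithms: while programs over a field

-- A program is a fixed finite text, the same for all m and n and for all
-- fields.  It uses registers reg i holding natural numbers (control,
-- indices; the register number may itself be computed) and cells
-- cell k i j holding field elements.  The only access to the field is
-- through 0#, 1#, arithmetic and equality tests.  Every operation has
-- unit cost.  Bookkeeping is charged as well as field operations, and
-- natural numbers cannot be multiplied in one step: unrestricted free
-- computation on natural numbers could hide an exponential search.

data ℕExp : Set where
  lit     : ℕ → ℕExp
  reg     : ℕExp → ℕExp
  _⊕_ _⊖_ : ℕExp → ℕExp → ℕExp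

data FExp : Set where
  𝟘 𝟙              : FExp
  cell             : ℕExp → ℕExp → ℕExp → FExp
  _⊞_ _⊟_ _⊠_ _⊘_ : FExp → FExp → FExp

data Test : Set where
  _<ᵗ_ : ℕExp → ℕExp → Test
  _≈ᵗ_ : FExp → FExp → Test

infixr 4 _⨾_
infix  5 reg_≔_ cell⟨_,_,_⟩≔_

data Program : Set where
  skip            : Program
  reg_≔_          : ℕExp → ℕExp → Program
  cell⟨_,_,_⟩≔_   : ℕExp → ℕExp → ℕExp → FExp → Program
  _⨾_             : Program → Program → Program
  cond            : Test → Program → Program → Program
  while           : Test → Program → Program

costℕ : ℕExp → ℕ
costℕ (lit k) = 1
costℕ (reg e) = 1 ℕ.+ costℕ e
costℕ (e ⊕ f) = 1 ℕ.+ costℕ e ℕ.+ costℕ f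
costℕ (e ⊖ f) = 1 ℕ.+ costℕ e ℕ.+ costℕ f

costF : FExp → ℕ
costF 𝟘            = 1
costF 𝟙            = 1
costF (cell e f g) = 1 ℕ.+ costℕ e ℕ.+ costℕ f ℕ.+ costℕ g
costF (x ⊞ y)      = 1 ℕ.+ costF x ℕ.+ costF y
costF (x ⊟ y)      = 1 ℕ.+ costF x ℕ.+ costF y
costF (x ⊠ y)      = 1 ℕ.+ costF x ℕ.+ costF y
costF (x ⊘ y)      = 1 ℕ.+ costF x ℕ.+ costF y

costT : Test → ℕ
costT (e <ᵗ f) = 1 ℕ.+ costℕ e ℕ.+ costℕ f
costT (x ≈ᵗ y) = 1 ℕ.+ costF x ℕ.+ costF y

module Semantics {c ℓ₁ ℓ₂} (F : DiscreteField c ℓ₁ ℓ₂) where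
  open DiscreteField F
  open MatrixModule F using (Matrix)

  record State : Set c where
    constructor ⟨_,_⟩
    field
      registers : ℕ → ℕ
      cells     : ℕ → ℕ → ℕ → Carrier

  open State public

  setRegister : ℕ → ℕ → State → State
  setRegister a x σ = record σ
    { registers = λ b → if b ℕ.≡ᵇ a then x else registers σ b }

  setCell : ℕ → ℕ → ℕ → Carrier → State → State
  setCell a b d x σ = record σ
    { cells = λ k i j →
        if (k ℕ.≡ᵇ a) ∧ (i ℕ.≡ᵇ b) ∧ (j ℕ.≡ᵇ d) then x else cells σ k i j }

  evalℕ : ℕExp → State → ℕ
  evalℕ (lit k) σ = k
  evalℕ (reg e) σ = registers σ (evalℕ e σ)
  evalℕ (e ⊕ f) σ = evalℕ e σ ℕ.+ evalℕ f σ
  evalℕ (e ⊖ f) σ = evalℕ e σ ℕ.∸ evalℕ f σ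

  evalF : FExp → State → Carrier
  evalF 𝟘            σ = 0#
  evalF 𝟙            σ = 1#
  evalF (cell e f g) σ = cells σ (evalℕ e σ) (evalℕ f σ) (evalℕ g σ)
  evalF (x ⊞ y)      σ = evalF x σ + evalF y σ
  evalF (x ⊟ y)      σ = evalF x σ - evalF y σ
  evalF (x ⊠ y)      σ = evalF x σ * evalF y σ
  evalF (x ⊘ y)      σ = evalF x σ * evalF y σ ⁻¹

  evalT : Test → State → Bool
  evalT (e <ᵗ f) σ = evalℕ e σ ℕ.<ᵇ evalℕ f σ
  evalT (x ≈ᵗ y) σ = evalF x σ ≈ᵇ evalF y σ

  infix 3 _,_⇓_cost_

  -- P , σ ⇓ τ cost t: started in σ, P halts in τ after t operations.
  data _,_⇓_cost_ : Program → State → State → ℕ → Set c where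

    ⇓skip : ∀ {σ} → skip , σ ⇓ σ cost 1

    ⇓reg : ∀ {e f σ} →
      reg e ≔ f , σ ⇓ setRegister (evalℕ e σ) (evalℕ f σ) σ
        cost 1 ℕ.+ costℕ e ℕ.+ costℕ f

    ⇓cell : ∀ {e f g x σ} →
      cell⟨ e , f , g ⟩≔ x , σ
        ⇓ setCell (evalℕ e σ) (evalℕ f σ) (evalℕ g σ) (evalF x σ) σ
        cost 1 ℕ.+ costℕ e ℕ.+ costℕ f ℕ.+ costℕ g ℕ.+ costF x

    ⇓seq : ∀ {P Q σ τ υ s t} →
      P , σ ⇓ τ cost s → Q , τ ⇓ υ cost t →
      P ⨾ Q , σ ⇓ υ cost s ℕ.+ t

    ⇓if-true : ∀ {b P Q σ τ t} → evalT b σ ≡ true →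
      P , σ ⇓ τ cost t →
      cond b P Q , σ ⇓ τ cost 1 ℕ.+ costT b ℕ.+ t

    ⇓if-false : ∀ {b P Q σ τ t} → evalT b σ ≡ false →
      Q , σ ⇓ τ cost t →
      cond b P Q , σ ⇓ τ cost 1 ℕ.+ costT b ℕ.+ t

    ⇓while-true : ∀ {b P σ τ υ s t} → evalT b σ ≡ true →
      P , σ ⇓ τ cost s → while b P , τ ⇓ υ cost t →
      while b P , σ ⇓ υ cost 1 ℕ.+ costT b ℕ.+ s ℕ.+ t

    ⇓while-false : ∀ {b P σ} → evalT b σ ≡ false →
      while b P , σ ⇓ σ cost 1 ℕ.+ costT b

  -- Entry (i , j) of the k-th matrix is placed in cell k i j; registers 0
  -- and 1 hold m and n; everything else is zero.
  initial : ∀ {m n} → Vector (Matrix n) m → State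
  initial {m} {n} S = ⟨ inputRegisters , inputCells ⟩
    where
    inputRegisters : ℕ → ℕ
    inputRegisters 0 = m
    inputRegisters 1 = n
    inputRegisters _ = 0

    inputCells : ℕ → ℕ → ℕ → Carrier
    inputCells k i j with k ℕ.<? m | i ℕ.<? n | j ℕ.<? n
    ... | yes k<m | yes i<n | yes j<n = S (fromℕ< k<m) (fromℕ< i<n) (fromℕ< j<n)
    ... | _       | _       | _       = 0#

  output : State → ℕ
  output σ = registers σ 0

------------------------------------------------------------------------
-- Polynomials in m and n (natural coefficients suffice for upper bounds)

data Polynomial : Set where
  con       : ℕ → Polynomial
  𝐦 𝐧       : Polynomial
  _:+_ _:*_ : Polynomial → Polynomial → Polynomial

evalPolynomial : Polynomial → ℕ → ℕ → ℕ
evalPolynomial (con k)  m n = k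
evalPolynomial 𝐦        m n = m
evalPolynomial 𝐧        m n = n
evalPolynomial (p :+ q) m n = evalPolynomial p m n ℕ.+ evalPolynomial q m n
evalPolynomial (p :* q) m n = evalPolynomial p m n ℕ.* evalPolynomial q m n

-- On every input S, the program halts within the given number of
-- operations, having computed the minimum number of generators.
FindsMinimumNumberOfGenerators : ∀ {c ℓ₁ ℓ₂} → DiscreteField c ℓ₁ ℓ₂ →
                                 Program → Polynomial → Set (c ⊔ suc ℓ₁)
FindsMinimumNumberOfGenerators F P p =
  ∀ m n (S : Vector (Matrix n) m) →
    ∃[ τ ] ∃[ t ] ((P , initial S ⇓ τ cost t) ×
                   t ℕ.≤ evalPolynomial p m n ×
                   IsMinimumNumberOfGenerators S (output τ))
  where
  open MatrixModule F
  open Semantics F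

-- Let A be the algebra generated by the matrices.  If k vectors generate V, then for every right
-- ideal R of A and every submodule W the dimension of (R V + W) / W is at most k times that of
-- R / {r : r V ⊆ W}; such inequalities certify lower bounds.  The algorithm keeps a tuple v of
-- vectors, a superfluous submodule W (one that any set of generators can do without) and a subspace
-- E such that V = A v + A R V + W for the right ideal R = {a ∈ A : a V ⊆ E}.  For an entry vᵢ, let
-- T = {r ∈ R : r vᵢ ∈ W + Σ_{j ≠ i} R vⱼ}.  If T V ⊆ W for all i, then either V = A v + W, so that v
-- generates V, or the inequality for R and W shows that v has too few entries, and it gets another
-- one.  Otherwise take i with T V ⊄ W and a large N.
--   If (A T)ᴺ V ⊆ W, then W + A T V is superfluous by Nakayama's lemma and replaces W.
--   If (A T)ᴺ V ⊄ A v + W, there is an x ∈ A T x outside A v + W, and adding x to vᵢ enlarges A v + W.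
--   Else some f ∈ T A has a nonzero eigenvalue in F, and E is replaced by E ∩ ker fᴺ.
-- Each of dim W, dim (A v + W), the length of v and the codimension of E grows at most n times.
-- Neither the radical of A nor the factorisation of polynomials is needed.
--
-- The program is written in a language of arrays in which every loop runs over indices bounded by m,
-- n or 4, so that a polynomial bound on the running time can be read off its text.

module Submission where

open import Level using (_⊔_; Lift; lift; module Lift) renaming (suc to lsuc)
open import Defs
open import Algebra.Bundles using (CommutativeRing; RawRing)
import Algebra.Definitions.RawMonoid as RawMonoidDefs
import Algebra.Properties.Ring as RingProperties
import Algebra.Properties.Semiring.Mult as SemiringMult
import Algebra.Properties.CommutativeMonoid.Sum as MonoidSum
import Algebra.Apartness.Properties.HeytingCommutativeRing as HeytingProperties
import Algebra.Solver.Ring as RingSolver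
open import Algebra.Solver.Ring.AlmostCommutativeRing
  using (AlmostCommutativeRing; fromCommutativeRing; _-Raw-AlmostCommutative⟶_)
open import Data.Bool.Base using (Bool; true; false; if_then_else_; _∧_)
open import Data.Bool.Properties using (∧-zeroʳ)
open import Data.Unit.Base using (⊤; tt)
open import Data.Fin.Base as Fin using (Fin; zero; suc; toℕ)
import Data.Fin.Properties as Finₚ
open import Data.List.Base using (List; []; _∷_; _++_; length; map; cartesianProductWith; allFin; tabulate)
  renaming (lookup to lookupˡ)
import Data.List.Properties as Listₚ
open import Data.List.Membership.Propositional using () renaming (_∈_ to _∈ˡ_)
import Data.List.Membership.Propositional.Properties as ∈ₚ
open import Data.List.Relation.Unary.Any using (here; there)
open import Data.List.Relation.Unary.All as All using (All; []; _∷_)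
import Data.List.Relation.Unary.All.Properties as Allₚ
open import Data.List.Relation.Unary.AllPairs as AllPairs using (AllPairs; []; _∷_)
import Data.List.Relation.Unary.AllPairs.Properties as AllPairsₚ
open import Data.Maybe.Base using (Maybe; just; nothing)
open import Data.Nat.Base as ℕ using (ℕ; zero; suc; z≤n; s≤s)
import Data.Nat.Properties as ℕₚ
open import Data.Nat.Solver using (module +-*-Solver)
open import Data.Product using (_×_; _,_; proj₁; proj₂; Σ-syntax; ∃-syntax)
open import Data.Sum.Base using (_⊎_; inj₁; inj₂; [_,_]′)
open import Data.Vec.Functional using (Vector)
open import Function.Base using (_∘_; id)
open import Function.Bundles using (mk⇔; module Equivalence)
open import Relation.Binary.Definitions using (tri<; tri≈; tri>)
open import Relation.Binary.PropositionalEquality as ≡ using (_≡_; _≢_)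
open import Relation.Nullary using (¬_; Dec; yes; no; does; contradiction)
open import Relation.Nullary.Decidable using (map′; _×-dec_)
open import Relation.Unary using (Pred)
import Relation.Binary.Reasoning.Setoid as SetoidReasoning

-- The inequality behind the lower bounds: if w generates V, then R V = R A w is the sum of the R wⱼ
-- because R is a right ideal, and modulo W each R wⱼ is an image of R / {r : r V ⊆ W}. When no
-- relation moves V outside W, the maps r ↦ r vᵢ on that quotient are jointly injective modulo W, so
-- the entries of v already attain equality, and one element of R V outside A v + W shows that more
-- entries are needed. R has to vary: with R = A, a relation f that is not nilpotent may have a high
-- power mapping V into A v + W. Then f yields nothing new, yet it spoils the count. Fitting's
-- decomposition for f splits this harmless part off from R. Loops have fixed lengths, so no search
-- can stop early. Each is controlled by a dimension that moves until a stationary state is reached,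
-- and stationary states survive further rounds. For the main loop the potential dim W + dim (A v +
-- W) + length of v - dim E rises in every unfinished round; it starts at -n or above and stays
-- below 3n while V is not reached, whence 4n rounds.

module FieldProperties {c ℓ₁ ℓ₂} (F : DiscreteField c ℓ₁ ℓ₂) where
  open DiscreteField F public hiding (zero)
  open CommutativeRing commutativeRing public
    using (ring; semiring; +-commutativeMonoid)
  open RingProperties ring public
    using (-‿distribˡ-*; -‿distribʳ-*; -0#≈0#; x∙y⁻¹≈ε⇒x≈y; -‿involutive; -‿+-comm)
    renaming (x≈y⇒x∙y⁻¹≈ε to x≈y⇒x-y≈0)
  open HeytingProperties heytingCommutativeRing public using (x-0≈x; 1#0)

  private
    module Mult = SemiringMult semiring
    infixr 8 _·1
    _·1 : ℕ → Carrier
    k ·1 = k Mult.× 1#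

  -- Integers as formal differences, so that the solver can cancel.
  private
    differences : RawRing _ _
    differences = record
      { Carrier = ℕ × ℕ
      ; _≈_ = _≡_
      ; _+_ = λ (a , b) (a′ , b′) → a ℕ.+ a′ , b ℕ.+ b′
      ; _*_ = λ (a , b) (a′ , b′) → a ℕ.* a′ ℕ.+ b ℕ.* b′ , a ℕ.* b′ ℕ.+ b ℕ.* a′
      ; -_ = λ (a , b) → b , a
      ; 0# = 0 , 0
      ; 1# = 1 , 0
      }

    R : AlmostCommutativeRing c ℓ₁
    R = fromCommutativeRing commutativeRing

    value : ℕ × ℕ → Carrier
    value (a , b) = a ·1 - b ·1

    open SetoidReasoning setoid

    interchange : ∀ a b a′ b′ → (a + a′) + (b + b′) ≈ (a + b) + (a′ + b′)
    interchange a b a′ b′ = begin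
      (a + a′) + (b + b′)  ≈⟨ +-assoc a a′ _ ⟩
      a + (a′ + (b + b′))  ≈⟨ +-congˡ (+-assoc a′ b b′) ⟨
      a + ((a′ + b) + b′)  ≈⟨ +-congˡ (+-congʳ (+-comm a′ b)) ⟩
      a + ((b + a′) + b′)  ≈⟨ +-congˡ (+-assoc b a′ b′) ⟩
      a + (b + (a′ + b′))  ≈⟨ +-assoc a b _ ⟨
      (a + b) + (a′ + b′)  ∎

    +-homo : ∀ x y → value (x .proj₁ ℕ.+ y .proj₁ , x .proj₂ ℕ.+ y .proj₂) ≈ value x + value y
    +-homo (a , b) (a′ , b′) = begin
      (a ℕ.+ a′) ·1 - (b ℕ.+ b′) ·1          ≈⟨ +-cong (Mult.×-homo-+ 1# a a′)
          (-‿cong (Mult.×-homo-+ 1# b b′)) ⟩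
      (a ·1 + a′ ·1) - (b ·1 + b′ ·1)        ≈⟨ +-congˡ (-‿+-comm _ _) ⟨
      (a ·1 + a′ ·1) + (- (b ·1) - b′ ·1)    ≈⟨ interchange _ _ _ _ ⟩
      (a ·1 - b ·1) + (a′ ·1 - b′ ·1)        ∎

    negate : ∀ x y → value (y , x) ≈ - value (x , y)
    negate x y = begin
      y ·1 - x ·1          ≈⟨ +-comm _ _ ⟩
      - (x ·1) + y ·1      ≈⟨ +-congˡ (-‿involutive _) ⟨
      - (x ·1) - - (y ·1)  ≈⟨ -‿+-comm _ _ ⟩
      - (x ·1 - y ·1)      ∎

    *-homo : ∀ x y → value (x .proj₁ ℕ.* y .proj₁ ℕ.+ x .proj₂ ℕ.* y .proj₂ ,
                            x .proj₁ ℕ.* y .proj₂ ℕ.+ x .proj₂ ℕ.* y .proj₁) ≈ value x * value y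
    *-homo (a , b) (a′ , b′) = begin
      (a ℕ.* a′ ℕ.+ b ℕ.* b′) ·1 - (a ℕ.* b′ ℕ.+ b ℕ.* a′) ·1
        ≈⟨ +-cong (trans (Mult.×-homo-+ 1# (a ℕ.* a′) _)
            (+-cong (Mult.×1-homo-* a a′) (Mult.×1-homo-* b b′)))
             (-‿cong (trans (Mult.×-homo-+ 1# (a ℕ.* b′) _)
                 (+-cong (Mult.×1-homo-* a b′) (Mult.×1-homo-* b a′)))) ⟩
      (a ·1 * a′ ·1 + b ·1 * b′ ·1) - (a ·1 * b′ ·1 + b ·1 * a′ ·1)
        ≈⟨ +-congˡ (trans (-‿cong (+-comm _ _)) (sym (-‿+-comm _ _))) ⟩
      (a ·1 * a′ ·1 + b ·1 * b′ ·1) + (- (b ·1 * a′ ·1) - a ·1 * b′ ·1)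
        ≈⟨ interchange _ _ _ _ ⟩
      (a ·1 * a′ ·1 - b ·1 * a′ ·1) + (b ·1 * b′ ·1 - a ·1 * b′ ·1)
        ≈⟨ +-cong (+-congˡ (-‿distribˡ-* _ _))
             (trans (+-comm _ _) (+-cong (-‿distribʳ-* _ _)
               (trans (sym (-‿involutive _)) (trans (-‿cong (-‿distribˡ-* _ _))
                   (-‿distribʳ-* _ _))))) ⟩
      (a ·1 * a′ ·1 + - (b ·1) * a′ ·1) + (a ·1 * - (b′ ·1) + - (b ·1) * - (b′ ·1))
        ≈⟨ +-cong (distribʳ _ _ _) (distribʳ _ _ _) ⟨
      (a ·1 - b ·1) * a′ ·1 + (a ·1 - b ·1) * - (b′ ·1)
        ≈⟨ distribˡ _ _ _ ⟨
      (a ·1 - b ·1) * (a′ ·1 - b′ ·1) ∎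

    morphism : differences -Raw-AlmostCommutative⟶ R
    morphism = record
      { ⟦_⟧ = value
      ; +-homo = +-homo
      ; *-homo = *-homo
      ; -‿homo = λ (x , y) → negate x y
      ; 0-homo = -‿inverseʳ 0#
      ; 1-homo = trans (+-cong (+-identityʳ 1#) -0#≈0#) (+-identityʳ 1#)
      }

    equal? : ∀ x y → Maybe (value x ≈ value y)
    equal? (a , b) (a′ , b′) with a ℕ.+ b′ ℕₚ.≟ b ℕ.+ a′
    ... | no _  = nothing
    ... | yes e = just (x∙y⁻¹≈ε⇒x≈y _ _ (begin
      value (a , b) - value (a′ , b′)        ≈⟨ +-congˡ (negate a′ b′) ⟨
      value (a , b) + value (b′ , a′)        ≈⟨ +-homo (a , b) (b′ , a′) ⟨
      (a ℕ.+ b′) ·1 - (b ℕ.+ a′) ·1          ≡⟨ ≡.cong (λ k → k ·1 - (b ℕ.+ a′) ·1) e ⟩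
      (b ℕ.+ a′) ·1 - (b ℕ.+ a′) ·1          ≈⟨ -‿inverseʳ _ ⟩
      0#                                     ∎))

  open RingSolver differences R morphism equal? public
    using (solve; _:=_; _:-_; :-_)
    renaming (_:+_ to infixl 7 _⊹_; _:*_ to infixl 8 _⊛_; con to :con)

  infix 4 _≈?_
  _≈?_ : ∀ x y → Dec (x ≈ y)
  x ≈? y with x #? y
  ... | yes x#y = no (λ x≈y → #⇒≉ x#y x≈y)
    where
    #⇒≉ : x # y → ¬ x ≈ y
    #⇒≉ p q = proj₂ (tight x y) q p
  ... | no ¬x#y = yes (proj₁ (tight x y) ¬x#y)

  ≈ᵇ-true : ∀ {x y} → x ≈ y → x ≈ᵇ y ≡ true
  ≈ᵇ-true {x} {y} x≈y with x #? y
  ... | yes x#y = contradiction x#y (proj₂ (tight x y) x≈y)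
  ... | no _    = ≡.refl

  ≈ᵇ-false : ∀ {x y} → ¬ x ≈ y → x ≈ᵇ y ≡ false
  ≈ᵇ-false {x} {y} x≉y with x #? y
  ... | yes _   = ≡.refl
  ... | no ¬x#y = contradiction (proj₁ (tight x y) ¬x#y) x≉y

  ⁻¹-zero : ∀ {x} → x ≈ 0# → x ⁻¹ ≡ 0#
  ⁻¹-zero {x} x≈0 with x #? 0#
  ... | yes x#0 = contradiction x#0 (proj₂ (tight x 0#) x≈0)
  ... | no _    = ≡.refl

  ⁻¹-inverseˡ : ∀ {x} → ¬ x ≈ 0# → x ⁻¹ * x ≈ 1#
  ⁻¹-inverseˡ {x} x≉0 with x #? 0#
  ... | yes x#0 = trans (*-congˡ (sym (x-0≈x x))) (proj₁ (proj₂ (#⇒invertible x#0)))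
  ... | no ¬x#0 = contradiction (proj₁ (tight x 0#) ¬x#0) x≉0

  1≉0 : ¬ 1# ≈ 0#
  1≉0 1≈0 = proj₂ (tight 1# 0#) 1≈0 1#0

  *-cancel-0 : ∀ {x y} → ¬ x ≈ 0# → x * y ≈ 0# → y ≈ 0#
  *-cancel-0 {x} {y} x≉0 xy≈0 = begin
    y               ≈⟨ *-identityˡ y ⟨
    1# * y          ≈⟨ *-congʳ (⁻¹-inverseˡ x≉0) ⟨
    x ⁻¹ * x * y    ≈⟨ *-assoc _ _ _ ⟩
    x ⁻¹ * (x * y)  ≈⟨ *-congˡ xy≈0 ⟩
    x ⁻¹ * 0#       ≈⟨ zeroʳ _ ⟩
    0#              ∎

  x-y≈0⇒x≈y : ∀ {x y} → x - y ≈ 0# → x ≈ y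
  x-y≈0⇒x≈y = x∙y⁻¹≈ε⇒x≈y _ _

-- Shapes of arrays, and loops over their indices

data Dim : Set where
  𝑚 𝑛 𝟜 : Dim

infixr 6 _⊗_

data Shape : Set where
  unit : Shape
  dim  : Dim → Shape
  _⊗_  : Shape → Shape → Shape

𝑚ˢ 𝑛ˢ : Shape
𝑚ˢ = dim 𝑚
𝑛ˢ = dim 𝑛

length-product : ∀ {a b c} {A : Set a} {B : Set b} {C : Set c} (f : A → B → C) xs ys →
                 length (cartesianProductWith f xs ys) ≡ length xs ℕ.* length ys
length-product f []       ys = ≡.refl
length-product f (x ∷ xs) ys = ≡.trans (Listₚ.length-++ (map (f x) ys))
  (≡.cong₂ ℕ._+_ (Listₚ.length-map (f x) ys) (length-product f xs ys))

module Indices (m n : ℕ) where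

  size : Dim → ℕ
  size 𝑚 = m
  size 𝑛 = n
  size 𝟜 = 4

  Idx : Shape → Set
  Idx unit    = ⊤
  Idx (dim d) = Fin (size d)
  Idx (s ⊗ t) = Idx s × Idx t

  card : Shape → ℕ
  card unit    = 1
  card (dim d) = size d
  card (s ⊗ t) = card s ℕ.* card t

  infix 4 _≟ᵢ_
  _≟ᵢ_ : ∀ {s} (i j : Idx s) → Dec (i ≡ j)
  _≟ᵢ_ {unit}  i j = yes ≡.refl
  _≟ᵢ_ {dim d} i j = i Finₚ.≟ j
  _≟ᵢ_ {s ⊗ t} (i , i′) (j , j′) =
    map′ (λ (p , q) → ≡.cong₂ _,_ p q) (λ p → ≡.cong proj₁ p , ≡.cong proj₂ p)
      (i ≟ᵢ j ×-dec i′ ≟ᵢ j′)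

  enum : ∀ s → List (Idx s)
  enum unit    = tt ∷ []
  enum (dim d) = allFin (size d)
  enum (s ⊗ t) = cartesianProductWith _,_ (enum s) (enum t)

  length-enum : ∀ s → length (enum s) ≡ card s
  length-enum unit    = ≡.refl
  length-enum (dim d) = Listₚ.length-tabulate id
  length-enum (s ⊗ t) = ≡.trans (length-product _,_ (enum s) (enum t))
    (≡.cong₂ ℕ._*_ (length-enum s) (length-enum t))

  ∈-enum : ∀ s (i : Idx s) → i ∈ˡ enum s
  ∈-enum unit    i       = here ≡.refl
  ∈-enum (dim d) i       = ∈ₚ.∈-allFin i
  ∈-enum (s ⊗ t) (i , j) = ∈ₚ.∈-cartesianProductWith⁺ _,_ (∈-enum s i) (∈-enum t j)

  module _ {a} {X : Set a} where

    foldFin : ∀ k → (Fin k → X → X) → X → X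
    foldFin zero    f x = x
    foldFin (suc k) f x = foldFin k (f ∘ suc) (f zero x)

    fold : ∀ s → (Idx s → X → X) → X → X
    fold unit    f = f tt
    fold (dim d) f = foldFin (size d) f
    fold (s ⊗ t) f = fold s λ i → fold t λ j → f (i , j)

    module _ {p} (P : X → Set p) where

      foldFin-preserves : ∀ k {f} → (∀ i x → P x → P (f i x)) → ∀ {x} → P x → P (foldFin k f x)
      foldFin-preserves zero    h px = px
      foldFin-preserves (suc k) h px = foldFin-preserves k (h ∘ suc) (h zero _ px)

      fold-preserves : ∀ s {f} → (∀ i x → P x → P (f i x)) → ∀ {x} → P x → P (fold s f x)
      fold-preserves unit    h = h tt _
      fold-preserves (dim d) h = foldFin-preserves (size d) h
      fold-preserves (s ⊗ t) h = fold-preserves s λ i x → fold-preserves t λ j → h (i , j)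

    module _ {p} (P : ℕ → X → Set p) where

      foldFin-counts : ∀ k {f} → (∀ i j x → P j x → P (suc j) (f i x)) →
                       ∀ {j x} → P j x → P (k ℕ.+ j) (foldFin k f x)
      foldFin-counts zero    h px = px
      foldFin-counts (suc k) {f} h {j} {x} px =
        ≡.subst (λ l → P l (foldFin k (f ∘ suc) (f zero x))) (ℕₚ.+-suc k j)
            (foldFin-counts k (h ∘ suc) (h zero j _ px))

    module _ {p q} (P : X → Set p) (Q : X → Set q) where

      foldFin-reaches : ∀ k {f} → (∀ i x → P x → P (f i x)) →
                        (∀ i x → P x → Q x → Q (f i x)) →
                        ∀ i → (∀ x → P x → Q (f i x)) → ∀ {x} → P x → Q (foldFin k f x)
      foldFin-reaches (suc k) h g zero    e px =
        proj₂ (foldFin-preserves (λ x → P x × Q x) k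
          (λ j x (p , q) → h (suc j) x p , g (suc j) x p q) (h zero _ px , e _ px))
      foldFin-reaches (suc k) h g (suc i) e px =
        foldFin-reaches k (h ∘ suc) (g ∘ suc) i e (h zero _ px)

      -- The step at `i` establishes `Q` from the invariant `P` alone and all later steps keep it,
      -- so nothing needs to be known about the place of `i` in the order of the loop.
      fold-reaches : ∀ s {f} → (∀ i x → P x → P (f i x)) →
                     (∀ i x → P x → Q x → Q (f i x)) →
                     ∀ i → (∀ x → P x → Q (f i x)) → ∀ {x} → P x → Q (fold s f x)
      fold-reaches unit    h g i e px = e _ px
      fold-reaches (dim d) h g i e px = foldFin-reaches (size d) h g i e px
      fold-reaches (s ⊗ t) {f} h g (i , j) e px =
        fold-reaches s
          (λ i x → fold-preserves P t λ j → h (i , j))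
          (λ i x p q → proj₂ (fold-preserves (λ x → P x × Q x) t
             (λ j x (p , q) → h (i , j) x p , g (i , j) x p q) (p , q)))
          i (λ x p → fold-reaches t (λ j → h (i , j)) (λ j → g (i , j)) j e p) px

  -- Meant for invariants of the form "stationary, or some dimension has moved at least `j` times":
  -- a loop that is long enough must then end in the stationary case.
  fold-counts : ∀ {a p} {X : Set a} (P : ℕ → X → Set p) s {f} →
                (∀ i j x → P j x → P (suc j) (f i x)) →
                ∀ {j x} → P j x → P (card s ℕ.+ j) (fold s f x)
  fold-counts P unit    h px = h tt _ _ px
  fold-counts P (dim d) h px = foldFin-counts P (size d) h px
  fold-counts P (s ⊗ t) {f} h {j} {x} px =
    ≡.subst (λ l → P (l ℕ.* card t ℕ.+ j) (fold (s ⊗ t) f x)) (ℕₚ.+-identityʳ (card s))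
      (fold-counts (λ l → P (l ℕ.* card t ℕ.+ j)) s {λ i → fold t λ j → f (i , j)}
        (λ i l x px → ≡.subst (λ k → P k (fold t (λ i′ → f (i , i′)) x))
            (≡.sym (ℕₚ.+-assoc (card t) (l ℕ.* card t) j))
          (fold-counts P t (λ i′ → h (i , i′)) px))
        {0} px)

  module _ {a b r} {X : Set a} {Y : Set b} (R : X → Y → Set r) where

    foldFin-related : ∀ k {f g} → (∀ i x y → R x y → R (f i x) (g i y)) →
                      ∀ {x y} → R x y → R (foldFin k f x) (foldFin k g y)
    foldFin-related zero    h r = r
    foldFin-related (suc k) h r = foldFin-related k (h ∘ suc) (h zero _ _ r)

    fold-related : ∀ s {f g} → (∀ i x y → R x y → R (f i x) (g i y)) →
                   ∀ {x y} → R x y → R (fold s f x) (fold s g y)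
    fold-related unit    h r = h tt _ _ r
    fold-related (dim d) h r = foldFin-related (size d) h r
    fold-related (s ⊗ t) h r = fold-related s (λ i _ _ → fold-related t λ j → h (i , j)) r

-- Finite sums over shapes

module Sums {c ℓ₁ ℓ₂} (F : DiscreteField c ℓ₁ ℓ₂) (m n : ℕ) where
  open FieldProperties F
  open Indices m n public
  open RawMonoidDefs +-rawMonoid using (sum)
  private module Sum = MonoidSum +-commutativeMonoid
  open SetoidReasoning setoid

  ∑ : ∀ s → (Idx s → Carrier) → Carrier
  ∑ s f = fold s (λ i a → a + f i) 0#

  private
    -- `∑` accumulates from the left as the compiled loop does. This variant follows the structure
    -- of the shape, so that the laws of `sum` carry over by induction.
    ∑′ : ∀ s → (Idx s → Carrier) → Carrier
    ∑′ unit    f = f tt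
    ∑′ (dim d) f = sum f
    ∑′ (s ⊗ t) f = ∑′ s λ i → ∑′ t λ j → f (i , j)

    foldFin-sum : ∀ k (f : Fin k → Carrier) a → foldFin k (λ i a → a + f i) a ≈ a + sum f
    foldFin-sum zero    f a = sym (+-identityʳ a)
    foldFin-sum (suc k) f a = trans (foldFin-sum k (f ∘ suc) _) (+-assoc _ _ _)

    ∑′-cong : ∀ s {f g : Idx s → Carrier} → (∀ i → f i ≈ g i) → ∑′ s f ≈ ∑′ s g
    ∑′-cong unit    h = h tt
    ∑′-cong (dim d) h = Sum.sum-cong-≋ h
    ∑′-cong (s ⊗ t) h = ∑′-cong s λ i → ∑′-cong t λ j → h (i , j)

    fold-sum : ∀ s (f : Idx s → Carrier) a → fold s (λ i a → a + f i) a ≈ a + ∑′ s f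
    fold-sum unit    f a = refl
    fold-sum (dim d) f a = foldFin-sum (size d) f a
    fold-sum (s ⊗ t) f a = trans
      (fold-related _≈_ s (λ i x y x≈y → trans (fold-sum t _ x) (+-congʳ x≈y)) refl)
      (fold-sum s _ a)

    ∑≈∑′ : ∀ s (f : Idx s → Carrier) → ∑ s f ≈ ∑′ s f
    ∑≈∑′ s f = trans (fold-sum s f 0#) (+-identityˡ _)

    ∑′-0 : ∀ s → ∑′ s (λ _ → 0#) ≈ 0#
    ∑′-0 unit    = refl
    ∑′-0 (dim d) = Sum.sum-replicate-zero (size d)
    ∑′-0 (s ⊗ t) = trans (∑′-cong s λ _ → ∑′-0 t) (∑′-0 s)

    ∑′-+ : ∀ s (f g : Idx s → Carrier) → ∑′ s (λ i → f i + g i) ≈ ∑′ s f + ∑′ s g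
    ∑′-+ unit    f g = refl
    ∑′-+ (dim d) f g = Sum.∑-distrib-+ f g
    ∑′-+ (s ⊗ t) f g = trans (∑′-cong s λ _ → ∑′-+ t _ _) (∑′-+ s _ _)

    sum-* : ∀ {k} x (f : Fin k → Carrier) → sum (λ i → x * f i) ≈ x * sum f
    sum-* {zero}  x f = sym (zeroʳ x)
    sum-* {suc k} x f = trans (+-congˡ (sum-* x (f ∘ suc))) (sym (distribˡ _ _ _))

    ∑′-* : ∀ s x (f : Idx s → Carrier) → ∑′ s (λ i → x * f i) ≈ x * ∑′ s f
    ∑′-* unit    x f = refl
    ∑′-* (dim d) x f = sum-* x f
    ∑′-* (s ⊗ t) x f = trans (∑′-cong s λ _ → ∑′-* t x _) (∑′-* s x _)

    sum-∑′ : ∀ {k} t (f : Fin k → Idx t → Carrier) →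
             sum (λ i → ∑′ t (f i)) ≈ ∑′ t (λ j → sum (λ i → f i j))
    sum-∑′ {zero}  t f = sym (∑′-0 t)
    sum-∑′ {suc k} t f = trans (+-congˡ (sum-∑′ t (f ∘ suc))) (sym (∑′-+ t _ _))

    ∑′-swap : ∀ s t (f : Idx s → Idx t → Carrier) →
              ∑′ s (λ i → ∑′ t (f i)) ≈ ∑′ t (λ j → ∑′ s (λ i → f i j))
    ∑′-swap unit    t f = refl
    ∑′-swap (dim d) t f = sum-∑′ t f
    ∑′-swap (s ⊗ r) t f = trans (∑′-cong s λ i → ∑′-swap r t _) (∑′-swap s t _)

  ∑≈sum : ∀ d (f : Fin (size d) → Carrier) → ∑ (dim d) f ≈ sum f
  ∑≈sum d = ∑≈∑′ (dim d)

  ∑-⊗ : ∀ s t (f : Idx (s ⊗ t) → Carrier) → ∑ (s ⊗ t) f ≈ ∑ s (λ i → ∑ t (λ j → f (i , j)))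
  ∑-⊗ s t f = trans (∑≈∑′ (s ⊗ t) f) (sym (trans (∑≈∑′ s _) (∑′-cong s λ i → ∑≈∑′ t _)))

  ∑-cong : ∀ s {f g : Idx s → Carrier} → (∀ i → f i ≈ g i) → ∑ s f ≈ ∑ s g
  ∑-cong s h = trans (∑≈∑′ s _) (trans (∑′-cong s h) (sym (∑≈∑′ s _)))

  ∑-0 : ∀ s {f : Idx s → Carrier} → (∀ i → f i ≈ 0#) → ∑ s f ≈ 0#
  ∑-0 s h = trans (∑≈∑′ s _) (trans (∑′-cong s h) (∑′-0 s))

  ∑-+ : ∀ s (f g : Idx s → Carrier) → ∑ s (λ i → f i + g i) ≈ ∑ s f + ∑ s g
  ∑-+ s f g = trans (∑≈∑′ s _) (trans (∑′-+ s f g) (sym (+-cong (∑≈∑′ s f) (∑≈∑′ s g))))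

  ∑-*ˡ : ∀ s x (f : Idx s → Carrier) → ∑ s (λ i → x * f i) ≈ x * ∑ s f
  ∑-*ˡ s x f = trans (∑≈∑′ s _) (trans (∑′-* s x f) (sym (*-congˡ (∑≈∑′ s f))))

  ∑-*ʳ : ∀ s x (f : Idx s → Carrier) → ∑ s (λ i → f i * x) ≈ ∑ s f * x
  ∑-*ʳ s x f = trans (∑-cong s λ _ → *-comm _ _) (trans (∑-*ˡ s x f) (*-comm _ _))

  ∑-swap : ∀ s t (f : Idx s → Idx t → Carrier) →
           ∑ s (λ i → ∑ t (f i)) ≈ ∑ t (λ j → ∑ s (λ i → f i j))
  ∑-swap s t f = begin
    ∑ s (λ i → ∑ t (f i))              ≈⟨ ∑≈∑′ s _ ⟩
    ∑′ s (λ i → ∑ t (f i))             ≈⟨ ∑′-cong s (λ i → ∑≈∑′ t _) ⟩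
    ∑′ s (λ i → ∑′ t (f i))            ≈⟨ ∑′-swap s t f ⟩
    ∑′ t (λ j → ∑′ s (λ i → f i j))    ≈⟨ ∑′-cong t (λ j → ∑≈∑′ s _) ⟨
    ∑′ t (λ j → ∑ s (λ i → f i j))     ≈⟨ ∑≈∑′ t _ ⟨
    ∑ t (λ j → ∑ s (λ i → f i j))      ∎

  eq : ∀ s → Idx s → Idx s → Carrier
  eq unit    i j = 1#
  eq (dim d) i j = if does (i Finₚ.≟ j) then 1# else 0#
  eq (s ⊗ t) (i , i′) (j , j′) = eq s i j * eq t i′ j′

  private
    δ : ∀ {k} → Fin k → Fin k → Carrier
    δ i j = if does (i Finₚ.≟ j) then 1# else 0#

    sum-δ : ∀ {k} i (f : Fin k → Carrier) → sum (λ j → δ i j * f j) ≈ f i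
    sum-δ {suc k} zero f = begin
      1# * f zero + sum (λ j → 0# * f (suc j))  ≈⟨ +-cong (*-identityˡ _)
          (Sum.sum-cong-≋ {k} λ j → zeroˡ (f (suc j))) ⟩
      f zero + sum {k} (λ j → 0#)               ≈⟨ +-congˡ (Sum.sum-replicate-zero k) ⟩
      f zero + 0#                               ≈⟨ +-identityʳ _ ⟩
      f zero                                    ∎
    sum-δ {suc k} (suc i) f = begin
      0# * f zero + sum (λ j → δ i j * f (suc j))  ≈⟨ +-cong (zeroˡ _) (sum-δ i (f ∘ suc)) ⟩
      0# + f (suc i)                               ≈⟨ +-identityˡ _ ⟩
      f (suc i)                                    ∎

    ∑′-eq : ∀ s i (f : Idx s → Carrier) → ∑′ s (λ j → eq s i j * f j) ≈ f i
    ∑′-eq unit    i f = *-identityˡ _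
    ∑′-eq (dim d) i f = sum-δ i f
    ∑′-eq (s ⊗ t) (i , i′) f = begin
      ∑′ s (λ j → ∑′ t (λ j′ → eq s i j * eq t i′ j′ * f (j , j′)))
        ≈⟨ ∑′-cong s (λ j → trans (∑′-cong t λ j′ → *-assoc _ _ _) (∑′-* t _ _)) ⟩
      ∑′ s (λ j → eq s i j * ∑′ t (λ j′ → eq t i′ j′ * f (j , j′)))
        ≈⟨ ∑′-eq s i (λ j → ∑′ t (λ j′ → eq t i′ j′ * f (j , j′))) ⟩
      ∑′ t (λ j′ → eq t i′ j′ * f (i , j′))
        ≈⟨ ∑′-eq t i′ (λ j′ → f (i , j′)) ⟩
      f (i , i′) ∎

    δ-sym : ∀ {k} (i j : Fin k) → δ i j ≡ δ j i
    δ-sym zero    zero    = ≡.refl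
    δ-sym zero    (suc j) = ≡.refl
    δ-sym (suc i) zero    = ≡.refl
    δ-sym (suc i) (suc j) = δ-sym i j

  eq-sym : ∀ s i j → eq s i j ≡ eq s j i
  eq-sym unit    i j = ≡.refl
  eq-sym (dim d) i j = δ-sym i j
  eq-sym (s ⊗ t) (i , i′) (j , j′) = ≡.cong₂ _*_ (eq-sym s i j) (eq-sym t i′ j′)

  ∑-eqˡ : ∀ s i (f : Idx s → Carrier) → ∑ s (λ j → eq s i j * f j) ≈ f i
  ∑-eqˡ s i f = trans (∑≈∑′ s _) (∑′-eq s i f)

  ∑-eqʳ : ∀ s i (f : Idx s → Carrier) → ∑ s (λ j → f j * eq s j i) ≈ f i
  ∑-eqʳ s i f = trans (∑-cong s λ j → trans (*-comm _ _) (*-congʳ (reflexive (eq-sym s j i))))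
    (∑-eqˡ s i f)

-- Linear algebra modulo a subspace: spans, independence, exchange

module LinearAlgebra {c ℓ₁ ℓ₂} (F : DiscreteField c ℓ₁ ℓ₂) (m n : ℕ) where
  open FieldProperties F public
  open Sums F m n public
  private module ≈-R = SetoidReasoning setoid

  Vec : Shape → Set c
  Vec s = Idx s → Carrier

  infix 4 _≋_
  _≋_ : ∀ {s} → Vec s → Vec s → Set ℓ₁
  x ≋ y = ∀ i → x i ≈ y i

  infixl 6 _+ᵛ_ _-ᵛ_
  infixl 7 _∙ᵛ_

  0ᵛ : ∀ {s} → Vec s
  0ᵛ i = 0#

  _+ᵛ_ _-ᵛ_ : ∀ {s} → Vec s → Vec s → Vec s
  (x +ᵛ y) i = x i + y i
  (x -ᵛ y) i = x i - y i

  _∙ᵛ_ : ∀ {s} → Carrier → Vec s → Vec s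
  (a ∙ᵛ x) i = a * x i

  infix 4 _≋?_
  _≋?_ : ∀ {s} (x y : Vec s) → Dec (x ≋ y)
  _≋?_ {s} x y = map′ (λ h i → All.lookup h (∈-enum s i)) (λ h → All.tabulate (λ {i} _ → h i))
    (All.all? (λ i → x i ≈? y i) (enum s))

  infix 4 _⊆_
  _⊆_ : ∀ {s p q} → Pred (Vec s) p → Pred (Vec s) q → Set (c ⊔ p ⊔ q)
  X ⊆ Y = ∀ x → X x → Y x

  record IsSubspace {ℓ s} (X : Pred (Vec s) ℓ) : Set (c ⊔ ℓ₁ ⊔ ℓ) where
    field
      resp  : ∀ {x y} → x ≋ y → X x → X y
      null  : X 0ᵛ
      add   : ∀ {x y} → X x → X y → X (x +ᵛ y)
      scale : ∀ a {x} → X x → X (a ∙ᵛ x)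

    minus : ∀ {x y} → X x → X y → X (x -ᵛ y)
    minus {x} {y} p q = resp
      (λ i → +-congˡ (trans (sym (-‿distribˡ-* 1# (y i))) (-‿cong (*-identityˡ (y i)))))
      (add p (scale (- 1#) q))

    add⁻ : ∀ {x y} → X (x -ᵛ y) → X y → X x
    add⁻ {x} {y} p q = resp (λ i → solve 2 (λ x y → x :- y ⊹ y := x) refl (x i) (y i)) (add p q)

    ∑-closed : ∀ t (f : Idx t → Carrier) (u : Idx t → Vec s) → (∀ i → X (u i)) →
               X (λ p → ∑ t (λ i → f i * u i p))
    ∑-closed t f u h = resp
      (λ p → fold-related (λ (x : Vec s) a → x p ≈ a) t
        {λ i x → x +ᵛ f i ∙ᵛ u i} {λ i a → a + f i * u i p} (λ i x a x≈a → +-congʳ x≈a) {0ᵛ} refl)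
      (fold-preserves X t {λ i x → x +ᵛ f i ∙ᵛ u i}
          (λ i x px → add px (scale (f i) (h i))) {0ᵛ} null)

  open IsSubspace public

  module _ {ℓ s} (B : Pred (Vec s) ℓ) where

    -- Relative to a subspace `B`, which takes the place of forming the quotient by `B`. Dimensions
    -- of quotients are later compared in this way.
    data Span : List (Vec s) → Pred (Vec s) (c ⊔ ℓ) where
      base : ∀ {x} → B x → Span [] x
      _∷_  : ∀ {x y ys} a → Span ys (x -ᵛ a ∙ᵛ y) → Span (y ∷ ys) x

    -- Each vector is required to lie outside the span of B and its successors.
    data Independent : List (Vec s) → Set (c ⊔ ℓ) where
      []  : Independent []
      _∷_ : ∀ {y ys} → ¬ Span ys y → Independent ys → Independent (y ∷ ys)

  module Spans {ℓ s} {B : Pred (Vec s) ℓ} (isB : IsSubspace B) where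

    isSpan : ∀ ys → IsSubspace (Span B ys)
    isSpan [] = record
      { resp = λ { e (base b) → base (resp isB e b) }
      ; null = base (null isB)
      ; add = λ { (base b) (base b′) → base (add isB b b′) }
      ; scale = λ { a (base b) → base (scale isB a b) }
      }
    isSpan (y ∷ ys) = record
      { resp = λ { e (a ∷ p) → a ∷ resp rec (λ i → +-congʳ (e i)) p }
      ; null = 0# ∷ resp rec (λ i → sym (trans (+-congˡ (-‿cong (zeroˡ _))) (-‿inverseʳ 0#)))
          (null rec)
      ; add = λ { {x} {x′} (a ∷ p) (a′ ∷ p′) → (a + a′) ∷ resp rec
          (λ i → solve 5 (λ x x′ a a′ y → (x :- a ⊛ y) ⊹ (x′ :- a′ ⊛ y) := (x ⊹ x′) :- (a ⊹ a′) ⊛ y)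
             refl (x i) (x′ i) a a′ (y i)) (add rec p p′) }
      ; scale = λ { b {x} (a ∷ p) → (b * a) ∷ resp rec
          (λ i → solve 4 (λ x a b y → b ⊛ (x :- a ⊛ y) := b ⊛ x :- b ⊛ a ⊛ y)
             refl (x i) a b (y i)) (scale rec b p) }
      }
      where rec = isSpan ys

    Span-∷ : ∀ {y ys} → Span B ys ⊆ Span B (y ∷ ys)
    Span-∷ {y} {ys} x p = 0# ∷ resp (isSpan ys)
      (λ i → sym (trans (+-congˡ (trans (-‿cong (zeroˡ _)) -0#≈0#)) (+-identityʳ _))) p

    base⊆Span : ∀ ys → B ⊆ Span B ys
    base⊆Span []       x b = base b
    base⊆Span (y ∷ ys) x b = Span-∷ x (base⊆Span ys x b)

    head∈Span : ∀ {y ys} → Span B (y ∷ ys) y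
    head∈Span {y} {ys} = 1# ∷ resp (isSpan ys)
      (λ i → sym (trans (+-congˡ (-‿cong (*-identityˡ _))) (-‿inverseʳ (y i)))) (null (isSpan ys))

    ∈-Span : ∀ {y ys} → y ∈ˡ ys → Span B ys y
    ∈-Span (here ≡.refl) = head∈Span
    ∈-Span (there y∈)    = Span-∷ _ (∈-Span y∈)

    Span-least : ∀ {p} {X : Pred (Vec s) p} → IsSubspace X → ∀ {ys} →
                 B ⊆ X → All X ys → Span B ys ⊆ X
    Span-least isX B⊆X []       x (base b) = B⊆X x b
    Span-least isX B⊆X (h ∷ hs) x (a ∷ p)  =
      add⁻ isX (Span-least isX B⊆X hs _ p) (scale isX a h)

    private
      -- One step of Gaussian elimination: `pivot` is congruent to `x` modulo the span of `xs`, and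
      -- subtracting multiples of it removes `x` from the other members of `ys`, at the price of one
      -- vector.
      record Pivot (x : Vec s) (xs ys : List (Vec s)) : Set (c ⊔ ℓ) where
        field
          rest        : List (Vec s)
          length-rest : length ys ≡ suc (length rest)
          independent : Independent B rest
          rest⊆xs     : All (Span B xs) rest
          rest⊆ys     : All (Span B ys) rest
          pivot       : Vec s
          pivot∈ys    : Span B ys pivot
          pivot-x     : Span B xs (pivot -ᵛ x)

      eliminate : ∀ x xs {ys} → Independent B ys → All (Span B (x ∷ xs)) ys →
                  All (Span B xs) ys ⊎ Pivot x xs ys
      eliminate x xs [] [] = inj₁ []
      eliminate x xs {y ∷ ys} (y∉ ∷ ind) ((a ∷ p) ∷ ps) with eliminate x xs ind ps
      -- The pivot comes from the span of the tail, so subtracting a multiple of it from `y` cannot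
      -- bring `y` into the span of the later vectors.
      ... | inj₂ r = inj₂ record
        { rest = (y -ᵛ a ∙ᵛ pivot) ∷ rest
        ; length-rest = ≡.cong suc length-rest
        ; independent = (λ q → y∉ (add⁻ (isSpan ys)
            (Span-least (isSpan ys) (base⊆Span ys) rest⊆ys _ q) (scale (isSpan ys) a pivot∈ys)))
            ∷ independent
        ; rest⊆xs = resp (isSpan xs)
            (λ i → solve 4 (λ y a p x → (y :- a ⊛ x) :- a ⊛ (p :- x) := y :- a ⊛ p)
               refl (y i) a (pivot i) (x i))
            (minus (isSpan xs) p (scale (isSpan xs) a pivot-x)) ∷ rest⊆xs
        ; rest⊆ys = minus (isSpan (y ∷ ys)) head∈Span
            (scale (isSpan (y ∷ ys)) a (Span-∷ _ pivot∈ys))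
            ∷ All.map (Span-∷ _) rest⊆ys
        ; pivot = pivot
        ; pivot∈ys = Span-∷ _ pivot∈ys
        ; pivot-x = pivot-x
        }
        where open Pivot r
      ... | inj₁ ys∈ with a ≈? 0#
      ...   | yes a≈0 = inj₁ (resp (isSpan xs)
              (λ i → trans (+-congˡ (trans (-‿cong (trans (*-congʳ a≈0) (zeroˡ _))) -0#≈0#))
                  (+-identityʳ _))
              p ∷ ys∈)
      ...   | no a≉0 = inj₂ record
        { rest = ys
        ; length-rest = ≡.refl
        ; independent = ind
        ; rest⊆xs = ys∈
        ; rest⊆ys = All.tabulate (Span-∷ _ ∘ ∈-Span)
        ; pivot = a ⁻¹ ∙ᵛ y
        ; pivot∈ys = scale (isSpan (y ∷ ys)) (a ⁻¹) head∈Span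
        ; pivot-x = resp (isSpan xs)
            (λ i → trans (solve 4 (λ b y a x → b ⊛ (y :- a ⊛ x) := b ⊛ y :- (b ⊛ a) ⊛ x)
               refl (a ⁻¹) (y i) a (x i))
               (+-congˡ (-‿cong (trans (*-congʳ (⁻¹-inverseˡ a≉0)) (*-identityˡ _)))))
            (scale (isSpan xs) (a ⁻¹) p)
        }

    -- Each member of `xs` is eliminated at the cost of at most one member of `ys`. Once `xs` is
    -- used up, any vector that remained would lie in `B`.
    steinitz : ∀ xs {ys} → Independent B ys → All (Span B xs) ys → length ys ℕ.≤ length xs
    steinitz []       {[]}     _          _             = z≤n
    steinitz []       {y ∷ ys} (y∉ ∷ _)   (base b ∷ _)  = contradiction (base⊆Span ys y b) y∉
    steinitz (x ∷ xs) ind      ys∈        with eliminate x xs ind ys∈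
    ... | inj₁ ys∈′ = ℕₚ.m≤n⇒m≤1+n (steinitz xs ind ys∈′)
    ... | inj₂ r    = ≡.subst (ℕ._≤ _) (≡.sym length-rest) (s≤s (steinitz xs independent rest⊆xs))
      where open Pivot r

    record Basis (xs : List (Vec s)) : Set (c ⊔ ℓ) where
      field
        vectors     : List (Vec s)
        independent : Independent B vectors
        spans       : All (Span B vectors) xs
        subset      : All (_∈ˡ xs) vectors

    basis : (∀ zs x → Dec (Span B zs x)) → ∀ xs → Basis xs
    basis dec [] = record { vectors = [] ; independent = [] ; spans = [] ; subset = [] }
    basis dec (x ∷ xs) with basis dec xs
    ... | b with dec (Basis.vectors b) x
    ...   | yes x∈ = record
      { vectors = vectors
      ; independent = independent
      ; spans = x∈ ∷ spans
      ; subset = All.map there subset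
      }
      where open Basis b
    ...   | no x∉ = record
      { vectors = x ∷ vectors
      ; independent = x∉ ∷ independent
      ; spans = head∈Span ∷ All.map (Span-∷ _) spans
      ; subset = here ≡.refl ∷ All.map there subset
      }
      where open Basis b

-- Subspaces as ranges of idempotent matrices

module Projections {c ℓ₁ ℓ₂} (F : DiscreteField c ℓ₁ ℓ₂) (m n : ℕ) where
  open LinearAlgebra F m n public
  open SetoidReasoning setoid

  -- Subspaces are represented by projections onto them: x lies in P when P x = x.

  Op : Shape → Set c
  Op s = Vec (s ⊗ s)

  dot : ∀ {s} → Vec s → Vec s → Carrier
  dot {s} φ x = ∑ s λ q → φ q * x q

  ap : ∀ {s} → Op s → Vec s → Vec s
  ap {s} P x p = ∑ s λ q → P (p , q) * x q

  col : ∀ {s} {t : Shape} → Vec (s ⊗ t) → Idx t → Vec s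
  col P j p = P (p , j)

  module _ {s : Shape} where

    dot-cong : ∀ (φ : Vec s) {x y} → x ≋ y → dot φ x ≈ dot φ y
    dot-cong φ e = ∑-cong s λ q → *-congˡ (e q)

    dot-+ : ∀ (φ : Vec s) x y → dot φ (x +ᵛ y) ≈ dot φ x + dot φ y
    dot-+ φ x y = trans (∑-cong s λ q → distribˡ _ _ _) (∑-+ s _ _)

    dot-∙ : ∀ (φ : Vec s) a x → dot φ (a ∙ᵛ x) ≈ a * dot φ x
    dot-∙ φ a x = trans
      (∑-cong s λ q → solve 3 (λ f a x → f ⊛ (a ⊛ x) := a ⊛ (f ⊛ x)) refl (φ q) a (x q))
      (∑-*ˡ s a _)

    dot-0 : ∀ (φ : Vec s) → dot φ 0ᵛ ≈ 0#
    dot-0 φ = ∑-0 s λ q → zeroʳ _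

    ap-cong : ∀ (P : Op s) {x y} → x ≋ y → ap P x ≋ ap P y
    ap-cong P e p = dot-cong (λ q → P (p , q)) e

    ap-congˡ : ∀ {P Q : Op s} → P ≋ Q → ∀ x → ap P x ≋ ap Q x
    ap-congˡ e x p = ∑-cong s λ q → *-congʳ (e (p , q))

    ap-+ : ∀ (P : Op s) x y → ap P (x +ᵛ y) ≋ ap P x +ᵛ ap P y
    ap-+ P x y p = dot-+ (λ q → P (p , q)) x y

    ap-∙ : ∀ (P : Op s) a x → ap P (a ∙ᵛ x) ≋ a ∙ᵛ ap P x
    ap-∙ P a x p = dot-∙ (λ q → P (p , q)) a x

    ap-0 : ∀ (P : Op s) → ap P 0ᵛ ≋ 0ᵛ
    ap-0 P p = dot-0 (λ q → P (p , q))

    -1∙ : ∀ (x y : Vec s) → x +ᵛ (- 1#) ∙ᵛ y ≋ x -ᵛ y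
    -1∙ x y p = +-congˡ (trans (sym (-‿distribˡ-* 1# (y p))) (-‿cong (*-identityˡ (y p))))

    ap-- : ∀ (P : Op s) x y → ap P (x -ᵛ y) ≋ ap P x -ᵛ ap P y
    ap-- P x y p = begin
      ap P (x -ᵛ y) p                   ≈⟨ ap-cong P (-1∙ x y) p ⟨
      ap P (x +ᵛ (- 1#) ∙ᵛ y) p         ≈⟨ ap-+ P x _ p ⟩
      ap P x p + ap P ((- 1#) ∙ᵛ y) p   ≈⟨ +-congˡ (ap-∙ P (- 1#) y p) ⟩
      ap P x p + (- 1#) * ap P y p      ≈⟨ -1∙ (ap P x) (ap P y) p ⟩
      ap P x p - ap P y p               ∎

    infix 4 _∈_
    _∈_ : Vec s → Op s → Set ℓ₁
    x ∈ P = ap P x ≋ x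

    infix 4 _∈?_
    _∈?_ : ∀ (x : Vec s) (P : Op s) → Dec (x ∈ P)
    x ∈? P = ap P x ≋? x

    isSubspace-∈ : ∀ (P : Op s) → IsSubspace (_∈ P)
    isSubspace-∈ P = record
      { resp = λ e h p → trans (ap-cong P (λ q → sym (e q)) p) (trans (h p) (e p))
      ; null = ap-0 P
      ; add = λ {x} {y} h k p → trans (ap-+ P x y p) (+-cong (h p) (k p))
      ; scale = λ a {x} h p → trans (ap-∙ P a x p) (*-congˡ (h p))
      }

    IsProjection : Pred (Op s) (c ⊔ ℓ₁)
    IsProjection P = ∀ x → ap P x ∈ P

    ap-closed : ∀ {ℓ t} {X : Pred (Vec s) ℓ} → IsSubspace X → ∀ (P : Vec (s ⊗ t)) →
                (∀ j → X (col P j)) → ∀ (x : Vec t) → X (λ p → ∑ t λ q → P (p , q) * x q)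
    ap-closed {t = t} isX P h x = resp isX
      (λ p → ∑-cong t λ j → *-comm _ _) (∑-closed isX t x (col P) h)

    columns⊆ : ∀ {ℓ} {X : Pred (Vec s) ℓ} → IsSubspace X → ∀ P →
               (∀ j → X (col P j)) → (_∈ P) ⊆ X
    columns⊆ isX P h x x∈ = resp isX x∈ (ap-closed isX P h x)

    unitᵛ : Idx s → Vec s
    unitᵛ j i = eq s i j

    ap-unit : ∀ {t} (P : Vec (t ⊗ s)) j p → ∑ s (λ q → P (p , q) * unitᵛ j q) ≈ P (p , j)
    ap-unit P j p = ∑-eqʳ s j _

    column∈ : ∀ {P} → IsProjection P → ∀ j → col P j ∈ P
    column∈ {P} proj j = resp (isSubspace-∈ P) (ap-unit P j) (proj (unitᵛ j))

    1ᵒ 0ᵒ : Op s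
    1ᵒ (p , q) = eq s p q
    0ᵒ _ = 0#

    ap-1 : ∀ (x : Vec s) → x ∈ 1ᵒ
    ap-1 x p = ∑-eqˡ s p x

    ap-0ᵒ : ∀ (x : Vec s) → ap 0ᵒ x ≋ 0ᵛ
    ap-0ᵒ x p = ∑-0 s λ q → zeroˡ _

    0-isProjection : IsProjection 0ᵒ
    0-isProjection x p = trans (ap-0ᵒ _ p) (sym (ap-0ᵒ x p))

    1-isProjection : IsProjection 1ᵒ
    1-isProjection x = ap-1 _

    ∈0⇒≋0 : ∀ {x} → x ∈ 0ᵒ → x ≋ 0ᵛ
    ∈0⇒≋0 {x} x∈ p = trans (sym (x∈ p)) (ap-0ᵒ x p)

    0⊆ : ∀ {ℓ} {X : Pred (Vec s) ℓ} → IsSubspace X → (_∈ 0ᵒ) ⊆ X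
    0⊆ isX x x∈ = resp isX (λ p → sym (∈0⇒≋0 x∈ p)) (null isX)

    residue : Op s → Vec s → Vec s
    residue P u = u -ᵛ ap P u

    -- A rank one update; since 0⁻¹ = 0 it leaves P alone when the residue of u has a zero at i.
    insert₁ : Op s → Vec s → Idx s → Op s
    insert₁ P u i (p , q) = P (p , q) + residue P u p * (eq s i q - P (i , q)) * residue P u i ⁻¹

    -- No pivot is searched for. The first index at which the residue of `u` is nonzero brings `u`
    -- into the range; from then on the residue vanishes and the remaining updates act trivially.
    insert : Op s → Vec s → Op s
    insert P u = fold s (λ i Q → insert₁ Q u i) P

    ap-insert₁ : ∀ (P : Op s) (u : Vec s) (i : Idx s) (x : Vec s) →
      ap (insert₁ P u i) x ≋ ap P x +ᵛ (residue P u i ⁻¹ * residue P x i) ∙ᵛ residue P u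
    ap-insert₁ P u i x p = begin
      ∑ s (λ q → (P (p , q) + w p * (eq s i q - P (i , q)) * k) * x q)
        -- The coefficient `(0 , 1)` is the formal difference -1.
        ≈⟨ ∑-cong s (λ q → solve 6 (λ P w e R k x → (P ⊹ w ⊛ (e :- R) ⊛ k) ⊛ x :=
             P ⊛ x ⊹ (w ⊛ k) ⊛ (e ⊛ x) ⊹ (:con (0 , 1) ⊛ w ⊛ k) ⊛ (R ⊛ x)) refl
             (P (p , q)) (w p) (eq s i q) (P (i , q)) k (x q)) ⟩
      ∑ s (λ q → P (p , q) * x q + (w p * k) * (eq s i q * x q) + _ * (P (i , q) * x q))
        ≈⟨ trans (∑-+ s _ _) (+-cong (trans (∑-+ s _ _) (+-congˡ (∑-*ˡ s _ _))) (∑-*ˡ s _ _)) ⟩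
      ap P x p + (w p * k) * ∑ s (λ q → eq s i q * x q) + _ * ap P x i
        ≈⟨ +-congʳ (+-congˡ (*-congˡ (∑-eqˡ s i x))) ⟩
      ap P x p + (w p * k) * x i + _ * ap P x i
        ≈⟨ solve 5 (λ a w k x b → a ⊹ (w ⊛ k) ⊛ x ⊹ (:con (0 , 1) ⊛ w ⊛ k) ⊛ b :=
             a ⊹ (k ⊛ (x :- b)) ⊛ w) refl (ap P x p) (w p) k (x i) (ap P x i) ⟩
      ap P x p + (k * (x i - ap P x i)) * w p ∎
      where
      w = residue P u
      k = w i ⁻¹

    -- The upper bound `X` is a parameter: choosing it anew at each use expresses that the range of
    -- `Q` is the smallest possible.
    record Insertion {ℓ} (X : Pred (Vec s) ℓ) (P Q : Op s) : Set (c ⊔ ℓ₁ ⊔ ℓ) where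
      field
        isProjection : IsProjection Q
        larger       : (_∈ P) ⊆ (_∈ Q)
        least        : (_∈ Q) ⊆ X

    private
      unchanged : ∀ (P : Op s) (u : Vec s) (i : Idx s) → residue P u i ≈ 0# → ∀ x → ap
          (insert₁ P u i) x ≋ ap P x
      unchanged P u i w≈0 x p = trans (ap-insert₁ P u i x p) (trans
        (+-congˡ (trans (*-congʳ (trans (*-congʳ (reflexive (⁻¹-zero w≈0))) (zeroˡ _))) (zeroˡ _)))
        (+-identityʳ _))

      residue-0 : ∀ {P} → IsProjection P → ∀ x → ap P (residue P x) ≋ 0ᵛ
      residue-0 {P} proj x p = trans (ap-- P x _ p)
        (trans (+-congˡ (-‿cong (proj x p))) (-‿inverseʳ _))

      insert₁-∋ : ∀ (P : Op s) (u : Vec s) (i : Idx s) → ¬ residue P u i ≈ 0# → u ∈ insert₁ P u i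
      insert₁-∋ P u i w≉0 p = begin
        ap (insert₁ P u i) u p                          ≈⟨ ap-insert₁ P u i u p ⟩
        ap P u p + (w i ⁻¹ * w i) * (u p - ap P u p)    ≈⟨ +-congˡ
            (trans (*-congʳ (⁻¹-inverseˡ w≉0)) (*-identityˡ _)) ⟩
        ap P u p + (u p - ap P u p)                     ≈⟨ solve 2 (λ a u → a ⊹ (u :- a) := u) refl
            (ap P u p) (u p) ⟩
        u p                                             ∎
        where w = residue P u

    insert₁-spec : ∀ {ℓ} {X : Pred (Vec s) ℓ} → IsSubspace X → ∀ {P u} i → IsProjection P →
                   (_∈ P) ⊆ X → X u → Insertion X P (insert₁ P u i)
    insert₁-spec {X = X} isX {P} {u} i proj P⊆X u∈X = record
      { isProjection = idem
      ; larger = λ x x∈ p → trans (ap-insert₁ P u i x p) (trans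
          (+-cong (x∈ p) (trans (*-congʳ (trans (*-congˡ
              (trans (+-congˡ (-‿cong (x∈ i))) (-‿inverseʳ _))) (zeroʳ _))) (zeroˡ _)))
          (+-identityʳ _))
      ; least = λ x x∈ → resp isX (λ p → trans (sym (ap-insert₁ P u i x p)) (x∈ p))
          (add isX (P⊆X _ (proj x)) (scale isX _ (minus isX u∈X (P⊆X _ (proj u)))))
      }
      where
      Q = insert₁ P u i
      w = residue P u
      φ : Vec s → Carrier
      φ x = w i ⁻¹ * residue P x i

      idem : IsProjection Q
      idem x with w i ≈? 0#
      ... | yes w≈0 = λ p → trans (unchanged P u i w≈0 _ p)
              (trans (ap-cong P (unchanged P u i w≈0 x) p)
                  (trans (proj x p) (sym (unchanged P u i w≈0 x p))))
      -- `P` kills the residue of `u`, so applying `P` forgets the correction term, and coordinate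
      -- `i` recovers its coefficient.
      ... | no w≉0 = λ p → begin
        ap Q (ap Q x) p
          ≈⟨ ap-insert₁ P u i (ap Q x) p ⟩
        ap P (ap Q x) p + (w i ⁻¹ * (ap Q x i - ap P (ap Q x) i)) * w p
          ≈⟨ +-cong (collapse p) (*-congʳ (*-congˡ (+-cong (ap-insert₁ P u i x i)
              (-‿cong (collapse i))))) ⟩
        ap P x p + (w i ⁻¹ * (ap P x i + φ x * w i - ap P x i)) * w p
          ≈⟨ +-congˡ (*-congʳ (solve 4 (λ k a f w → k ⊛ (a ⊹ f ⊛ w :- a) := f ⊛ (k ⊛ w)) refl
              (w i ⁻¹) (ap P x i) (φ x) (w i))) ⟩
        ap P x p + (φ x * (w i ⁻¹ * w i)) * w p
          ≈⟨ +-congˡ (*-congʳ (trans (*-congˡ (⁻¹-inverseˡ w≉0)) (*-identityʳ _))) ⟩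
        ap P x p + φ x * w p
          ≈⟨ ap-insert₁ P u i x p ⟨
        ap Q x p ∎
        where
        collapse : ap P (ap Q x) ≋ ap P x
        collapse p = begin
          ap P (ap Q x) p                    ≈⟨ ap-cong P (ap-insert₁ P u i x) p ⟩
          ap P (ap P x +ᵛ φ x ∙ᵛ w) p        ≈⟨ trans (ap-+ P _ _ p) (+-congˡ (ap-∙ P (φ x) w p)) ⟩
          ap P (ap P x) p + φ x * ap P w p   ≈⟨ +-cong (proj x p)
              (trans (*-congˡ (residue-0 proj u p)) (zeroʳ _)) ⟩
          ap P x p + 0#                      ≈⟨ +-identityʳ _ ⟩
          ap P x p                           ∎

    Insertion-trans : ∀ {ℓ} {X : Pred (Vec s) ℓ} {P Q R} →
                      Insertion X P Q → Insertion X Q R → Insertion X P R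
    Insertion-trans a b = record
      { isProjection = isProjection b
      ; larger = λ x → larger b x ∘ larger a x
      ; least = least b
      }
      where open Insertion

    insert-spec : ∀ {ℓ} {X : Pred (Vec s) ℓ} → IsSubspace X → ∀ {P u} → IsProjection P →
                  (_∈ P) ⊆ X → X u → Insertion X P (insert P u)
    insert-spec {X = X} isX {P} {u} proj P⊆X u∈X =
      fold-preserves (Insertion X P) s
        (λ i Q h → Insertion-trans h
          (insert₁-spec isX i (Insertion.isProjection h) (Insertion.least h) u∈X))
        (record { isProjection = proj ; larger = λ _ → id ; least = P⊆X })

    -- The residue of `u` is zero at `p` at the latest when index `p` is treated: it vanishes there
    -- already, or the update makes it vanish everywhere. Later updates keep it zero.
    insert-∋ : ∀ (P : Op s) (u : Vec s) → u ∈ insert P u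
    insert-∋ P u p = sym (x-y≈0⇒x≈y (fold-reaches (λ _ → ⊤) (λ Q → residue Q u p ≈ 0#) s
      (λ _ _ _ → tt) stays p (λ Q _ → vanishes Q) {P} tt))
      where
      done : ∀ (Q : Op s) (i : Idx s) → ¬ residue Q u i ≈ 0# → ∀ q → residue
          (insert₁ Q u i) u q ≈ 0#
      done Q i w≉0 q = trans (+-congˡ (-‿cong (insert₁-∋ Q u i w≉0 q))) (-‿inverseʳ _)

      keeps : ∀ (Q : Op s) (i : Idx s) → residue Q u i ≈ 0# → residue
          (insert₁ Q u i) u ≋ residue Q u
      keeps Q i w≈0 q = +-congˡ (-‿cong (unchanged Q u i w≈0 u q))

      stays : ∀ i Q → ⊤ → residue Q u p ≈ 0# → residue (insert₁ Q u i) u p ≈ 0#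
      stays i Q _ h with residue Q u i ≈? 0#
      ... | yes w≈0 = trans (keeps Q i w≈0 p) h
      ... | no w≉0  = done Q i w≉0 p

      vanishes : ∀ (Q : Op s) → residue (insert₁ Q u p) u p ≈ 0#
      vanishes Q with residue Q u p ≈? 0#
      ... | yes w≈0 = trans (keeps Q p w≈0 p) w≈0
      ... | no w≉0  = done Q p w≉0 p

    insertAll : ∀ t → Op s → (Idx t → Vec s) → Op s
    insertAll t P u = fold t (λ j Q → insert Q (u j)) P

    insertAll-spec : ∀ {ℓ} {X : Pred (Vec s) ℓ} → IsSubspace X → ∀ t {P u} → IsProjection P →
                     (_∈ P) ⊆ X → (∀ j → X (u j)) → Insertion X P (insertAll t P u)
    insertAll-spec {X = X} isX t {P} {u} proj P⊆X u∈X =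
      fold-preserves (Insertion X P) t
        (λ j Q h → Insertion-trans h
          (insert-spec isX (Insertion.isProjection h) (Insertion.least h) (u∈X j)))
        (record { isProjection = proj ; larger = λ _ → id ; least = P⊆X })

    isSubspace-all : IsSubspace {ℓ = ℓ₁} {s} (λ _ → Lift ℓ₁ ⊤)
    isSubspace-all = _

    insertAll-⊇ : ∀ t {P} u → IsProjection P → (_∈ P) ⊆ (_∈ insertAll t P u)
    insertAll-⊇ t u proj = Insertion.larger (insertAll-spec isSubspace-all t proj (λ _ _ → _)
        (λ _ → _))

    insertAll-isProjection : ∀ t {P} u → IsProjection P → IsProjection (insertAll t P u)
    insertAll-isProjection t u proj =
      Insertion.isProjection (insertAll-spec isSubspace-all t proj (λ _ _ → _) (λ _ → _))

    insertAll-∋ : ∀ t {P} u → IsProjection P → ∀ j → u j ∈ insertAll t P u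
    insertAll-∋ t u proj j = fold-reaches IsProjection (u j ∈_) t
      (λ i Q p → Insertion.isProjection (insert-spec isSubspace-all {u = u i} p (λ _ _ → _) _))
      (λ i Q p → Insertion.larger (insert-spec isSubspace-all {u = u i} p (λ _ _ → _) _) (u j))
      j (λ Q _ → insert-∋ Q (u j)) proj

    -- Dual to `insert₁`: a multiple of column `j` is subtracted so that `φ` vanishes on the new
    -- range. If `φ` is already zero on that column, the convention 0⁻¹ = 0 makes the correction
    -- disappear.
    cut₁ : Op s → Vec s → Idx s → Op s
    cut₁ P φ j (p , q) = P (p , q) - P (p , j) * dot φ (col P q) * dot φ (col P j) ⁻¹

    cut : Op s → Vec s → Op s
    cut P φ = fold s (λ j Q → cut₁ Q φ j) P

    cutAll : ∀ t → Op s → (Idx t → Vec s) → Op s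
    cutAll t P φ = fold t (λ j Q → cut Q (φ j)) P

    private
      dot-ap : ∀ (φ : Vec s) (P : Op s) (x : Vec s) → ∑ s (λ q → dot φ (col P q) * x q) ≈ dot φ
          (ap P x)
      dot-ap φ P x = begin
        ∑ s (λ q → dot φ (col P q) * x q)                   ≈⟨ ∑-cong s (λ q → ∑-*ʳ s _ _) ⟨
        ∑ s (λ q → ∑ s (λ p → φ p * P (p , q) * x q))       ≈⟨ ∑-swap s s _ ⟩
        ∑ s (λ p → ∑ s (λ q → φ p * P (p , q) * x q))       ≈⟨ ∑-cong s
            (λ p → trans (∑-cong s λ q → *-assoc _ _ _) (∑-*ˡ s _ _)) ⟩
        dot φ (ap P x)                                      ∎

    ap-cut₁ : ∀ (P : Op s) (φ : Vec s) (j : Idx s) (x : Vec s) → ap (cut₁ P φ j) x ≋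
              ap P x -ᵛ (dot φ (col P j) ⁻¹ * dot φ (ap P x)) ∙ᵛ col P j
    ap-cut₁ P φ j x p = begin
      ∑ s (λ q → (P (p , q) - P (p , j) * dot φ (col P q) * k) * x q)
        ≈⟨ ∑-cong s (λ q → solve 5 (λ P R d k x → (P :- R ⊛ d ⊛ k) ⊛ x := P ⊛ x ⊹
            (:con (0 , 1) ⊛ R ⊛ k) ⊛ (d ⊛ x))
             refl (P (p , q)) (P (p , j)) (dot φ (col P q)) k (x q)) ⟩
      ∑ s (λ q → P (p , q) * x q + _ * (dot φ (col P q) * x q))
        ≈⟨ trans (∑-+ s _ _) (+-congˡ (trans (∑-*ˡ s _ _) (*-congˡ (dot-ap φ P x)))) ⟩
      ap P x p + _ * dot φ (ap P x)
        ≈⟨ solve 4 (λ a R k d → a ⊹ (:con (0 , 1) ⊛ R ⊛ k) ⊛ d := a :- (k ⊛ d) ⊛ R)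
             refl (ap P x p) (P (p , j)) k (dot φ (ap P x)) ⟩
      ap P x p - (k * dot φ (ap P x)) * P (p , j) ∎
      where k = dot φ (col P j) ⁻¹

    record Cut {ℓ} (X : Pred (Vec s) ℓ) (P Q : Op s) : Set (c ⊔ ℓ₁ ⊔ ℓ) where
      field
        isProjection : IsProjection Q
        smaller      : (_∈ Q) ⊆ (_∈ P)
        greatest     : X ⊆ (_∈ Q)

    private
      unchanged′ : ∀ (P : Op s) (φ : Vec s) (j : Idx s) → dot φ (col P j) ≈ 0# → ∀ x → ap
          (cut₁ P φ j) x ≋ ap P x
      unchanged′ P φ j w≈0 x p = trans (ap-cut₁ P φ j x p) (trans
        (+-congˡ (trans (-‿cong (trans (*-congʳ (trans (*-congʳ (reflexive (⁻¹-zero w≈0)))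
            (zeroˡ _))) (zeroˡ _))) -0#≈0#))
        (+-identityʳ _))

      cut₁-kills : ∀ (P : Op s) (φ : Vec s) (j : Idx s) → ¬ dot φ (col P j) ≈ 0# → ∀ x → dot φ
          (ap (cut₁ P φ j) x) ≈ 0#
      cut₁-kills P φ j w≉0 x = begin
        dot φ (ap (cut₁ P φ j) x)
          ≈⟨ dot-cong φ (λ p → trans (ap-cut₁ P φ j x p) (+-congˡ (-‿distribˡ-* _ _))) ⟩
        dot φ (ap P x +ᵛ (- (k * dot φ (ap P x))) ∙ᵛ col P j)
          ≈⟨ trans (dot-+ φ _ _) (+-congˡ (dot-∙ φ _ _)) ⟩
        dot φ (ap P x) + (- (k * dot φ (ap P x))) * dot φ (col P j)
          ≈⟨ solve 3 (λ d k w → d ⊹ (:- (k ⊛ d)) ⊛ w := d :- d ⊛ (k ⊛ w)) refl (dot φ (ap P x)) k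
              (dot φ (col P j)) ⟩
        dot φ (ap P x) - dot φ (ap P x) * (k * dot φ (col P j))
          ≈⟨ trans (+-congˡ (-‿cong (trans (*-congˡ (⁻¹-inverseˡ w≉0)) (*-identityʳ _))))
              (-‿inverseʳ _) ⟩
        0# ∎
        where k = dot φ (col P j) ⁻¹

    isSubspace-≋0 : IsSubspace {ℓ = ℓ₁} {s} (λ x → x ≋ 0ᵛ)
    isSubspace-≋0 = record
      { resp = λ e h p → trans (sym (e p)) (h p)
      ; null = λ _ → refl
      ; add = λ h k p → trans (+-cong (h p) (k p)) (+-identityˡ _)
      ; scale = λ a h p → trans (*-congˡ (h p)) (zeroʳ _)
      }

    isSubspace-ker : ∀ (φ : Vec s) → IsSubspace (λ x → dot φ x ≈ 0#)
    isSubspace-ker φ = record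
      { resp = λ e h → trans (dot-cong φ (λ p → sym (e p))) h
      ; null = dot-0 φ
      ; add = λ h k → trans (dot-+ φ _ _) (trans (+-cong h k) (+-identityˡ _))
      ; scale = λ a h → trans (dot-∙ φ a _) (trans (*-congˡ h) (zeroʳ a))
      }

    cut₁-spec : ∀ {ℓ} {X : Pred (Vec s) ℓ} {P : Op s} {φ} (j : Idx s) → IsProjection P →
                X ⊆ (_∈ P) → X ⊆ (λ x → dot φ x ≈ 0#) → Cut X P (cut₁ P φ j)
    cut₁-spec {X = X} {P} {φ} j proj X⊆P X⊆ker = record
      { isProjection = idem
      ; smaller = smaller
      ; greatest = λ x x∈ → fixes (X⊆P x x∈) (X⊆ker x x∈)
      }
      where
      Q = cut₁ P φ j

      range : ∀ x → ap Q x ∈ P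
      range x = resp (isSubspace-∈ P) (λ p → sym (ap-cut₁ P φ j x p))
        (minus (isSubspace-∈ P) (proj x) (scale (isSubspace-∈ P) _ (column∈ proj j)))

      smaller : (_∈ Q) ⊆ (_∈ P)
      smaller x x∈ = resp (isSubspace-∈ P) x∈ (range x)

      fixes : ∀ {x} → x ∈ P → dot φ x ≈ 0# → x ∈ Q
      fixes {x} x∈ h p = trans (ap-cut₁ P φ j x p) (trans
        (+-cong (x∈ p) (trans (-‿cong (trans (*-congʳ
            (trans (*-congˡ (trans (dot-cong φ x∈) h)) (zeroʳ _))) (zeroˡ _))) -0#≈0#))
        (+-identityʳ _))

      idem : IsProjection Q
      idem x with dot φ (col P j) ≈? 0#
      ... | yes w≈0 = λ p → trans (unchanged′ P φ j w≈0 _ p)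
              (trans (ap-cong P (unchanged′ P φ j w≈0 x) p)
                  (trans (proj x p) (sym (unchanged′ P φ j w≈0 x p))))
      ... | no w≉0 = fixes (range x) (cut₁-kills P φ j w≉0 x)

    Cut-trans : ∀ {ℓ} {X : Pred (Vec s) ℓ} {P Q R} → Cut X P Q → Cut X Q R → Cut X P R
    Cut-trans a b = record
      { isProjection = isProjection b
      ; smaller = λ x → smaller a x ∘ smaller b x
      ; greatest = greatest b
      }
      where open Cut

    cut-spec : ∀ {ℓ} {X : Pred (Vec s) ℓ} {P : Op s} {φ} → IsProjection P →
               X ⊆ (_∈ P) → X ⊆ (λ x → dot φ x ≈ 0#) → Cut X P (cut P φ)
    cut-spec {X = X} {P} {φ} proj X⊆P X⊆ker =
      fold-preserves (Cut X P) s
        (λ j Q h → Cut-trans h (cut₁-spec j (Cut.isProjection h) (Cut.greatest h) X⊆ker))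
        (record { isProjection = proj ; smaller = λ _ → id ; greatest = X⊆P })

    cut-kills : ∀ (P : Op s) φ → (_∈ cut P φ) ⊆ (λ x → dot φ x ≈ 0#)
    cut-kills P φ = columns⊆ (isSubspace-ker φ) (cut P φ) λ j →
      fold-reaches (λ _ → ⊤) (λ Q → dot φ (col Q j) ≈ 0#) s (λ _ _ _ → tt)
        (λ i Q _ → stays j i Q) j (λ Q _ → vanishes j Q) {P} tt
      where
      killed : ∀ (Q : Op s) i j → ¬ dot φ (col Q i) ≈ 0# → dot φ (col (cut₁ Q φ i) j) ≈ 0#
      killed Q i j w≉0 = trans (dot-cong φ (λ p → sym (ap-unit (cut₁ Q φ i) j p)))
        (cut₁-kills Q φ i w≉0 (unitᵛ j))

      keeps : ∀ (Q : Op s) i j → dot φ (col Q i) ≈ 0# → col (cut₁ Q φ i) j ≋ col Q j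
      keeps Q i j w≈0 p = trans (sym (ap-unit (cut₁ Q φ i) j p))
        (trans (unchanged′ Q φ i w≈0 (unitᵛ j) p) (ap-unit Q j p))

      stays : ∀ j i (Q : Op s) → dot φ (col Q j) ≈ 0# → dot φ (col (cut₁ Q φ i) j) ≈ 0#
      stays j i Q h with dot φ (col Q i) ≈? 0#
      ... | yes w≈0 = trans (dot-cong φ (keeps Q i j w≈0)) h
      ... | no w≉0  = killed Q i j w≉0

      vanishes : ∀ j (Q : Op s) → dot φ (col (cut₁ Q φ j) j) ≈ 0#
      vanishes j Q with dot φ (col Q j) ≈? 0#
      ... | yes w≈0 = trans (dot-cong φ (keeps Q j j w≈0)) w≈0
      ... | no w≉0  = killed Q j j w≉0

    cutAll-spec : ∀ {ℓ} {X : Pred (Vec s) ℓ} t {P : Op s} {φ} → IsProjection P →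
                  X ⊆ (_∈ P) → (∀ j → X ⊆ (λ x → dot (φ j) x ≈ 0#)) → Cut X P (cutAll t P φ)
    cutAll-spec {X = X} t {P} {φ} proj X⊆P X⊆ker =
      fold-preserves (Cut X P) t
        (λ j Q h → Cut-trans h (cut-spec (Cut.isProjection h) (Cut.greatest h) (X⊆ker j)))
        (record { isProjection = proj ; smaller = λ _ → id ; greatest = X⊆P })

    cutAll-isProjection : ∀ t {P : Op s} φ → IsProjection P → IsProjection (cutAll t P φ)
    cutAll-isProjection t φ proj =
      -- The zero subspace is contained in every kernel, so it can serve as the subspace to be
      -- preserved.
      Cut.isProjection (cutAll-spec {X = λ x → x ≋ 0ᵛ} t proj
        (λ x e → resp (isSubspace-∈ _) (λ p → sym (e p)) (null (isSubspace-∈ _)))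
        (λ j x e → trans (dot-cong (φ j) e) (dot-0 (φ j))))

    cutAll-⊆ : ∀ t {P : Op s} φ → IsProjection P → (_∈ cutAll t P φ) ⊆ (_∈ P)
    cutAll-⊆ t φ proj =
      Cut.smaller (cutAll-spec {X = λ x → x ≋ 0ᵛ} t proj
        (λ x e → resp (isSubspace-∈ _) (λ p → sym (e p)) (null (isSubspace-∈ _)))
        (λ j x e → trans (dot-cong (φ j) e) (dot-0 (φ j))))

    cutAll-kills : ∀ t {P : Op s} φ → IsProjection P → ∀ j {x} → x ∈ cutAll t P φ → dot (φ j) x ≈ 0#
    cutAll-kills t φ proj j {x} = fold-reaches IsProjection
        (λ Q → (_∈ Q) ⊆ (λ x → dot (φ j) x ≈ 0#)) t
      (λ i Q p → cutAll-isProjection unit (λ _ → φ i) p)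
      (λ i Q p h x x∈ → h x (cutAll-⊆ unit (λ _ → φ i) p x x∈))
      j (λ Q p → cut-kills Q (φ j)) proj x

    cutAll-∋ : ∀ t {P : Op s} φ → IsProjection P → ∀ {x} → x ∈ P → (∀ j → dot (φ j) x ≈ 0#) →
               x ∈ cutAll t P φ
    cutAll-∋ t {P} φ proj {x} x∈ h = Cut.greatest
      (cutAll-spec {X = λ y → y ∈ P × (∀ j → dot (φ j) y ≈ 0#)} t proj (λ _ → proj₁)
          (λ j _ q → proj₂ q j))
      x (x∈ , h)

    record Representation {ℓ} (X : Pred (Vec s) ℓ) : Set (c ⊔ ℓ₁ ⊔ ℓ) where
      field
        projection   : Op s
        isProjection : IsProjection projection
        sound        : (_∈ projection) ⊆ X
        complete     : X ⊆ (_∈ projection)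

      member? : ∀ x → Dec (X x)
      member? x = map′ (sound x) (complete x) (x ∈? projection)

    -- Turns membership in a span into an equality test of vectors. Extracting a basis from a list
    -- depends on this decision.
    representation : ∀ {ℓ} {B : Pred (Vec s) ℓ} → IsSubspace B → Representation B →
                     ∀ ys → Representation (Span B ys)
    representation isB r [] = record
      { projection = projection
      ; isProjection = isProjection
      ; sound = λ x x∈ → base (sound x x∈)
      ; complete = λ { x (base b) → complete x b }
      }
      where open Representation r
    representation isB r (y ∷ ys) = record
      { projection = insert projection y
      ; isProjection = Insertion.isProjection spec
      ; sound = Insertion.least spec
      ; complete = λ { x (a ∷ p) → add⁻ (isSubspace-∈ _) (Insertion.larger spec _ (complete _ p))
          (scale (isSubspace-∈ _) a (insert-∋ projection y)) }
      }
      where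
      open Representation (representation isB r ys)
      open Spans isB
      spec = insert-spec (isSpan (y ∷ ys)) {u = y} isProjection (λ x → Span-∷ x ∘ sound x) head∈Span

    ∈-representation : ∀ {P : Op s} → IsProjection P → Representation (_∈ P)
    ∈-representation proj = record
      { projection = _ ; isProjection = proj ; sound = λ _ → id ; complete = λ _ → id }

    columns : Op s → List (Vec s)
    columns P = map (col P) (enum s)

    columns-∈ : ∀ {ℓ} {X : Pred (Vec s) ℓ} P → All X (columns P) → ∀ j → X (col P j)
    columns-∈ P h j = All.lookup h (∈ₚ.∈-map⁺ (col P) (∈-enum s j))

    All-columns : ∀ {ℓ} {X : Pred (Vec s) ℓ} P → (∀ j → X (col P j)) → All X (columns P)
    All-columns P h = Allₚ.map⁺ (All.tabulate λ {j} _ → h j)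

    private
      0-subspace : IsSubspace (_∈ 0ᵒ)
      0-subspace = isSubspace-∈ 0ᵒ

      module S₀ = Spans 0-subspace

    abstract
      dimension-basis : ∀ P → S₀.Basis (columns P)
      dimension-basis P = S₀.basis
        (λ zs → Representation.member? (representation 0-subspace
            (∈-representation 0-isProjection) zs))
        (columns P)

    dimension : Op s → ℕ
    dimension P = length (S₀.Basis.vectors (dimension-basis P))

    private
      module DB P = S₀.Basis (dimension-basis P)

      ∈⇒Span : ∀ P → (_∈ P) ⊆ Span (_∈ 0ᵒ) (DB.vectors P)
      ∈⇒Span P = columns⊆ (S₀.isSpan _) P (columns-∈ P (DB.spans P))

      basis-∈ : ∀ {P} → IsProjection P → All (_∈ P) (DB.vectors P)
      basis-∈ {P} proj = All.map (All.lookup (All-columns {X = _∈ P} P (column∈ proj)))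
          (DB.subset P)

    dimension-mono : ∀ {P Q} → IsProjection P → (_∈ P) ⊆ (_∈ Q) → dimension P ℕ.≤ dimension Q
    dimension-mono {P} {Q} proj P⊆Q = S₀.steinitz (DB.vectors Q) (DB.independent P)
      (All.map (λ v∈ → ∈⇒Span Q _ (P⊆Q _ v∈)) (basis-∈ proj))

    dimension-strict : ∀ {P Q} → IsProjection P → (_∈ P) ⊆ (_∈ Q) → ∀ {x} → x ∈ Q → ¬ x ∈ P →
                       dimension P ℕ.< dimension Q
    dimension-strict {P} {Q} proj P⊆Q x∈ x∉ = S₀.steinitz (DB.vectors Q)
      ((λ p → x∉ (S₀.Span-least (isSubspace-∈ P) (0⊆ (isSubspace-∈ P)) (basis-∈ proj) _ p))
        ∷ DB.independent P)
      (∈⇒Span Q _ x∈ ∷ All.map (λ v∈ → ∈⇒Span Q _ (P⊆Q _ v∈)) (basis-∈ proj))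

    dimension-≤ : ∀ P → dimension P ℕ.≤ card s
    dimension-≤ P = ≡.subst (dimension P ℕ.≤_)
        (≡.trans (Listₚ.length-map (col 1ᵒ) (enum s)) (length-enum s))
      (S₀.steinitz (columns 1ᵒ) (DB.independent P) (All.tabulate λ {v} _ → every v))
      where
      every : ∀ v → Span (_∈ 0ᵒ) (columns 1ᵒ) v
      every v = columns⊆ (S₀.isSpan _) 1ᵒ (columns-∈ 1ᵒ (All.tabulate S₀.∈-Span)) v (ap-1 v)

    dimension-< : ∀ {P} → IsProjection P → ∀ {x} → ¬ x ∈ P → dimension P ℕ.< card s
    dimension-< {P} proj {x} x∉ = ℕₚ.<-≤-trans
      (dimension-strict {Q = 1ᵒ} proj (λ y _ → ap-1 y) (ap-1 x) x∉) (dimension-≤ 1ᵒ)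

-- Programs carrying a polynomial time bound

infixr 4 _⨾ₜ_

record Timed : Set where
  constructor _within_
  field
    program : Program
    bound   : Polynomial

skipₜ : Timed
skipₜ = skip within con 1

assign : ℕ → ℕExp → Timed
assign r e = (reg (lit r) ≔ e) within con (2 ℕ.+ costℕ e)

store : ℕExp → ℕExp → ℕExp → FExp → Timed
store e f g x = (cell⟨ e , f , g ⟩≔ x) within con
    (1 ℕ.+ costℕ e ℕ.+ costℕ f ℕ.+ costℕ g ℕ.+ costF x)

_⨾ₜ_ : Timed → Timed → Timed
(P within p) ⨾ₜ (Q within q) = (P ⨾ Q) within (p :+ q)

condₜ : Test → Timed → Timed → Timed
condₜ b (P within p) (Q within q) = cond b P Q within ((con (1 ℕ.+ costT b) :+ p) :+ q)

for : ℕ → ℕExp → Polynomial → Timed → Timed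
for r e size (P within p) =
  (reg (lit r) ≔ lit 0 ⨾ while (reg (lit r) <ᵗ e) (P ⨾ reg (lit r) ≔ (reg (lit r) ⊕ lit 1)))
  -- Clearing the counter costs 3, incrementing it 6, and each test, the last failing one included,
  -- 4 plus the cost of `e`.
  within (con 3 :+ ((size :* (con (4 ℕ.+ costℕ e) :+ (p :+ con 6))) :+ con (4 ℕ.+ costℕ e)))

module Execution {c ℓ₁ ℓ₂} (F : DiscreteField c ℓ₁ ℓ₂) (m n : ℕ) where
  open DiscreteField F using (Carrier)
  open Semantics F public
  open Timed
  open Indices m n

  record Runs {q} (P : Timed) (σ : State) (Q : State → Set q) : Set (c ⊔ q) where
    constructor runs
    field
      {τ}      : State
      {t}      : ℕ
      run      : program P , σ ⇓ τ cost t
      in-time  : t ℕ.≤ evalPolynomial (bound P) m n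
      holds    : Q τ

  module _ {q} {Q : State → Set q} where

    run-skip : ∀ {σ} → Q σ → Runs skipₜ σ Q
    run-skip h = runs ⇓skip ℕₚ.≤-refl h

    run-assign : ∀ {r e σ} → Q (setRegister r (evalℕ e σ) σ) → Runs (assign r e) σ Q
    run-assign h = runs ⇓reg ℕₚ.≤-refl h

    run-store : ∀ {e f g x σ} → Q (setCell (evalℕ e σ) (evalℕ f σ) (evalℕ g σ) (evalF x σ) σ) →
                Runs (store e f g x) σ Q
    run-store h = runs ⇓cell ℕₚ.≤-refl h

    run-⨾ : ∀ {P R σ} → Runs P σ (λ τ → Runs R τ Q) → Runs (P ⨾ₜ R) σ Q
    run-⨾ (runs p s≤ (runs r t≤ h)) = runs (⇓seq p r) (ℕₚ.+-mono-≤ s≤ t≤) h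

    run-cond-true : ∀ {b P R σ} → evalT b σ ≡ true → Runs P σ Q → Runs (condₜ b P R) σ Q
    run-cond-true {b} e (runs p t≤ h) = runs (⇓if-true e p)
      (ℕₚ.≤-trans (ℕₚ.+-monoʳ-≤ (1 ℕ.+ costT b) t≤) (ℕₚ.m≤m+n _ _)) h

    run-cond-false : ∀ {b P R σ} → evalT b σ ≡ false → Runs R σ Q → Runs (condₜ b P R) σ Q
    run-cond-false {b} e (runs p t≤ h) = runs (⇓if-false e p)
      (ℕₚ.+-mono-≤ (ℕₚ.m≤m+n (1 ℕ.+ costT b) _) t≤) h

    run-mono : ∀ {r} {R : State → Set r} {P σ} → (∀ {τ} → R τ → Q τ) → Runs P σ R → Runs P σ Q
    run-mono f (runs p t≤ h) = runs p t≤ (f h)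

  ≡ᵇ-refl : ∀ k → (k ℕ.≡ᵇ k) ≡ true
  ≡ᵇ-refl zero    = ≡.refl
  ≡ᵇ-refl (suc k) = ≡ᵇ-refl k

  ≢⇒≡ᵇ : ∀ {k l} → k ≢ l → (k ℕ.≡ᵇ l) ≡ false
  ≢⇒≡ᵇ {zero}  {zero}  k≢l = contradiction ≡.refl k≢l
  ≢⇒≡ᵇ {zero}  {suc l} k≢l = ≡.refl
  ≢⇒≡ᵇ {suc k} {zero}  k≢l = ≡.refl
  ≢⇒≡ᵇ {suc k} {suc l} k≢l = ≢⇒≡ᵇ (k≢l ∘ ≡.cong suc)

  <⇒<ᵇ≡true : ∀ {k l} → k ℕ.< l → (k ℕ.<ᵇ l) ≡ true
  <⇒<ᵇ≡true {zero}  {suc l} _         = ≡.refl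
  <⇒<ᵇ≡true {suc k} {suc l} (s≤s k<l) = <⇒<ᵇ≡true k<l

  ≥⇒<ᵇ≡false : ∀ {k l} → l ℕ.≤ k → (k ℕ.<ᵇ l) ≡ false
  ≥⇒<ᵇ≡false {k}     {zero}  _         = ≡.refl
  ≥⇒<ᵇ≡false {suc k} {suc l} (s≤s l≤k) = ≥⇒<ᵇ≡false l≤k

  register-set : ∀ r {v} σ → registers (setRegister r v σ) r ≡ v
  register-set r σ rewrite ≡ᵇ-refl r = ≡.refl

  register-other : ∀ {r s v} σ → s ≢ r → registers (setRegister r v σ) s ≡ registers σ s
  register-other σ s≢r rewrite ≢⇒≡ᵇ s≢r = ≡.refl

  cell-set : ∀ k i j {v} σ → cells (setCell k i j v σ) k i j ≡ v
  cell-set k i j σ rewrite ≡ᵇ-refl k | ≡ᵇ-refl i | ≡ᵇ-refl j = ≡.refl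

  cell-other : ∀ {k i j v k′ i′ j′} σ → k′ ≢ k ⊎ i′ ≢ i →
               cells (setCell k i j v σ) k′ i′ j′ ≡ cells σ k′ i′ j′
  cell-other σ (inj₁ k≢) rewrite ≢⇒≡ᵇ k≢ = ≡.refl
  cell-other {k} {i} {j} {v} {k′} σ (inj₂ i≢) rewrite ≢⇒≡ᵇ i≢ | ∧-zeroʳ (k′ ℕ.≡ᵇ k) = ≡.refl

  module _ {x p} {X : Set x} (J : X → State → Set p)
           {r : ℕ} {e : ℕExp} {N : ℕ} {size : Polynomial} {P : Timed}
           (size-ok : evalPolynomial size m n ≡ N)
           (stable : ∀ {a v σ} → J a σ → J a (setRegister r v σ))
           (limit : ∀ {a σ} → J a σ → evalℕ e σ ≡ N) where

    private
      test : Test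
      test = reg (lit r) <ᵗ e

      body : Timed
      body = P ⨾ₜ assign r (reg (lit r) ⊕ lit 1)

      cost : ℕ
      cost = 4 ℕ.+ costℕ e ℕ.+ evalPolynomial (bound body) m n

    -- The induction is on the number `k` of rounds left, with `c` rounds done. The counter lies
    -- outside `J`: `stable` lets it be changed, and the body has to return it with its old value.
    run-while : ∀ k c (g : Fin k → X → X) → c ℕ.+ k ≡ N →
      (∀ i {a σ} → J a σ → registers σ r ≡ c ℕ.+ toℕ i →
         Runs P σ (λ τ → J (g i a) τ × registers τ r ≡ c ℕ.+ toℕ i)) →
      ∀ {a σ} → J a σ → registers σ r ≡ c →
      ∃[ τ ] ∃[ t ] (while test (program body) , σ ⇓ τ cost t) ×
        t ℕ.≤ k ℕ.* cost ℕ.+ (4 ℕ.+ costℕ e) × J (foldFin k g a) τ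
    run-while zero c g c+k≡N h {σ = σ} ja rc = _ , _ , ⇓while-false test-false , ℕₚ.≤-refl , ja
      where
      test-false : evalT test σ ≡ false
      test-false = ≥⇒<ᵇ≡false (ℕₚ.≤-reflexive
        (≡.trans (limit ja) (≡.trans (≡.sym c+k≡N) (≡.trans (ℕₚ.+-identityʳ c) (≡.sym rc)))))
    run-while (suc k) c g c+k≡N h {σ = σ} ja rc
      with h zero ja (≡.trans rc (≡.sym (ℕₚ.+-identityʳ c)))
    ... | runs {τ} {t} p t≤ (jτ , rτ)
      with run-while k (suc c) (g ∘ suc) (≡.trans (≡.sym (ℕₚ.+-suc c k)) c+k≡N)
             (λ i ja rc → run-mono (λ (j , r) → j , ≡.trans r (ℕₚ.+-suc c (toℕ i)))
               (h (suc i) ja (≡.trans rc (≡.sym (ℕₚ.+-suc c (toℕ i))))))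
             (stable jτ) (≡.trans (register-set r τ) (≡.trans
                 (≡.cong (ℕ._+ 1) (≡.trans rτ (ℕₚ.+-identityʳ c))) (ℕₚ.+-comm c 1)))
    ... | υ , u , q , u≤ , jυ = υ , _ , ⇓while-true test-true (⇓seq p ⇓reg) q , bounded , jυ
      where
      test-true : evalT test σ ≡ true
      test-true = <⇒<ᵇ≡true (≡.subst₂ ℕ._<_ (≡.sym rc) (≡.trans c+k≡N (≡.sym (limit ja)))
        (ℕₚ.m<m+n c (s≤s z≤n)))

      bounded : 1 ℕ.+ costT test ℕ.+ (t ℕ.+ 6) ℕ.+ u ℕ.≤ suc k ℕ.* cost ℕ.+ (4 ℕ.+ costℕ e)
      bounded = ℕₚ.≤-trans
        (ℕₚ.+-mono-≤ (ℕₚ.+-monoʳ-≤ (4 ℕ.+ costℕ e) (ℕₚ.+-monoˡ-≤ 6 t≤)) u≤)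
        (ℕₚ.≤-reflexive (≡.sym (ℕₚ.+-assoc cost (k ℕ.* cost) _)))

    run-for : (g : Fin N → X → X) →
      (∀ i {a σ} → J a σ → registers σ r ≡ toℕ i →
         Runs P σ (λ τ → J (g i a) τ × registers τ r ≡ toℕ i)) →
      ∀ {a σ} → J a σ → Runs (for r e size P) σ (J (foldFin N g a))
    run-for g h {σ = σ} ja with run-while N 0 g ≡.refl h (stable ja) (register-set r σ)
    ... | τ , t , p , t≤ , jτ = runs (⇓seq ⇓reg p) (ℕₚ.+-monoʳ-≤ 3 bounded) jτ
      where
      bounded : t ℕ.≤ evalPolynomial size m n ℕ.* cost ℕ.+ (4 ℕ.+ costℕ e)
      bounded = ≡.subst (λ k → t ℕ.≤ k ℕ.* cost ℕ.+ (4 ℕ.+ costℕ e)) (≡.sym size-ok) t≤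

-- A language of arrays with bounded loops, and its denotation

infix 4 _∋_

data _∋_ : List Shape → Shape → Set where
  here  : ∀ {Γ t} → (t ∷ Γ) ∋ t
  there : ∀ {Γ t u} → Γ ∋ t → (u ∷ Γ) ∋ t

lookup : ∀ {a} {A : Shape → Set a} {Γ t} → Γ ∋ t → All A Γ → A t
lookup here      (x ∷ _)  = x
lookup (there v) (_ ∷ xs) = lookup v xs

data Index (Δ : List Shape) : Shape → Set where
  var  : ∀ {t} → Δ ∋ t → Index Δ t
  lit  : Fin 4 → Index Δ (dim 𝟜)
  _,_  : ∀ {t u} → Index Δ t → Index Δ u → Index Δ (t ⊗ u)
  fst  : ∀ {t u} → Index Δ (t ⊗ u) → Index Δ t
  snd  : ∀ {t u} → Index Δ (t ⊗ u) → Index Δ u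

infixl 6 _+ₑ_ _-ₑ_
infixl 7 _*ₑ_ _/ₑ_

-- Γ lists the shapes of the arrays in scope, Δ those of the loop indices.
data Exp (Γ Δ : List Shape) : Shape → Set where
  zeroₑ oneₑ : Exp Γ Δ unit
  _+ₑ_ _-ₑ_ _*ₑ_ _/ₑ_ : Exp Γ Δ unit → Exp Γ Δ unit → Exp Γ Δ unit
  read   : ∀ {t} → Γ ∋ t → Index Δ t → Exp Γ Δ unit
  input  : Index Δ 𝑚ˢ → Index Δ 𝑛ˢ → Index Δ 𝑛ˢ → Exp Γ Δ unit
  δ      : ∀ {d} → Index Δ (dim d) → Index Δ (dim d) → Exp Γ Δ unit
  tab    : ∀ {t} → Exp Γ (t ∷ Δ) unit → Exp Γ Δ t
  sum    : ∀ r → Exp Γ (r ∷ Δ) unit → Exp Γ Δ unit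
  -- choose r flag value default: the value at the last index where the flag is nonzero.
  choose : ∀ {t} r → Exp Γ (r ∷ Δ) unit → Exp Γ (r ∷ Δ) t → Exp Γ Δ t → Exp Γ Δ t
  iter   : ∀ {t} r → Exp Γ Δ t → Exp (t ∷ Γ) (r ∷ Δ) t → Exp Γ Δ t
  bind   : ∀ {t u} → Exp Γ Δ t → Exp (t ∷ Γ) Δ u → Exp Γ Δ u
  -- A procedure has contexts of its own and is applied through a renaming. Compilation inlines it,
  -- so there is no recursion to be bounded.
  call   : ∀ {Γ′ Δ′ t} → Exp Γ′ Δ′ t → All (Γ ∋_) Γ′ → All (Index Δ) Δ′ → Exp Γ Δ t

module Denotation {c ℓ₁ ℓ₂} (F : DiscreteField c ℓ₁ ℓ₂) (m n : ℕ)
                  (S : Vector (MatrixModule.Matrix F n) m) where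
  open LinearAlgebra F m n

  Arrays : List Shape → Set c
  Arrays = All Vec

  Indexes : List Shape → Set
  Indexes = All Idx

  ⟦_⟧ᵢ : ∀ {Δ t} → Index Δ t → Indexes Δ → Idx t
  ⟦ var v ⟧ᵢ η = lookup v η
  ⟦ lit k ⟧ᵢ η = k
  ⟦ i , j ⟧ᵢ η = ⟦ i ⟧ᵢ η , ⟦ j ⟧ᵢ η
  ⟦ fst i ⟧ᵢ η = proj₁ (⟦ i ⟧ᵢ η)
  ⟦ snd i ⟧ᵢ η = proj₂ (⟦ i ⟧ᵢ η)

  arrays : ∀ {Γ Γ′} → All (Γ ∋_) Γ′ → Arrays Γ → Arrays Γ′
  arrays []       ρ = []
  arrays (v ∷ vs) ρ = lookup v ρ ∷ arrays vs ρ

  indexes : ∀ {Δ Δ′} → All (Index Δ) Δ′ → Indexes Δ → Indexes Δ′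
  indexes []       η = []
  indexes (i ∷ is) η = ⟦ i ⟧ᵢ η ∷ indexes is η

  ⟦_⟧ : ∀ {Γ Δ t} → Exp Γ Δ t → Arrays Γ → Indexes Δ → Vec t
  ⟦ zeroₑ ⟧ ρ η _ = 0#
  ⟦ oneₑ ⟧ ρ η _ = 1#
  ⟦ a +ₑ b ⟧ ρ η _ = ⟦ a ⟧ ρ η tt + ⟦ b ⟧ ρ η tt
  ⟦ a -ₑ b ⟧ ρ η _ = ⟦ a ⟧ ρ η tt - ⟦ b ⟧ ρ η tt
  ⟦ a *ₑ b ⟧ ρ η _ = ⟦ a ⟧ ρ η tt * ⟦ b ⟧ ρ η tt
  ⟦ a /ₑ b ⟧ ρ η _ = ⟦ a ⟧ ρ η tt * ⟦ b ⟧ ρ η tt ⁻¹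
  ⟦ read v i ⟧ ρ η _ = lookup v ρ (⟦ i ⟧ᵢ η)
  ⟦ input k i j ⟧ ρ η _ = S (⟦ k ⟧ᵢ η) (⟦ i ⟧ᵢ η) (⟦ j ⟧ᵢ η)
  ⟦ δ {d} i j ⟧ ρ η _ = eq (dim d) (⟦ i ⟧ᵢ η) (⟦ j ⟧ᵢ η)
  ⟦ tab e ⟧ ρ η i = ⟦ e ⟧ ρ (i ∷ η) tt
  ⟦ sum r e ⟧ ρ η _ = ∑ r λ i → ⟦ e ⟧ ρ (i ∷ η) tt
  ⟦ choose r f v d ⟧ ρ η = fold r
    (λ i a → if ⟦ f ⟧ ρ (i ∷ η) tt ≈ᵇ 0# then a else ⟦ v ⟧ ρ (i ∷ η)) (⟦ d ⟧ ρ η)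
  ⟦ iter r e b ⟧ ρ η = fold r (λ i a → ⟦ b ⟧ (a ∷ ρ) (i ∷ η)) (⟦ e ⟧ ρ η)
  ⟦ bind e b ⟧ ρ η = ⟦ b ⟧ (⟦ e ⟧ ρ η ∷ ρ) η
  ⟦ call e vs is ⟧ ρ η = ⟦ e ⟧ (arrays vs ρ) (indexes is η)

-- Compilation into while programs

Code : Shape → Set
Code unit    = ⊤
Code (dim d) = ℕExp
Code (t ⊗ u) = Code t × Code u

sizeₑ : Dim → ℕExp
sizeₑ 𝑚 = reg (lit 0)
sizeₑ 𝑛 = reg (lit 1)
sizeₑ 𝟜 = lit 4

sizeₚ : Dim → Polynomial
sizeₚ 𝑚 = 𝐦
sizeₚ 𝑛 = 𝐧
sizeₚ 𝟜 = con 4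

module Compilation where

  -- Array number u is stored in the cells with first coordinate m + u.
  array : ℕ → ℕExp
  array u = reg (lit 0) ⊕ lit u

  scalar : ℕ → FExp
  scalar u = cell (array u) (lit 0) (lit 0)

  setScalar : ℕ → FExp → Timed
  setScalar u = store (array u) (lit 0) (lit 0)

  index : ∀ {Δ t} → Index Δ t → All Code Δ → Code t
  index (var v) κ = lookup v κ
  index (lit k) κ = lit (toℕ k)
  index (i , j) κ = index i κ , index j κ
  index (fst i) κ = proj₁ (index i κ)
  index (snd i) κ = proj₂ (index i κ)

  -- Registers from l on are free.  Register l accumulates the digits of an
  -- index in base m + n + 4, which exceeds every dimension.
  digits : ∀ t → Code t → ℕ → Timed
  digits unit    _       l = skipₜ
  digits (dim d) e       l =
    assign (1 ℕ.+ l) (lit 0) ⨾ₜ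
    -- Programs have no multiplication of natural numbers, so multiplying by the radix is repeated
    -- addition.
    for (2 ℕ.+ l) ((reg (lit 0) ⊕ reg (lit 1)) ⊕ lit 4) ((𝐦 :+ 𝐧) :+ con 4)
      (assign (1 ℕ.+ l) (reg (lit (1 ℕ.+ l)) ⊕ reg (lit l))) ⨾ₜ
    assign l (reg (lit (1 ℕ.+ l)) ⊕ e)
  digits (t ⊗ u) (a , b) l = digits t a l ⨾ₜ digits u b l

  address : ∀ t → Code t → ℕ → Timed
  address t a l = assign l (lit 0) ⨾ₜ digits t a l

  forEach : ∀ t → ℕ → (Code t → ℕ → Timed) → Timed
  forEach unit    l body = body tt l
  forEach (dim d) l body = for l (sizeₑ d) (sizeₚ d) (body (reg (lit l)) (1 ℕ.+ l))
  forEach (t ⊗ u) l body = forEach t l λ a l′ → forEach u l′ λ b l″ → body (a , b) l″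

  writeAt : ∀ t → ℕ → Code t → ℕ → (ℕ → FExp) → Timed
  writeAt t u a l x = address t a l ⨾ₜ store (array u) (reg (lit l)) (lit 0) (x l)

  copy : ∀ t → ℕ → ℕ → ℕ → Timed
  copy t v u l = forEach t l λ a l′ → writeAt t u a l′ λ l → cell (array v) (reg (lit l)) (lit 0)

  ids : ∀ {Γ Γ′} → All (Γ ∋_) Γ′ → All (λ _ → ℕ) Γ → All (λ _ → ℕ) Γ′
  ids []       γ = []
  ids (v ∷ vs) γ = lookup v γ ∷ ids vs γ

  codes : ∀ {Δ Δ′} → All (Index Δ) Δ′ → All Code Δ → All Code Δ′
  codes []       κ = []
  codes (i ∷ is) κ = index i κ ∷ codes is κ

  -- The value of the expression is left in array u; arrays above u are scratch.
  compile : ∀ {Γ Δ t} → Exp Γ Δ t → All (λ _ → ℕ) Γ → All Code Δ → ℕ → ℕ → Timed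
  operation : ∀ {Γ Δ} → (FExp → FExp → FExp) → Exp Γ Δ unit → Exp Γ Δ unit →
              All (λ _ → ℕ) Γ → All Code Δ → ℕ → ℕ → Timed

  operation _∙_ a b γ κ u l =
    compile a γ κ u l ⨾ₜ compile b γ κ (suc u) l ⨾ₜ setScalar u (scalar u ∙ scalar (suc u))

  compile zeroₑ    γ κ u l = setScalar u 𝟘
  compile oneₑ     γ κ u l = setScalar u 𝟙
  compile (a +ₑ b) γ κ u l = operation _⊞_ a b γ κ u l
  compile (a -ₑ b) γ κ u l = operation _⊟_ a b γ κ u l
  compile (a *ₑ b) γ κ u l = operation _⊠_ a b γ κ u l
  compile (a /ₑ b) γ κ u l = operation _⊘_ a b γ κ u l
  compile (read {t} v i) γ κ u l =
    address t (index i κ) l ⨾ₜ setScalar u (cell (array (lookup v γ)) (reg (lit l)) (lit 0))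
  compile (input k i j) γ κ u l = setScalar u (cell (index k κ) (index i κ) (index j κ))
  compile (δ i j) γ κ u l =
    condₜ (index i κ <ᵗ index j κ) (setScalar u 𝟘)
      (condₜ (index j κ <ᵗ index i κ) (setScalar u 𝟘) (setScalar u 𝟙))
  compile (tab {t} e) γ κ u l = forEach t l λ a l′ →
    compile e γ (a ∷ κ) (suc u) l′ ⨾ₜ writeAt t u a l′ λ _ → scalar (suc u)
  compile (sum r e) γ κ u l = setScalar u 𝟘 ⨾ₜ forEach r l λ a l′ →
    compile e γ (a ∷ κ) (suc u) l′ ⨾ₜ setScalar u (scalar u ⊞ scalar (suc u))
  compile (choose {t} r f v d) γ κ u l = compile d γ κ u l ⨾ₜ forEach r l λ a l′ →
    compile f γ (a ∷ κ) (suc u) l′ ⨾ₜ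
    condₜ (scalar (suc u) ≈ᵗ 𝟘) skipₜ (compile v γ (a ∷ κ) (suc u) l′ ⨾ₜ copy t (suc u) u l′)
  -- The body still reads the old accumulator from array `u` while the new value is built in
  -- `suc u`; only then is it copied back.
  compile (iter {t} r e b) γ κ u l = compile e γ κ u l ⨾ₜ forEach r l λ a l′ →
    compile b (u ∷ γ) (a ∷ κ) (suc u) l′ ⨾ₜ copy t (suc u) u l′
  compile (bind {t} {t′} e b) γ κ u l =
    compile e γ κ u l ⨾ₜ compile b (u ∷ γ) κ (suc u) l ⨾ₜ copy t′ (suc u) u l
  compile (call e vs is) γ κ u l = compile e (ids vs γ) (codes is κ) u l

-- Correctness and running time of compiled code

module CompilationCorrectness {c ℓ₁ ℓ₂} (F : DiscreteField c ℓ₁ ℓ₂) (m n : ℕ)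
                              (S : Vector (MatrixModule.Matrix F n) m) where
  open LinearAlgebra F m n using (Carrier; 0#; 1#; _+_; _*_; _-_; _⁻¹; _≈ᵇ_; Vec; eq; ∑;
    Idx; size; fold; foldFin; fold-reaches; _≟ᵢ_)
  open Execution F m n
  open Denotation F m n S
  open Compilation

  -- With `SameCells`, a frame condition: code for array `u` at level `l` writes only to registers
  -- from `l` on and to cells from `m + u` on. This protects the inputs, the enclosing loop counters
  -- and the arrays in scope.
  record SameRegs (l : ℕ) (σ τ : State) : Set where
    constructor sameRegs
    field same : ∀ r → r ℕ.< l → registers τ r ≡ registers σ r

  record SameCells (k : ℕ) (σ τ : State) : Set c where
    constructor sameCells
    field same : ∀ k′ i j → k′ ℕ.< k → cells τ k′ i j ≡ cells σ k′ i j

  open SameRegs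
  open SameCells renaming (same to sameᶜ)

  Sized : State → Set
  Sized σ = registers σ 0 ≡ m × registers σ 1 ≡ n

  SameRegs-refl : ∀ {l σ} → SameRegs l σ σ
  SameRegs-refl = sameRegs λ _ _ → ≡.refl

  SameCells-refl : ∀ {k σ} → SameCells k σ σ
  SameCells-refl = sameCells λ _ _ _ _ → ≡.refl

  SameRegs-≤ : ∀ {l l′ σ τ} → l ℕ.≤ l′ → SameRegs l′ σ τ → SameRegs l σ τ
  SameRegs-≤ l≤l′ h = sameRegs λ r r<l → same h r (ℕₚ.<-≤-trans r<l l≤l′)

  SameRegs-trans : ∀ {l σ τ υ} → SameRegs l σ τ → SameRegs l τ υ → SameRegs l σ υ
  SameRegs-trans h k = sameRegs λ r r<l → ≡.trans (same k r r<l) (same h r r<l)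

  SameRegs-set : ∀ {l r v} σ → l ℕ.≤ r → SameRegs l σ (setRegister r v σ)
  SameRegs-set σ l≤r = sameRegs λ r′ r′<l → register-other σ (ℕₚ.<⇒≢ (ℕₚ.<-≤-trans r′<l l≤r))

  SameCells-trans : ∀ {k σ τ υ} → SameCells k σ τ → SameCells k τ υ → SameCells k σ υ
  SameCells-trans h g = sameCells λ k i j k< → ≡.trans (sameᶜ g k i j k<) (sameᶜ h k i j k<)

  SameCells-≤ : ∀ {k k′ σ τ} → k ℕ.≤ k′ → SameCells k′ σ τ → SameCells k σ τ
  SameCells-≤ k≤k′ h = sameCells λ k i j k< → sameᶜ h k i j (ℕₚ.<-≤-trans k< k≤k′)

  sized : ∀ {l σ τ} → 2 ℕ.≤ l → SameRegs l σ τ → Sized σ → Sized τ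
  sized 2≤l h (p , q) = ≡.trans (same h 0 (ℕₚ.<-≤-trans (s≤s z≤n) 2≤l)) p , ≡.trans (same h 1 2≤l) q

  -- The equation is demanded in every state that agrees below `l`, since the expression is
  -- evaluated again after registers from `l` on have been overwritten.
  Denotes : ∀ t → ℕ → State → Code t → Idx t → Set c
  Denotes unit    l σ _       _       = Lift c ⊤
  Denotes (dim d) l σ e       i       = ∀ τ → SameRegs l σ τ → evalℕ e τ ≡ toℕ i
  Denotes (t ⊗ u) l σ (a , b) (i , j) = Denotes t l σ a i × Denotes u l σ b j

  denotes-mono : ∀ t {l l′ σ τ a i} → l ℕ.≤ l′ → SameRegs l σ τ → Denotes t l σ a i →
      Denotes t l′ τ a i
  denotes-mono unit    l≤ h _       = _
  denotes-mono (dim d) l≤ h e       = λ υ k → e υ (SameRegs-trans h (SameRegs-≤ l≤ k))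
  denotes-mono (t ⊗ u) l≤ h (p , q) = denotes-mono t l≤ h p , denotes-mono u l≤ h q

  radix : ℕ
  radix = m ℕ.+ n ℕ.+ 4

  horner : ∀ t → Idx t → ℕ → ℕ
  horner unit    _       a = a
  horner (dim d) i       a = radix ℕ.* a ℕ.+ toℕ i
  horner (t ⊗ u) (i , j) a = horner u j (horner t i a)

  position : ∀ t → Idx t → ℕ
  position t i = horner t i 0

  size<radix : ∀ d (i : Fin (size d)) → toℕ i ℕ.< radix
  size<radix 𝑚 i = ℕₚ.<-≤-trans (Finₚ.toℕ<n i) (ℕₚ.≤-trans (ℕₚ.m≤m+n m n) (ℕₚ.m≤m+n _ 4))
  size<radix 𝑛 i = ℕₚ.<-≤-trans (Finₚ.toℕ<n i) (ℕₚ.≤-trans (ℕₚ.m≤n+m n m) (ℕₚ.m≤m+n _ 4))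
  size<radix 𝟜 i = ℕₚ.<-≤-trans (Finₚ.toℕ<n i) (ℕₚ.m≤n+m 4 _)

  private
    digit-≤ : ∀ {b a a′ r r′} → r ℕ.< b → b ℕ.* a ℕ.+ r ≡ b ℕ.* a′ ℕ.+ r′ → ¬ a ℕ.< a′
    digit-≤ {b} {a} {a′} {r} {r′} r<b e a<a′ = ℕₚ.<-irrefl e (begin-strict
      b ℕ.* a ℕ.+ r     <⟨ ℕₚ.+-monoʳ-< (b ℕ.* a) r<b ⟩
      b ℕ.* a ℕ.+ b     ≡⟨ ≡.trans (ℕₚ.+-comm (b ℕ.* a) b) (≡.sym (ℕₚ.*-suc b a)) ⟩
      b ℕ.* suc a       ≤⟨ ℕₚ.*-monoʳ-≤ b a<a′ ⟩
      b ℕ.* a′          ≤⟨ ℕₚ.m≤m+n _ r′ ⟩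
      b ℕ.* a′ ℕ.+ r′   ∎)
      where open ℕₚ.≤-Reasoning

    digit-injective : ∀ {b a a′ r r′} → r ℕ.< b → r′ ℕ.< b →
                      b ℕ.* a ℕ.+ r ≡ b ℕ.* a′ ℕ.+ r′ → a ≡ a′ × r ≡ r′
    digit-injective {b} {a} {a′} {r} r<b r′<b e
      with ℕₚ.≤-antisym (ℕₚ.≮⇒≥ (digit-≤ {b} {a′} {a} r′<b (≡.sym e)))
          (ℕₚ.≮⇒≥ (digit-≤ {b} {a} {a′} r<b e))
    ... | ≡.refl = ≡.refl , ℕₚ.+-cancelˡ-≡ (b ℕ.* a) _ _ e

  -- Every digit is smaller than the radix, so the expansion is unique. Hence writing one entry of
  -- an array leaves its other entries alone.
  horner-injective : ∀ t {i j a b} → horner t i a ≡ horner t j b → a ≡ b × i ≡ j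
  horner-injective unit    e = e , ≡.refl
  horner-injective (dim d) {i} {j} e with digit-injective (size<radix d i) (size<radix d j) e
  ... | a≡b , i≡j = a≡b , Finₚ.toℕ-injective i≡j
  horner-injective (t ⊗ u) e with horner-injective u e
  ... | e′ , ≡.refl with horner-injective t e′
  ...   | e″ , ≡.refl = e″ , ≡.refl

  position-injective : ∀ t {i j} → position t i ≡ position t j → i ≡ j
  position-injective t e = proj₂ (horner-injective t e)

  private
    foldFin-+ : ∀ k a x → foldFin k (λ _ y → y ℕ.+ a) x ≡ x ℕ.+ k ℕ.* a
    foldFin-+ zero    a x = ≡.sym (ℕₚ.+-identityʳ x)
    foldFin-+ (suc k) a x = ≡.trans (foldFin-+ k a (x ℕ.+ a)) (ℕₚ.+-assoc x a (k ℕ.* a))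

  run-digits : ∀ {q} {Q : State → Set q} t {a i l acc σ} → 2 ℕ.≤ l → Sized σ →
               Denotes t l σ a i → registers σ l ≡ acc →
               (∀ {τ} → SameRegs l σ τ → cells τ ≡ cells σ → registers τ l ≡ horner t i acc → Q τ) →
               Runs (digits t a l) σ Q
  run-digits unit 2≤l sz d e h = run-skip (h SameRegs-refl ≡.refl e)
  run-digits (t ⊗ u) {a , b} {i , j} {l} 2≤l sz (d , d′) e h = run-⨾ {P = digits t a l}
    (run-digits t 2≤l sz d e λ r c e →
      run-digits u 2≤l (sized 2≤l r sz) (denotes-mono u ℕₚ.≤-refl r d′) e λ r′ c′ e′ →
        h (SameRegs-trans r r′) (≡.trans c′ c) e′)
  run-digits {Q = Q} (dim d) {a} {i} {l} {acc} {σ} 2≤l sz den e h =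
    run-⨾ (run-assign (run-⨾ {P = loop} (run-mono {P = loop} finish
      (run-for J {e = limitₑ} {size = (𝐦 :+ 𝐧) :+ con 4} ≡.refl stable limit
          (λ _ y → y ℕ.+ acc) step
        (SameRegs-set σ ℕₚ.≤-refl , ≡.refl , register-set (1 ℕ.+ l) σ)))))
    where
    limitₑ : ℕExp
    limitₑ = (reg (lit 0) ⊕ reg (lit 1)) ⊕ lit 4

    loop : Timed
    loop = for (2 ℕ.+ l) limitₑ ((𝐦 :+ 𝐧) :+ con 4)
        (assign (1 ℕ.+ l) (reg (lit (1 ℕ.+ l)) ⊕ reg (lit l)))

    J : ℕ → State → Set c
    J x τ = SameRegs (1 ℕ.+ l) σ τ × cells τ ≡ cells σ × registers τ (1 ℕ.+ l) ≡ x

    stable : ∀ {x v τ} → J x τ → J x (setRegister (2 ℕ.+ l) v τ)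
    stable {τ = τ} (p , q , r) = SameRegs-trans p (SameRegs-set τ (ℕₚ.n≤1+n _)) , q ,
      ≡.trans (register-other τ (ℕₚ.<⇒≢ (ℕₚ.n<1+n _))) r

    limit : ∀ {x τ} → J x τ → evalℕ limitₑ τ ≡ radix
    limit (p , _ , _) with sized (ℕₚ.m≤n⇒m≤1+n 2≤l) p sz
    ... | p₀ , p₁ = ≡.cong₂ (λ x y → x ℕ.+ y ℕ.+ 4) p₀ p₁

    step : ∀ (k : Fin radix) {x τ} → J x τ → registers τ (2 ℕ.+ l) ≡ toℕ k →
           Runs (assign (1 ℕ.+ l) (reg (lit (1 ℕ.+ l)) ⊕ reg (lit l))) τ
             (λ υ → J (x ℕ.+ acc) υ × registers υ (2 ℕ.+ l) ≡ toℕ k)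
    step k {x} {τ} (p , q , r) rk = run-assign
      ((SameRegs-trans p (SameRegs-set τ ℕₚ.≤-refl) , q ,
        ≡.trans (register-set (1 ℕ.+ l) τ) (≡.cong₂ ℕ._+_ r (≡.trans (same p l (ℕₚ.n<1+n l)) e))) ,
       ≡.trans (register-other τ (ℕₚ.<⇒≢ (ℕₚ.n<1+n _) ∘ ≡.sym)) rk)

    finish : ∀ {τ} → J (foldFin radix (λ _ y → y ℕ.+ acc) 0) τ →
             Runs (assign l (reg (lit (1 ℕ.+ l)) ⊕ a)) τ Q
    finish {τ} (p , q , r) = run-assign (h
      (SameRegs-trans below (SameRegs-set τ ℕₚ.≤-refl)) q
      (≡.trans (register-set l τ) (≡.cong₂ ℕ._+_ (≡.trans r (foldFin-+ radix acc 0))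
          (den τ below))))
      where
      below : SameRegs l σ τ
      below = SameRegs-≤ (ℕₚ.n≤1+n l) p

  run-address : ∀ {q} {Q : State → Set q} t {a i l σ} → 2 ℕ.≤ l → Sized σ → Denotes t l σ a i →
                (∀ {τ} → SameRegs l σ τ → cells τ ≡ cells σ → registers τ l ≡ position t i → Q τ) →
                Runs (address t a l) σ Q
  run-address t {l = l} {σ} 2≤l sz d h = run-⨾ (run-assign
    (run-digits t 2≤l (sized 2≤l below sz) (denotes-mono t ℕₚ.≤-refl below d) (register-set l σ)
      λ r c e → h (SameRegs-trans below r) c e))
    where
    below : SameRegs l σ (setRegister l 0 σ)
    below = SameRegs-set σ ℕₚ.≤-refl

  after : Shape → ℕ → ℕ
  after unit    l = l
  after (dim d) l = suc l
  after (t ⊗ u) l = after u (after t l)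

  ≤-after : ∀ t l → l ℕ.≤ after t l
  ≤-after unit    l = ℕₚ.≤-refl
  ≤-after (dim d) l = ℕₚ.n≤1+n l
  ≤-after (t ⊗ u) l = ℕₚ.≤-trans (≤-after t l) (≤-after u (after t l))

  module _ {x p} {X : Set x} (J : X → State → Set p) where

    Stable : ℕ → Set (c ⊔ x ⊔ p)
    Stable l = ∀ {a r v σ} → l ℕ.≤ r → J a σ → J a (setRegister r v σ)

    private
      size-ok : ∀ d → evalPolynomial (sizeₚ d) m n ≡ size d
      size-ok 𝑚 = ≡.refl
      size-ok 𝑛 = ≡.refl
      size-ok 𝟜 = ≡.refl

      sizeₑ-ok : ∀ d {σ} → Sized σ → evalℕ (sizeₑ d) σ ≡ size d
      sizeₑ-ok 𝑚 (p , _) = p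
      sizeₑ-ok 𝑛 (_ , q) = q
      sizeₑ-ok 𝟜 _       = ≡.refl

    run-forEach : ∀ t {l body} (g : Idx t → X → X) {a σ₀} → 2 ℕ.≤ l → Sized σ₀ → Stable l →
      (∀ {e i a σ} → Denotes t (after t l) σ e i → SameRegs l σ₀ σ → J a σ →
         Runs (body e (after t l)) σ (λ τ → J (g i a) τ × SameRegs (after t l) σ τ)) →
      J a σ₀ → Runs (forEach t l body) σ₀ (λ τ → J (fold t g a) τ × SameRegs l σ₀ τ)
    run-forEach unit g 2≤l sz st h ja = h _ SameRegs-refl ja
    run-forEach (dim d) {l} {body} g {a} {σ₀} 2≤l sz st h ja =
      run-for J′ {e = sizeₑ d} {size = sizeₚ d} (size-ok d)
        (λ { {σ = σ} (j , r) → st ℕₚ.≤-refl j , SameRegs-trans r (SameRegs-set σ ℕₚ.≤-refl) })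
        (λ (j , r) → sizeₑ-ok d (sized 2≤l r sz)) g
        (λ { i {σ = σ} (j , r) e → run-mono {P = body (reg (lit l)) (suc l)}
          (λ (j′ , r′) → (j′ , SameRegs-trans r (SameRegs-≤ (ℕₚ.n≤1+n l) r′)) , ≡.trans
              (same r′ l (ℕₚ.n<1+n l)) e)
          (h (λ τ r′ → ≡.trans (same r′ l (ℕₚ.n<1+n l)) e) r j) })
        (ja , SameRegs-refl)
      where
      J′ : X → State → Set p
      J′ a σ = J a σ × SameRegs l σ₀ σ
    run-forEach (t ⊗ u) {l} g 2≤l sz st h ja =
      run-forEach t (λ i → fold u (λ j → g (i , j))) 2≤l sz st
        (λ d r ja → run-forEach u _ (ℕₚ.≤-trans 2≤l (≤-after t l)) (sized 2≤l r sz)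
          (λ l≤r → st (ℕₚ.≤-trans (≤-after t l) l≤r))
          (λ d′ r′ ja → h (denotes-mono t (≤-after u _) r′ d , d′)
            (SameRegs-trans r (SameRegs-≤ (≤-after t l) r′)) ja)
          ja)
        ja

  Holds : ∀ t → ℕ → Vec t → State → Set c
  Holds t u x σ = ∀ i → cells σ (m ℕ.+ u) (position t i) 0 ≡ x i

  Result : ∀ t → ℕ → ℕ → Vec t → State → State → Set c
  Result t u l x σ τ = SameRegs l σ τ × SameCells (m ℕ.+ u) σ τ × Holds t u x τ

  holds-mono : ∀ t {k v x σ τ} → SameCells k σ τ → m ℕ.+ v ℕ.< k → Holds t v x σ → Holds t v x τ
  holds-mono t h v<k hx i = ≡.trans (sameᶜ h _ _ _ v<k) (hx i)

  private
    array< : ∀ {v u} → v ℕ.< u → m ℕ.+ v ℕ.< m ℕ.+ u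
    array< = ℕₚ.+-monoʳ-< m

    cells-setCell : ∀ {a a′ b b′ d v v′} {σ τ} → a ≡ a′ → b ≡ b′ → v ≡ v′ → cells σ ≡ cells τ →
                    cells (setCell a b d v σ) ≡ cells (setCell a′ b′ d v′ τ)
    cells-setCell {a = a} {b = b} {d = d} {v = v} ≡.refl ≡.refl ≡.refl e = ≡.cong
      (λ f k i j → if (k ℕ.≡ᵇ a) ∧ (i ℕ.≡ᵇ b) ∧ (j ℕ.≡ᵇ d) then v else f k i j) e

    at : ∀ {f g : ℕ → ℕ → ℕ → Carrier} → f ≡ g → ∀ k i j → f k i j ≡ g k i j
    at ≡.refl k i j = ≡.refl

  record Written (k i j : ℕ) (v : Carrier) (σ τ : State) : Set c where
    constructor written
    field
      only : cells τ ≡ cells (setCell k i j v σ)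

    on : cells τ k i j ≡ v
    on = ≡.trans (at only k i j) (cell-set k i j σ)

    off : ∀ k′ i′ j′ → k′ ≢ k ⊎ i′ ≢ i → cells τ k′ i′ j′ ≡ cells σ k′ i′ j′
    off k′ i′ j′ ne = ≡.trans (at only k′ i′ j′) (cell-other {k} {i} {j} {v} {k′} {i′} {j′} σ ne)

  open Written

  private
    sameCells-written : ∀ {u b d v σ τ} → Written (m ℕ.+ u) b d v σ τ → SameCells (m ℕ.+ u) σ τ
    sameCells-written w = sameCells λ k i j k< → off w k i j (inj₁ (ℕₚ.<⇒≢ k<))

    update : ∀ {t} → Idx t → Carrier → Vec t → Vec t
    update i v x j = if does (j ≟ᵢ i) then v else x j

    holds-update : ∀ t {u i v x σ τ} → Written (m ℕ.+ u) (position t i) 0 v σ τ →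
                   Holds t u x σ → Holds t u (update i v x) τ
    holds-update t {i = i} w hx j with j ≟ᵢ i
    ... | yes ≡.refl = on w
    ... | no j≢i     = ≡.trans (off w _ _ _ (inj₂ (j≢i ∘ position-injective t))) (hx j)

  run-writeAt : ∀ t {u a i l x v σ} → 2 ℕ.≤ l → Sized σ → Denotes t l σ a i →
    (∀ {τ} → SameRegs l σ τ → cells τ ≡ cells σ → registers τ l ≡ position t i → evalF
        (x l) τ ≡ v) →
    Runs (writeAt t u a l x) σ
      (λ τ → SameRegs l σ τ × Written (m ℕ.+ u) (position t i) 0 v σ τ)
  run-writeAt t {u} {σ = σ} 2≤l sz d h = run-⨾ (run-address t 2≤l sz d λ {τ} r e p → run-store
    (sameRegs (same r) ,
     written (cells-setCell {σ = τ} {τ = σ} (≡.cong (ℕ._+ u) (proj₁ (sized 2≤l r sz))) p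
         (h r e p) e)))

  -- Before the loop the array contains arbitrary values. The invariant therefore starts from
  -- whatever the state holds there and replaces the entries treated so far; at the end none of the
  -- old ones is left.
  run-fill : ∀ t {u l body} (val : Vec t) (K : State → Set c) {σ₀} →
    (∀ {r v σ} → K σ → K (setRegister r v σ)) → 2 ℕ.≤ l → Sized σ₀ → K σ₀ →
    (∀ {e i σ} → Denotes t (after t l) σ e i → SameRegs l σ₀ σ → SameCells (m ℕ.+ u) σ₀ σ → K σ →
       Runs (body e (after t l)) σ (λ τ → SameRegs (after t l) σ τ × SameCells (m ℕ.+ u) σ τ × K τ ×
         (∀ x → Holds t u x σ → Holds t u (update i (val i) x) τ))) →
    Runs (forEach t l body) σ₀ (Result t u l val σ₀)
  run-fill t {u} {l} {body} val K {σ₀} st 2≤l sz k h = run-mono finish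
    (run-forEach J t {body = body} (λ i → update i (val i)) 2≤l sz
      (λ { _ (same , k , hx) → sameCells (sameᶜ same) , st k , hx })
      (λ d r (same , k , hx) → run-mono
        (λ (r′ , same′ , k′ , upd) → (SameCells-trans same same′ , k′ , upd _ hx) , r′)
        (h d r same k))
      (SameCells-refl , k , λ i → ≡.refl))
    where
    J : Vec t → State → Set c
    J x τ = SameCells (m ℕ.+ u) σ₀ τ × K τ × Holds t u x τ

    x₀ : Vec t
    x₀ i = cells σ₀ (m ℕ.+ u) (position t i) 0

    filled : ∀ j → fold t (λ i → update i (val i)) x₀ j ≡ val j
    filled j = fold-reaches (λ _ → ⊤) (λ x → x j ≡ val j) t (λ _ _ _ → tt) stays j hits {x₀} tt
      where
      stays : ∀ i x → ⊤ → x j ≡ val j → update i (val i) x j ≡ val j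
      stays i x _ e with j ≟ᵢ i
      ... | yes ≡.refl = ≡.refl
      ... | no _       = e

      hits : ∀ x → ⊤ → update j (val j) x j ≡ val j
      hits x _ with j ≟ᵢ j
      ... | yes _  = ≡.refl
      ... | no j≢j = contradiction ≡.refl j≢j

    finish : ∀ {τ} → J (fold t (λ i → update i (val i)) x₀) τ × SameRegs l σ₀ τ →
        Result t u l val σ₀ τ
    finish ((same , _ , hx) , r) = r , same , λ j → ≡.trans (hx j) (filled j)

  run-copy : ∀ t {u l x σ} → 2 ℕ.≤ l → Sized σ → Holds t (suc u) x σ →
             Runs (copy t (suc u) u l) σ (Result t u l x σ)
  run-copy t {u} {l} {x} {σ} 2≤l sz hx = run-fill t x (Holds t (suc u) x) id 2≤l sz hx step
    where
    step : ∀ {e i τ} → Denotes t (after t l) τ e i → SameRegs l σ τ → SameCells (m ℕ.+ u) σ τ →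
           Holds t (suc u) x τ → Runs _ τ (λ υ → _)
    step {e} {i} {τ} d r same hτ = run-mono
      (λ (r′ , e′) → r′ , sameCells-written e′ ,
        (λ j → ≡.trans (off e′ _ _ _ (inj₁ λ p → ℕₚ.<⇒≢ (array< (ℕₚ.n<1+n u)) (≡.sym p))) (hτ j)) ,
        λ y → holds-update t e′)
      (run-writeAt t {x = λ l → cell (array (suc u)) (reg (lit l)) (lit 0)} 2≤l′ szτ d λ {υ} r″ ce p → ≡.trans
        (≡.cong₂ (λ a b → cells υ (a ℕ.+ suc u) b 0) (proj₁ (sized 2≤l′ r″ szτ)) p)
        (≡.trans (at ce _ _ _) (hτ i)))
      where
      2≤l′ = ℕₚ.≤-trans 2≤l (≤-after t l)
      szτ = sized 2≤l r sz

  run-setScalar : ∀ {u l x v σ} → Sized σ → evalF x σ ≡ v → Runs (setScalar u x) σ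
      (Result unit u l (λ _ → v) σ)
  run-setScalar {u} {x = x} {v = v} {σ = σ} (p , _) e = run-store
    ((sameRegs λ _ _ → ≡.refl) , sameCells-written w , λ _ → on w)
    where
    w : Written (m ℕ.+ u) 0 0 v σ (setCell (registers σ 0 ℕ.+ u) 0 0 (evalF x σ) σ)
    w = written (cells-setCell {σ = σ} {τ = σ} (≡.cong (ℕ._+ u) p) ≡.refl e ≡.refl)

  scalar-value : ∀ u {v} σ → Sized σ → Holds unit u v σ → evalF (scalar u) σ ≡ v tt
  scalar-value u σ (p , _) h = ≡.trans (≡.cong (λ k → cells σ (k ℕ.+ u) 0 0) p) (h tt)

  record Context {Γ Δ} (ρ : Arrays Γ) (η : Indexes Δ) (γ : All (λ _ → ℕ) Γ) (κ : All Code Δ)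
                 (u l : ℕ) (σ : State) : Set c where
    constructor context
    field
      -- Registers 0 and 1 hold the dimensions throughout.
      2≤l       : 2 ℕ.≤ l
      sizedᶜ    : Sized σ
      inputs    : ∀ k i j → cells σ (toℕ k) (toℕ i) (toℕ j) ≡ S k i j
      arraysᶜ   : ∀ {t} (v : Γ ∋ t) → lookup v γ ℕ.< u × Holds t (lookup v γ) (lookup v ρ) σ
      indicesᶜ  : ∀ {t} (v : Δ ∋ t) → Denotes t l σ (lookup v κ) (lookup v η)

  open Context

  context-mono : ∀ {Γ Δ} {ρ : Arrays Γ} {η : Indexes Δ} {γ κ u u′ l l′ σ τ} → u ℕ.≤ u′ → l ℕ.≤ l′ →
                 SameRegs l σ τ → SameCells (m ℕ.+ u) σ τ →
                 Context ρ η γ κ u l σ → Context ρ η γ κ u′ l′ τ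
  context-mono u≤ l≤ r same C = record
    { 2≤l = ℕₚ.≤-trans (2≤l C) l≤
    ; sizedᶜ = sized (2≤l C) r (sizedᶜ C)
    ; inputs = λ k i j → ≡.trans
        (sameᶜ same _ _ _ (ℕₚ.<-≤-trans (Finₚ.toℕ<n k) (ℕₚ.m≤m+n m _))) (inputs C k i j)
    ; arraysᶜ = λ v → ℕₚ.<-≤-trans (proj₁ (arraysᶜ C v)) u≤ ,
        holds-mono _ same (array< (proj₁ (arraysᶜ C v))) (proj₂ (arraysᶜ C v))
    ; indicesᶜ = λ v → denotes-mono _ l≤ r (indicesᶜ C v)
    }

  context-index : ∀ {Γ Δ t} {ρ : Arrays Γ} {η : Indexes Δ} {γ κ u l σ a} {i : Idx t} →
                  Denotes t l σ a i → Context ρ η γ κ u l σ → Context ρ (i ∷ η) γ (a ∷ κ) u l σ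
  context-index d C = record
    { 2≤l = 2≤l C ; sizedᶜ = sizedᶜ C ; inputs = inputs C ; arraysᶜ = arraysᶜ C
    ; indicesᶜ = λ { here → d ; (there v) → indicesᶜ C v } }

  context-array : ∀ {Γ Δ t} {ρ : Arrays Γ} {η : Indexes Δ} {γ κ u l σ} {x : Vec t} →
                  Holds t u x σ → Context ρ η γ κ u l σ → Context (x ∷ ρ) η (u ∷ γ) κ (suc u) l σ
  context-array h C = record
    { 2≤l = 2≤l C ; sizedᶜ = sizedᶜ C ; inputs = inputs C ; indicesᶜ = indicesᶜ C
    ; arraysᶜ = λ { here → ℕₚ.n<1+n _ , h
                  ; (there v) → ℕₚ.m≤n⇒m≤1+n (proj₁ (arraysᶜ C v)) , proj₂ (arraysᶜ C v) } }

  denotes-index : ∀ {Γ Δ t} {ρ : Arrays Γ} {η : Indexes Δ} {γ κ u l σ} → Context ρ η γ κ u l σ →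
                  (i : Index Δ t) → Denotes t l σ (index i κ) (⟦ i ⟧ᵢ η)
  denotes-index C (var v) = indicesᶜ C v
  denotes-index C (lit k) = λ _ _ → ≡.refl
  denotes-index C (i , j) = denotes-index C i , denotes-index C j
  denotes-index C (fst i) = proj₁ (denotes-index C i)
  denotes-index C (snd i) = proj₂ (denotes-index C i)

  context-call : ∀ {Γ Δ Γ′ Δ′} {ρ : Arrays Γ} {η : Indexes Δ} {γ κ u l σ}
                 (vs : All (Γ ∋_) Γ′) (is : All (Index Δ) Δ′) → Context ρ η γ κ u l σ →
                 Context (arrays vs ρ) (indexes is η) (ids vs γ) (codes is κ) u l σ
  context-call {ρ = ρ} {η} {γ} {κ} {u} {l} {σ} vs is C = record
    { 2≤l = 2≤l C ; sizedᶜ = sizedᶜ C ; inputs = inputs C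
    ; arraysᶜ = args vs ; indicesᶜ = indices is }
    where
    args : ∀ {Γ′} (vs : All (_ ∋_) Γ′) {t} (v : Γ′ ∋ t) →
           lookup v (ids vs γ) ℕ.< u × Holds t (lookup v (ids vs γ)) (lookup v (arrays vs ρ)) σ
    args (v ∷ vs) here      = arraysᶜ C v
    args (_ ∷ vs) (there v) = args vs v

    indices : ∀ {Δ′} (is : All (Index _) Δ′) {t} (v : Δ′ ∋ t) →
              Denotes t l σ (lookup v (codes is κ)) (lookup v (indexes is η))
    indices (i ∷ is) here      = denotes-index C i
    indices (_ ∷ is) (there v) = indices is v

  result-trans : ∀ {t u l x σ τ υ} → SameRegs l σ τ → SameCells (m ℕ.+ u) σ τ →
                 Result t u l x τ υ → Result t u l x σ υ
  result-trans r same (r′ , same′ , h) = SameRegs-trans r r′ , SameCells-trans same same′ , h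

  private
    m+u≤ : ∀ {u} → m ℕ.+ u ℕ.≤ m ℕ.+ suc u
    m+u≤ {u} = ℕₚ.+-monoʳ-≤ m (ℕₚ.n≤1+n u)

  -- Subexpressions that are evaluated while array `u` holds a partial result are compiled at
  -- `suc u`, so that their frame condition preserves that result.
  compile-correct : ∀ {Γ Δ t} (e : Exp Γ Δ t) {ρ : Arrays Γ} {η : Indexes Δ} {γ κ u l σ} →
                    Context ρ η γ κ u l σ → Runs (compile e γ κ u l) σ (Result t u l (⟦ e ⟧ ρ η) σ)

  operation-correct : ∀ {Γ Δ} (_∙_ : FExp → FExp → FExp) (_∘′_ : Carrier → Carrier → Carrier)
    (a b : Exp Γ Δ unit) {ρ : Arrays Γ} {η : Indexes Δ} {γ κ u l σ} →
    (∀ x y τ → evalF (x ∙ y) τ ≡ evalF x τ ∘′ evalF y τ) → Context ρ η γ κ u l σ →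
    Runs (operation _∙_ a b γ κ u l) σ (Result unit u l (λ _ → ⟦ a ⟧ ρ η tt ∘′ ⟦ b ⟧ ρ η tt) σ)
  operation-correct _∙_ _∘′_ a b {u = u} ev C = run-⨾ (run-mono
    (λ (r , same , h) → run-⨾ (run-mono
      (λ {τ} (r′ , same′ , h′) →
        let szτ = sized (2≤l C) (SameRegs-trans r r′) (sizedᶜ C) in
        run-mono (result-trans (SameRegs-trans r r′)
            (SameCells-trans same (SameCells-≤ m+u≤ same′)))
          (run-setScalar szτ (≡.trans (ev _ _ _)
            (≡.cong₂ _∘′_ (scalar-value u τ szτ (holds-mono unit same′ (array< (ℕₚ.n<1+n _)) h))
              (scalar-value (suc u) τ szτ h′)))))
      (compile-correct b (context-mono (ℕₚ.n≤1+n _) ℕₚ.≤-refl r same C))))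
    (compile-correct a C))

  compile-correct zeroₑ C = run-setScalar (sizedᶜ C) ≡.refl
  compile-correct oneₑ C = run-setScalar (sizedᶜ C) ≡.refl
  compile-correct (a +ₑ b) C = operation-correct _⊞_ _+_ a b (λ _ _ _ → ≡.refl) C
  compile-correct (a -ₑ b) C = operation-correct _⊟_ _-_ a b (λ _ _ _ → ≡.refl) C
  compile-correct (a *ₑ b) C = operation-correct _⊠_ _*_ a b (λ _ _ _ → ≡.refl) C
  compile-correct (a /ₑ b) C = operation-correct _⊘_ (λ x y → x * y ⁻¹) a b (λ _ _ _ → ≡.refl) C
  compile-correct (read {t} v i) {ρ = ρ} {η} {γ} {σ = σ} C = run-⨾
    (run-address t (2≤l C) (sizedᶜ C) (denotes-index C i) λ {τ} r e p →
      let szτ = sized (2≤l C) r (sizedᶜ C) in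
      run-mono (result-trans r (sameCells λ _ _ _ _ → at e _ _ _))
        (run-setScalar szτ (≡.trans
          (≡.cong₂ (λ a b → cells τ (a ℕ.+ lookup v γ) b 0) (proj₁ szτ) p)
          (≡.trans (at e _ _ _) (proj₂ (arraysᶜ C v) (⟦ i ⟧ᵢ η))))))
  compile-correct (input k i j) {η = η} {σ = σ} C = run-setScalar (sizedᶜ C) (≡.trans
    (≡.trans (≡.cong₂ (λ a b → cells σ a b _) (denotes-index C k σ SameRegs-refl)
        (denotes-index C i σ SameRegs-refl))
      (≡.cong (cells σ _ _) (denotes-index C j σ SameRegs-refl)))
    (inputs C _ _ _))
  compile-correct (δ {d} i j) {η = η} {κ = κ} {u} {l} {σ} C = decide (⟦ i ⟧ᵢ η) (⟦ j ⟧ᵢ η)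
    (denotes-index C i σ SameRegs-refl) (denotes-index C j σ SameRegs-refl)
    where
    decide : ∀ (a b : Fin (size d)) → evalℕ (index i κ) σ ≡ toℕ a → evalℕ (index j κ) σ ≡ toℕ b →
             Runs (compile (δ i j) [] κ u l) σ (Result unit u l (λ _ → eq (dim d) a b) σ)
    decide a b ea eb with a Finₚ.≟ b
    ... | yes ≡.refl = run-cond-false (≥⇒<ᵇ≡false (ℕₚ.≤-reflexive (≡.trans eb (≡.sym ea))))
            (run-cond-false (≥⇒<ᵇ≡false (ℕₚ.≤-reflexive (≡.trans ea (≡.sym eb))))
              (run-setScalar (sizedᶜ C) ≡.refl))
    ... | no a≢b with ℕₚ.<-cmp (toℕ a) (toℕ b)
    ...   | tri< a<b _ _ = run-cond-true (<⇒<ᵇ≡true (≡.subst₂ ℕ._<_ (≡.sym ea) (≡.sym eb) a<b))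
              (run-setScalar (sizedᶜ C) ≡.refl)
    ...   | tri≈ _ a≡b _ = contradiction (Finₚ.toℕ-injective a≡b) a≢b
    ...   | tri> _ _ b<a = run-cond-false (≥⇒<ᵇ≡false
        (≡.subst₂ ℕ._≤_ (≡.sym eb) (≡.sym ea) (ℕₚ.<⇒≤ b<a)))
              (run-cond-true (<⇒<ᵇ≡true (≡.subst₂ ℕ._<_ (≡.sym eb) (≡.sym ea) b<a))
                (run-setScalar (sizedᶜ C) ≡.refl))
  compile-correct (tab {t} e) {ρ = ρ} {η} {l = l} {σ} C =
    run-fill t (λ i → ⟦ e ⟧ ρ (i ∷ η) tt) (λ _ → Lift c ⊤) id (2≤l C) (sizedᶜ C) _
      λ d r same _ →
        let 2≤l′ = ℕₚ.≤-trans (2≤l C) (≤-after t l) in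
        run-⨾ (run-mono
          (λ (r′ , same′ , h) →
            let szτ = sized 2≤l′ r′ (sized (2≤l C) r (sizedᶜ C)) in
            run-mono
              (λ (r″ , e′) → SameRegs-trans r′ r″ ,
                SameCells-trans (SameCells-≤ m+u≤ same′) (sameCells-written e′) , _ ,
                λ x hx → holds-update t e′ (holds-mono t same′ (array< (ℕₚ.n<1+n _)) hx))
              (run-writeAt t 2≤l′ szτ (denotes-mono t ℕₚ.≤-refl r′ d) λ {υ} r″ e′ _ → ≡.trans
                (≡.cong (λ k → cells υ (k ℕ.+ suc _) 0 0) (proj₁ (sized 2≤l′ r″ szτ)))
                (≡.trans (at e′ _ _ _) (h tt))))
          (compile-correct e (context-index d (context-mono (ℕₚ.n≤1+n _) (≤-after t l) r same C))))
  compile-correct (sum q e) {ρ = ρ} {η} {u = u} {l} {σ} C = run-⨾ (run-mono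
    (λ (r , same , h) →
      let szτ = sized (2≤l C) r (sizedᶜ C) in
      run-mono (λ ((same′ , h′) , r′) → result-trans r same (r′ , same′ , h′))
        (run-forEach (λ a υ → SameCells (m ℕ.+ u) _ υ × Holds unit u (λ _ → a) υ) q
          (λ i a → a + ⟦ e ⟧ ρ (i ∷ η) tt) (2≤l C) szτ
          (λ { _ (same′ , h′) → sameCells (sameᶜ same′) , h′ })
          (λ d r′ (same′ , h′) → run-⨾ (run-mono
            (λ {υ} (r″ , same″ , h″) →
              let szυ = sized (2≤l C) (SameRegs-trans r′ (SameRegs-≤ (≤-after q l) r″)) szτ in
              run-mono
                (λ (r‴ , same‴ , h‴) →
                  (SameCells-trans same′ (SameCells-trans (SameCells-≤ m+u≤ same″) same‴) , h‴) ,
                  SameRegs-trans r″ r‴)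
                (run-setScalar szυ (≡.cong₂ _+_
                  (scalar-value u υ szυ (holds-mono unit same″ (array< (ℕₚ.n<1+n _)) h′))
                  (scalar-value (suc u) υ szυ h″))))
            (compile-correct e (context-index d
              (context-mono (ℕₚ.n≤1+n _) (≤-after q l) (SameRegs-trans r r′)
                  (SameCells-trans same same′) C)))))
          (SameCells-refl , h)))
    (run-setScalar {l = l} (sizedᶜ C) ≡.refl))
  compile-correct (choose {t} q f v d) {ρ = ρ} {η} {γ} {κ} {u = u} {l} {σ} C = run-⨾ (run-mono
    (λ (r , same , h) →
      run-mono (λ ((same′ , h′) , r′) → result-trans r same (r′ , same′ , h′))
        (run-forEach (λ a υ → SameCells (m ℕ.+ u) _ υ × Holds t u a υ) q
          step (2≤l C) (sized (2≤l C) r (sizedᶜ C))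
          (λ { _ (same′ , h′) → sameCells (sameᶜ same′) , h′ })
          (λ dn r′ (same′ , h′) → body r same dn r′ same′ h′)
          (SameCells-refl , h)))
    (compile-correct d C))
    where
    step : Idx q → Vec t → Vec t
    step i a = if ⟦ f ⟧ ρ (i ∷ η) tt ≈ᵇ 0# then a else ⟦ v ⟧ ρ (i ∷ η)

    body : ∀ {τ e i a υ} → SameRegs l σ τ → SameCells (m ℕ.+ u) σ τ → Denotes q (after q l) υ e i →
           SameRegs l τ υ → SameCells (m ℕ.+ u) τ υ → Holds t u a υ →
           Runs _ υ (λ φ → (SameCells (m ℕ.+ u) τ φ × Holds t u (step i a) φ) × SameRegs
               (after q l) υ φ)
    body {τ} {e} {i} {a} {υ} r same dn r′ same′ h = run-⨾ (run-mono
      (λ {φ} (r″ , same″ , h″) → branch r″ same″ (scalar-value (suc u) φ (szφ r″) h″) (⟦ f ⟧ ρ (i ∷ η) tt ≈ᵇ 0#) ≡.refl)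
      (compile-correct f C′))
      where
      C′ : Context ρ (i ∷ η) γ (e ∷ κ) (suc u) (after q l) υ
      C′ = context-index dn
        (context-mono (ℕₚ.n≤1+n u) (≤-after q l) (SameRegs-trans r r′)
            (SameCells-trans same same′) C)

      szφ : ∀ {φ} → SameRegs (after q l) υ φ → Sized φ
      szφ r″ = sized (2≤l C′) r″ (sizedᶜ C′)

      branch : ∀ {φ} → SameRegs (after q l) υ φ → SameCells (m ℕ.+ suc u) υ φ →
               evalF (scalar (suc u)) φ ≡ ⟦ f ⟧ ρ (i ∷ η) tt →
               ∀ b → (⟦ f ⟧ ρ (i ∷ η) tt ≈ᵇ 0#) ≡ b →
               Runs (condₜ (scalar (suc u) ≈ᵗ 𝟘) skipₜ
                      (compile v γ (e ∷ κ) (suc u) (after q l) ⨾ₜ copy t (suc u) u (after q l))) φ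
                 (λ φ → (SameCells (m ℕ.+ u) τ φ × Holds t u (step i a) φ) × SameRegs
                     (after q l) υ φ)
      branch {φ} r″ same″ e″ true eb = run-cond-true (≡.trans (≡.cong (_≈ᵇ 0#) e″) eb)
        (run-skip ((SameCells-trans same′ (SameCells-≤ m+u≤ same″) ,
          ≡.subst (λ b → Holds t u (if b then a else ⟦ v ⟧ ρ (i ∷ η)) φ) (≡.sym eb)
            (holds-mono t same″ (array< (ℕₚ.n<1+n u)) h)) , r″))
      branch r″ same″ e″ false eb = run-cond-false (≡.trans (≡.cong (_≈ᵇ 0#) e″) eb)
        (run-⨾ (run-mono
          (λ (r₃ , same₃ , h₃) → run-mono
            (λ {φ} (r₄ , same₄ , h₄) →
              (SameCells-trans same′ (SameCells-trans (SameCells-≤ m+u≤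
                  (SameCells-trans same″ same₃)) same₄) ,
               ≡.subst (λ b → Holds t u (if b then a else ⟦ v ⟧ ρ (i ∷ η)) φ) (≡.sym eb) h₄) ,
              SameRegs-trans r″ (SameRegs-trans r₃ r₄))
            (run-copy t (2≤l C′) (szφ (SameRegs-trans r″ r₃)) h₃))
          (compile-correct v (context-mono ℕₚ.≤-refl ℕₚ.≤-refl r″ same″ C′))))
  compile-correct (iter {t} q e b) {ρ = ρ} {η} {u = u} {l} {σ} C = run-⨾ (run-mono
    (λ (r , same , h) →
      let szτ = sized (2≤l C) r (sizedᶜ C) in
      run-mono (λ ((same′ , h′) , r′) → result-trans r same (r′ , same′ , h′))
        (run-forEach (λ a υ → SameCells (m ℕ.+ u) _ υ × Holds t u a υ) q
          (λ i a → ⟦ b ⟧ (a ∷ ρ) (i ∷ η)) (2≤l C) szτ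
          (λ { _ (same′ , h′) → sameCells (sameᶜ same′) , h′ })
          (λ d r′ (same′ , h′) → run-⨾ (run-mono
            (λ (r″ , same″ , h″) →
              run-mono
                (λ (r‴ , same‴ , h‴) →
                  (SameCells-trans same′ (SameCells-trans (SameCells-≤ m+u≤ same″) same‴) , h‴) ,
                  SameRegs-trans r″ r‴)
                (run-copy t (ℕₚ.≤-trans (2≤l C) (≤-after q l))
                  (sized (2≤l C) (SameRegs-trans r′ (SameRegs-≤ (≤-after q l) r″)) szτ) h″))
            (compile-correct b (context-array h′ (context-index d
              (context-mono ℕₚ.≤-refl (≤-after q l) (SameRegs-trans r r′)
                  (SameCells-trans same same′) C))))))
          (SameCells-refl , h)))
    (compile-correct e C))
  compile-correct (bind {t} {t′} e b) C = run-⨾ (run-mono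
    (λ (r , same , h) → run-⨾ (run-mono
      (λ (r′ , same′ , h′) → run-mono
        (result-trans (SameRegs-trans r r′) (SameCells-trans same (SameCells-≤ m+u≤ same′)))
        (run-copy t′ (2≤l C) (sized (2≤l C) (SameRegs-trans r r′) (sizedᶜ C)) h′))
      (compile-correct b (context-array h (context-mono ℕₚ.≤-refl ℕₚ.≤-refl r same C)))))
    (compile-correct e C))
  compile-correct (call e vs is) C = compile-correct e (context-call vs is C)

-- Spaces of matrices acting on V

module MatrixSpaces {c ℓ₁ ℓ₂} (F : DiscreteField c ℓ₁ ℓ₂) (m n : ℕ) where
  open Projections F m n public
  open SetoidReasoning setoid

  𝑀 : Shape
  𝑀 = 𝑛ˢ ⊗ 𝑛ˢ

  record Linear {s t} (f : Vec s → Vec t) : Set (c ⊔ ℓ₁) where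
    field
      cong   : ∀ {x y} → x ≋ y → f x ≋ f y
      homo-0 : f 0ᵛ ≋ 0ᵛ
      homo-+ : ∀ x y → f (x +ᵛ y) ≋ f x +ᵛ f y
      homo-∙ : ∀ a x → f (a ∙ᵛ x) ≋ a ∙ᵛ f x

  preimage : ∀ {ℓ s t} {f : Vec s → Vec t} {X : Pred (Vec t) ℓ} → Linear f → IsSubspace X →
             IsSubspace (X ∘ f)
  preimage L isX = record
    { resp = λ e → resp isX (cong e)
    ; null = resp isX (λ i → sym (homo-0 i)) (null isX)
    ; add = λ p q → resp isX (λ i → sym (homo-+ _ _ i)) (add isX p q)
    ; scale = λ a p → resp isX (λ i → sym (homo-∙ a _ i)) (scale isX a p)
    }
    where open Linear L

  image : ∀ {ℓ s t} {f : Vec s → Vec t} {X : Pred (Vec s) ℓ} → Linear f → IsSubspace X →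
          IsSubspace (λ y → ∃[ x ] X x × f x ≋ y)
  image L isX = record
    { resp = λ e (x , p , q) → x , p , λ i → trans (q i) (e i)
    ; null = 0ᵛ , null isX , homo-0
    ; add = λ (x , p , q) (x′ , p′ , q′) → x +ᵛ x′ , add isX p p′ , λ i → trans (homo-+ x x′ i)
        (+-cong (q i) (q′ i))
    ; scale = λ a (x , p , q) → a ∙ᵛ x , scale isX a p , λ i → trans (homo-∙ a x i) (*-congˡ (q i))
    }
    where open Linear L

  isSubspace-∀ : ∀ {i ℓ s} {I : Set i} {X : I → Pred (Vec s) ℓ} → (∀ i → IsSubspace (X i)) →
                 IsSubspace (λ x → ∀ i → X i x)
  isSubspace-∀ h = record
    { resp = λ e p i → resp (h i) e (p i)
    ; null = λ i → null (h i)
    ; add = λ p q i → add (h i) (p i) (q i)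
    ; scale = λ a p i → scale (h i) a (p i)
    }

  isSubspace-line : ∀ {s} (x : Vec s) → IsSubspace (λ y → ∃[ k ] y ≋ k ∙ᵛ x)
  isSubspace-line x = record
    { resp = λ e (k , h) → k , λ i → trans (sym (e i)) (h i)
    ; null = 0# , λ i → sym (zeroˡ _)
    ; add = λ (k , h) (k′ , h′) → k + k′ , λ i → trans (+-cong (h i) (h′ i)) (sym (distribʳ _ _ _))
    ; scale = λ a (k , h) → a * k , λ i → trans (*-congˡ (h i)) (sym (*-assoc _ _ _))
    }

  V : Set c
  V = Vec 𝑛ˢ

  mul : Vec 𝑀 → Vec 𝑀 → Vec 𝑀
  mul a b (p , q) = ∑ 𝑛ˢ λ r → a (p , r) * b (r , q)

  applied : ∀ a → Linear {𝑛ˢ} {𝑛ˢ} (ap a)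
  applied a = record { cong = ap-cong a ; homo-0 = ap-0 a ; homo-+ = ap-+ a ; homo-∙ = ap-∙ a }

  applying : ∀ (x : V) → Linear {𝑀} (λ a → ap a x)
  applying x = record
    { cong = λ e → ap-congˡ e x
    ; homo-0 = ap-0ᵒ x
    ; homo-+ = λ a b p → trans (∑-cong 𝑛ˢ λ q → distribʳ _ _ _) (∑-+ 𝑛ˢ _ _)
    ; homo-∙ = λ k a p → trans (∑-cong 𝑛ˢ λ q → *-assoc _ _ _) (∑-*ˡ 𝑛ˢ k _)
    }

  ap-minus : ∀ (a b : Vec 𝑀) (x : V) → ap (a -ᵛ b) x ≋ ap a x -ᵛ ap b x
  ap-minus a b x p = begin
    ap (a -ᵛ b) x p                      ≈⟨ Linear.cong (applying x) (-1∙ a b) p ⟨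
    ap (a +ᵛ (- 1#) ∙ᵛ b) x p            ≈⟨ Linear.homo-+ (applying x) a ((- 1#) ∙ᵛ b) p ⟩
    ap a x p + ap ((- 1#) ∙ᵛ b) x p      ≈⟨ +-congˡ (Linear.homo-∙ (applying x) (- 1#) b p) ⟩
    ap a x p + (- 1#) * ap b x p         ≈⟨ -1∙ (ap a x) (ap b x) p ⟩
    ap a x p - ap b x p                  ∎

  mulˡ : ∀ a → Linear (mul a)
  mulˡ a = record
    { cong = λ e (p , q) → ∑-cong 𝑛ˢ λ r → *-congˡ (e (r , q))
    ; homo-0 = λ (p , q) → ∑-0 𝑛ˢ λ r → zeroʳ _
    ; homo-+ = λ b b′ (p , q) → ap-+ a (col b q) (col b′ q) p
    ; homo-∙ = λ k b (p , q) → ap-∙ a k (col b q) p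
    }

  mulʳ : ∀ b → Linear (λ a → mul a b)
  mulʳ b = record
    { cong = λ e (p , q) → ap-congˡ e (col b q) p
    ; homo-0 = λ (p , q) → ap-0ᵒ (col b q) p
    ; homo-+ = λ a a′ (p , q) → Linear.homo-+ (applying (col b q)) a a′ p
    ; homo-∙ = λ k a (p , q) → Linear.homo-∙ (applying (col b q)) k a p
    }

  ap-mul : ∀ a b (x : V) → ap (mul a b) x ≋ ap a (ap b x)
  ap-mul a b x p = begin
    ∑ 𝑛ˢ (λ q → ∑ 𝑛ˢ (λ r → a (p , r) * b (r , q)) * x q)    ≈⟨ ∑-cong 𝑛ˢ (λ q → ∑-*ʳ 𝑛ˢ (x q) _) ⟨
    ∑ 𝑛ˢ (λ q → ∑ 𝑛ˢ (λ r → a (p , r) * b (r , q) * x q))    ≈⟨ ∑-swap 𝑛ˢ 𝑛ˢ _ ⟩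
    ∑ 𝑛ˢ (λ r → ∑ 𝑛ˢ (λ q → a (p , r) * b (r , q) * x q))    ≈⟨ ∑-cong 𝑛ˢ
        (λ r → trans (∑-cong 𝑛ˢ λ q → *-assoc _ _ _) (∑-*ˡ 𝑛ˢ _ _)) ⟩
    ∑ 𝑛ˢ (λ r → a (p , r) * ap b x r)                        ∎

  mul-assoc : ∀ a b d → mul (mul a b) d ≋ mul a (mul b d)
  mul-assoc a b d (p , q) = ap-mul a b (col d q) p

  mul-1ˡ : ∀ a → mul 1ᵒ a ≋ a
  mul-1ˡ a (p , q) = ap-1 (col a q) p

  mul-1ʳ : ∀ a → mul a 1ᵒ ≋ a
  mul-1ʳ a (p , q) = ∑-eqʳ 𝑛ˢ q _

  record Closed (Λ : Op 𝑀) : Set (c ⊔ ℓ₁) where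
    field
      isProjection : IsProjection Λ
      closed       : ∀ {a b} → a ∈ Λ → b ∈ Λ → mul a b ∈ Λ

  Maps : ∀ {p q} → Op 𝑀 → Pred V p → Pred V q → Set (c ⊔ ℓ₁ ⊔ p ⊔ q)
  Maps Λ X Y = ∀ {a x} → a ∈ Λ → X x → Y (ap a x)

  -- Application is bilinear, and the columns of a matrix span all vectors that it fixes.
  maps-columns : ∀ {ℓ} {Y : Pred V ℓ} → IsSubspace Y → ∀ {Λ X} →
                 (∀ d j → Y (ap (col Λ d) (col X j))) → Maps Λ (_∈ X) Y
  maps-columns isY {Λ} {X} h {a} {x} a∈ x∈ =
    columns⊆ (preimage (applied a) isY) X
      (λ j → columns⊆ (preimage (applying (col X j)) isY) Λ (λ d → h d j) a a∈) x x∈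

  opaque
    -- Represents the sum P + Λ X.
    extend : Op 𝑛ˢ → Op 𝑀 → Op 𝑛ˢ → Op 𝑛ˢ
    extend P Λ X = insertAll (𝑛ˢ ⊗ 𝑀) P λ (j , d) → ap (col Λ d) (col X j)

  module _ {P : Op 𝑛ˢ} (proj : IsProjection P) (Λ : Op 𝑀) (X : Op 𝑛ˢ) where

    opaque
      unfolding extend

      extend-isProjection : IsProjection (extend P Λ X)
      extend-isProjection = insertAll-isProjection (𝑛ˢ ⊗ 𝑀) _ proj

      extend-⊇ : (_∈ P) ⊆ (_∈ extend P Λ X)
      extend-⊇ = insertAll-⊇ (𝑛ˢ ⊗ 𝑀) _ proj

      extend-column : ∀ j {a} → a ∈ Λ → ap a (col X j) ∈ extend P Λ X
      extend-column j {a} a∈ = columns⊆ (preimage (applying (col X j))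
          (isSubspace-∈ (extend P Λ X))) Λ
        (λ d → insertAll-∋ (𝑛ˢ ⊗ 𝑀) _ proj (j , d)) a a∈

      extend-maps : Maps Λ (_∈ X) (_∈ extend P Λ X)
      extend-maps = maps-columns (isSubspace-∈ (extend P Λ X)) λ d j → insertAll-∋ (𝑛ˢ ⊗ 𝑀) _ proj
          (j , d)

      extend-least : ∀ {ℓ} {Y : Pred V ℓ} → IsSubspace Y → (_∈ P) ⊆ Y →
                     (∀ d j → Y (ap (col Λ d) (col X j))) → (_∈ extend P Λ X) ⊆ Y
      extend-least isY P⊆Y h = Insertion.least (insertAll-spec isY (𝑛ˢ ⊗ 𝑀) proj P⊆Y λ (j , d) →
          h d j)

  opaque
    products : Op 𝑀 → Op 𝑀 → Op 𝑀
    products Λ Λ′ = insertAll (𝑀 ⊗ 𝑀) 0ᵒ λ (d , d′) → mul (col Λ d) (col Λ′ d′)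

  opaque
    unfolding products

    products-isProjection : ∀ Λ Λ′ → IsProjection (products Λ Λ′)
    products-isProjection Λ Λ′ = insertAll-isProjection (𝑀 ⊗ 𝑀) _ 0-isProjection

    products-∋ : ∀ {Λ Λ′ a b} → a ∈ Λ → b ∈ Λ′ → mul a b ∈ products Λ Λ′
    products-∋ {Λ} {Λ′} {a} {b} a∈ b∈ =
      columns⊆ (preimage (mulʳ b) isP) Λ
        (λ d → columns⊆ (preimage (mulˡ (col Λ d)) isP) Λ′
          (λ d′ → insertAll-∋ (𝑀 ⊗ 𝑀) _ 0-isProjection (d , d′)) b b∈) a a∈
      where
      isP : IsSubspace (_∈ products Λ Λ′)
      isP = isSubspace-∈ (products Λ Λ′)

    products-least : ∀ {ℓ} {X : Pred (Vec 𝑀) ℓ} → IsSubspace X → ∀ {Λ Λ′} → IsProjection Λ →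
        IsProjection Λ′ →
                     (∀ {a b} → a ∈ Λ → b ∈ Λ′ → X (mul a b)) → (_∈ products Λ Λ′) ⊆ X
    products-least isX proj proj′ h = Insertion.least
        (insertAll-spec isX (𝑀 ⊗ 𝑀) 0-isProjection (0⊆ isX)
      λ (d , d′) → h (column∈ proj d) (column∈ proj′ d′))

  opaque
    -- Represents {a ∈ Λ : a x ∈ B}. The functional for `p` is coordinate `p` of a x - B (a x),
    -- which is linear in a.
    transporter : Op 𝑀 → Op 𝑛ˢ → V → Op 𝑀
    transporter Λ B x = cutAll 𝑛ˢ Λ λ p (r , s) → (eq 𝑛ˢ p r - B (p , r)) * x s

  module _ {Λ : Op 𝑀} (proj : IsProjection Λ) (B : Op 𝑛ˢ) (x : V) where

    private
      functional : ∀ a p → dot {𝑀} (λ (r , s) → (eq 𝑛ˢ p r - B (p , r)) * x s) a ≈ residue B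
          (ap a x) p
      functional a p = begin
        dot {𝑀} (λ (r , s) → (eq 𝑛ˢ p r - B (p , r)) * x s) a
          ≈⟨ ∑-⊗ 𝑛ˢ 𝑛ˢ _ ⟩
        ∑ 𝑛ˢ (λ r → ∑ 𝑛ˢ (λ s → (eq 𝑛ˢ p r - B (p , r)) * x s * a (r , s)))
          ≈⟨ ∑-cong 𝑛ˢ (λ r → trans (∑-cong 𝑛ˢ λ s → trans (*-assoc _ _ _) (*-congˡ (*-comm _ _)))
              (∑-*ˡ 𝑛ˢ _ _)) ⟩
        ∑ 𝑛ˢ (λ r → (eq 𝑛ˢ p r - B (p , r)) * ap a x r)
          ≈⟨ ∑-cong 𝑛ˢ (λ r → solve 3 (λ e b y → (e :- b) ⊛ y := e ⊛ y ⊹ :con (0 , 1) ⊛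
              (b ⊛ y)) refl _ _ _) ⟩
        ∑ 𝑛ˢ (λ r → eq 𝑛ˢ p r * ap a x r + _ * (B (p , r) * ap a x r))
          ≈⟨ trans (∑-+ 𝑛ˢ _ _) (+-cong (∑-eqˡ 𝑛ˢ p (ap a x)) (∑-*ˡ 𝑛ˢ _ _)) ⟩
        ap a x p + _ * ap B (ap a x) p
          ≈⟨ solve 2 (λ y b → y ⊹ :con (0 , 1) ⊛ b := y :- b) refl _ _ ⟩
        residue B (ap a x) p ∎

    opaque
      unfolding transporter

      transporter-isProjection : IsProjection (transporter Λ B x)
      transporter-isProjection = cutAll-isProjection 𝑛ˢ _ proj

      transporter-⊆ : (_∈ transporter Λ B x) ⊆ (_∈ Λ)
      transporter-⊆ = cutAll-⊆ 𝑛ˢ _ proj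

      transporter-maps : ∀ {a} → a ∈ transporter Λ B x → ap a x ∈ B
      transporter-maps {a} a∈ p = sym (x-y≈0⇒x≈y
          (trans (sym (functional a p)) (cutAll-kills 𝑛ˢ _ proj p a∈)))

      transporter-∋ : ∀ {a} → a ∈ Λ → ap a x ∈ B → a ∈ transporter Λ B x
      transporter-∋ {a} a∈ h = cutAll-∋ 𝑛ˢ _ proj a∈ λ p →
        trans (functional a p) (trans (+-congˡ (-‿cong (h p))) (-‿inverseʳ _))

  opaque
    -- Represents {a ∈ Λ : a V ⊆ E}; it is enough to constrain the images of the unit vectors.
    ranged : Op 𝑀 → Op 𝑛ˢ → Op 𝑀
    ranged Λ E = fold 𝑛ˢ (λ j Q → transporter Q E (unitᵛ j)) Λ

  module _ {Λ : Op 𝑀} (proj : IsProjection Λ) (E : Op 𝑛ˢ) where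

    opaque
      unfolding ranged

      ranged-isProjection : IsProjection (ranged Λ E)
      ranged-isProjection = fold-preserves IsProjection 𝑛ˢ
        (λ j Q p → transporter-isProjection p E (unitᵛ j)) proj

      ranged-⊆ : (_∈ ranged Λ E) ⊆ (_∈ Λ)
      ranged-⊆ = proj₂ (fold-preserves (λ Q → IsProjection Q × ((_∈ Q) ⊆ (_∈ Λ))) 𝑛ˢ
        (λ j Q (p , h) → transporter-isProjection p E (unitᵛ j) ,
          λ x x∈ → h x (transporter-⊆ p E (unitᵛ j) x x∈)) (proj , λ _ → id))

      ranged-∋ : ∀ {a} → a ∈ Λ → (∀ x → ap a x ∈ E) → a ∈ ranged Λ E
      ranged-∋ {a} a∈ h = proj₂ (fold-preserves (λ Q → IsProjection Q × a ∈ Q) 𝑛ˢ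
        (λ j Q (p , q) → transporter-isProjection p E (unitᵛ j) , transporter-∋ p E (unitᵛ j) q
            (h _))
        (proj , a∈))

      ranged-maps : ∀ {a} → a ∈ ranged Λ E → ∀ x → ap a x ∈ E
      ranged-maps {a} a∈ x = columns⊆ (preimage (applied a) (isSubspace-∈ E)) 1ᵒ column x (ap-1 x)
        where
        column : ∀ j → ap a (unitᵛ j) ∈ E
        column j = fold-reaches IsProjection (λ Q → (_∈ Q) ⊆ (λ b → ap b (unitᵛ j) ∈ E)) 𝑛ˢ
          (λ i Q p → transporter-isProjection p E (unitᵛ i))
          (λ i Q p q b b∈ → q b (transporter-⊆ p E (unitᵛ i) b b∈))
          j (λ Q p b → transporter-maps p E (unitᵛ j)) proj a a∈

  if-≈0 : ∀ {a} {A : Set a} {x : Carrier} {y z : A} → x ≈ 0# → (if x ≈ᵇ 0# then y else z) ≡ y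
  if-≈0 {y = y} {z} x≈0 = ≡.cong (λ b → if b then y else z) (≈ᵇ-true x≈0)

  if-≉0 : ∀ {a} {A : Set a} {x : Carrier} {y z : A} → ¬ x ≈ 0# → (if x ≈ᵇ 0# then y else z) ≡ z
  if-≉0 {y = y} {z} x≉0 = ≡.cong (λ b → if b then y else z) (≈ᵇ-false x≉0)

  module _ {a} {A : Set a} (r : Shape) (flag : Idx r → Carrier) (value : Idx r → A) (default : A) where

    chooseLast : A
    chooseLast = fold r (λ i x → if flag i ≈ᵇ 0# then x else value i) default

    chooseLast-spec : ((∀ i → flag i ≈ 0#) × chooseLast ≡ default) ⊎
                      (∃[ i ] ¬ flag i ≈ 0# × chooseLast ≡ value i)
    chooseLast-spec with All.all? (λ i → flag i ≈? 0#) (enum r)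
    ... | yes all = inj₁ ((λ i → All.lookup all (∈-enum r i)) ,
            fold-preserves (_≡ default) r
              (λ i x e → ≡.trans (if-≈0 (All.lookup all (∈-enum r i))) e) ≡.refl)
    ... | no ¬all with search (enum r) ¬all
      where
      search : ∀ is → ¬ All (λ i → flag i ≈ 0#) is → ∃[ i ] ¬ flag i ≈ 0#
      search []       h = contradiction [] h
      search (i ∷ is) h with flag i ≈? 0#
      ... | yes p = search is (λ ps → h (p ∷ ps))
      ... | no ¬p = i , ¬p
    ...   | j , j≉0 = inj₂ (fold-reaches (λ _ → ⊤) (λ x → ∃[ i ] ¬ flag i ≈ 0# × x ≡ value i) r
              (λ _ _ _ → tt) stays j (λ x _ → j , j≉0 , if-≉0 j≉0) {default} tt)
      where
      stays : ∀ i x → ⊤ → (∃[ i ] ¬ flag i ≈ 0# × x ≡ value i) →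
              ∃[ j ] ¬ flag j ≈ 0# × (if flag i ≈ᵇ 0# then x else value i) ≡ value j
      stays i x _ (j , j≉0 , e) with flag i ≈? 0#
      ... | yes p = j , j≉0 , ≡.trans (if-≈0 p) e
      ... | no ¬p = i , ¬p , if-≉0 ¬p

  -- The choice is made among functions on `⊤`, because scalars of the array language are arrays of
  -- shape `unit`; the procedure then denotes this flag by definition.
  any : ∀ r → (Idx r → Carrier) → Carrier
  any r flag = chooseLast r flag (λ _ _ → 1#) (λ (_ : ⊤) → 0#) tt

  any-spec : ∀ r flag → ((∀ i → flag i ≈ 0#) × any r flag ≈ 0#) ⊎
      ((∃[ i ] ¬ flag i ≈ 0#) × ¬ any r flag ≈ 0#)
  any-spec r flag with chooseLast-spec r flag (λ _ _ → 1#) (λ (_ : ⊤) → 0#)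
  ... | inj₁ (h , e)       = inj₁ (h , reflexive (≡.cong (λ f → f tt) e))
  ... | inj₂ (i , i≉0 , e) = inj₂ ((i , i≉0) , λ h → 1≉0
      (trans (sym (reflexive (≡.cong (λ f → f tt) e))) h))

  opaque
    -- The entries tested are those of U - X U, which vanish exactly when `X` fixes every column of
    -- `U`.
    notBelow : Op 𝑛ˢ → Op 𝑛ˢ → Carrier
    notBelow U X = any 𝑀 λ (p , q) → U (p , q) - ∑ 𝑛ˢ λ r → X (p , r) * U (r , q)

  opaque
    unfolding notBelow

    notBelow-spec : ∀ {U} X → IsProjection U →
      (((_∈ U) ⊆ (_∈ X)) × notBelow U X ≈ 0#) ⊎ ((∃[ x ] x ∈ U × ¬ x ∈ X) × ¬ notBelow U X ≈ 0#)
    notBelow-spec {U} X proj with any-spec 𝑀 (λ (p , q) → U (p , q) - ∑ 𝑛ˢ λ r → X (p , r) * U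
        (r , q))
    ... | inj₁ (h , e) = inj₁ (columns⊆ (isSubspace-∈ X) U
        (λ j p → sym (x-y≈0⇒x≈y (h (p , j)))) , e)
    ... | inj₂ (((p , q) , h) , e) = inj₂ ((col U q , column∈ proj q ,
            λ k → h (trans (+-congˡ (-‿cong (k p))) (-‿inverseʳ _))) , e)

  below? : ∀ {s} {U : Op s} X → IsProjection U → ((_∈ U) ⊆ (_∈ X)) ⊎ (∃[ x ] x ∈ U × ¬ x ∈ X)
  below? {s} {U} X proj with All.all? (λ j → col U j ∈? X) (enum s)
  ... | yes all = inj₁ (columns⊆ (isSubspace-∈ X) U (λ j → All.lookup all (∈-enum s j)))
  ... | no ¬all = inj₂ (search (enum s) ¬all)
    where
    search : ∀ js → ¬ All (λ j → col U j ∈ X) js → ∃[ x ] x ∈ U × ¬ x ∈ X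
    search []       h = contradiction [] h
    search (j ∷ js) h with col U j ∈? X
    ... | yes p = search js (λ ps → h (p ∷ ps))
    ... | no ¬p = col U j , column∈ proj j , ¬p

  full? : ∀ {s} (X : Op s) → (∀ x → x ∈ X) ⊎ (∃[ x ] ¬ x ∈ X)
  full? X = [ (λ h → inj₁ λ x → h x (ap-1 x)) , (λ (x , _ , h) → inj₂ (x , h)) ]′
      (below? X 1-isProjection)

  line : ∀ {s} → Vec s → Op s
  line x = insert 0ᵒ x

  module _ {s} (x : Vec s) where

    line-isProjection : IsProjection (line x)
    line-isProjection = Insertion.isProjection
        (insert-spec isSubspace-all {u = x} 0-isProjection (λ _ _ → _) _)

    line-∋ : x ∈ line x
    line-∋ = insert-∋ 0ᵒ x

    line-least : ∀ {ℓ} {X : Pred (Vec s) ℓ} → IsSubspace X → X x → (_∈ line x) ⊆ X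
    line-least isX h = Insertion.least (insert-spec isX 0-isProjection (0⊆ isX) h)

-- Finding a vector x in Λ x and an element of Λ with a nonzero eigenvalue

module Search {c ℓ₁ ℓ₂} (F : DiscreteField c ℓ₁ ℓ₂) (m n : ℕ) where
  open MatrixSpaces F m n public
  open SetoidReasoning setoid

  step : Op 𝑀 → Op 𝑛ˢ → Op 𝑛ˢ
  step Λ X = extend 0ᵒ Λ X

  -- n² + 1 multiplications by Λ, enough for the descending chain of the Λᵏ X to become stationary.
  opaque
    power : Op 𝑀 → Op 𝑛ˢ → Op 𝑛ˢ
    power Λ X = fold 𝑀 (λ _ Y → step Λ Y) (step Λ X)

  opaque
    unfolding power

    power-isProjection : ∀ Λ X → IsProjection (power Λ X)
    power-isProjection Λ X = fold-preserves IsProjection 𝑀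
      (λ _ Y _ → extend-isProjection 0-isProjection Λ Y) (extend-isProjection 0-isProjection Λ X)

  step-least : ∀ {ℓ} {Y : Pred V ℓ} → IsSubspace Y → ∀ {Λ X} → IsProjection Λ → IsProjection X →
               Maps Λ (_∈ X) Y → (_∈ step Λ X) ⊆ Y
  step-least isY {Λ} {X} projΛ projX h = extend-least 0-isProjection Λ X isY (0⊆ isY)
    (λ d j → h (column∈ projΛ d) (column∈ projX j))

  step-maps : ∀ Λ X → Maps Λ (_∈ X) (_∈ step Λ X)
  step-maps Λ X = extend-maps 0-isProjection Λ X

  exhausted : ∀ {s k} {Y : Op s} → IsProjection Y → card s ℕ.≤ k → k ℕ.+ dimension Y ℕ.≤ card s →
              (_∈ Y) ⊆ (_∈ 0ᵒ)
  exhausted {s} {k} {Y} proj n≤k le with below? {U = Y} 0ᵒ proj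
  ... | inj₁ h = h
  ... | inj₂ (y , y∈ , y∉) = contradiction
    (ℕₚ.<-≤-trans (ℕₚ.+-mono-≤-< n≤k (ℕₚ.≤-<-trans z≤n
      (dimension-strict {P = 0ᵒ} {Q = Y} 0-isProjection (0⊆ (isSubspace-∈ Y)) y∈ y∉))) le)
    (ℕₚ.≤⇒≯ (ℕₚ.m≤m+n (card s) 0))

  module _ {Λ : Op 𝑀} (Λ-closed : Closed Λ) where
    open Closed Λ-closed renaming (isProjection to projΛ)

    step-stable : ∀ X → IsProjection X → Maps Λ (_∈ step Λ X) (_∈ step Λ X)
    step-stable X proj {a} a∈ = step-least (preimage (applied a)
        (isSubspace-∈ (step Λ X))) projΛ proj
      (λ {b} {x} b∈ x∈ → resp (isSubspace-∈ (step Λ X)) (ap-mul a b x) (step-maps Λ X (closed a∈ b∈) x∈)) _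

    module _ {X : Op 𝑛ˢ} (projX : IsProjection X) where

      opaque
        unfolding power

        power-least : ∀ {ℓ} {U : Pred V ℓ} → IsSubspace U → (_∈ step Λ X) ⊆ U → Maps Λ U U →
                      (_∈ power Λ X) ⊆ U
        power-least {U = U} isU h stable = proj₂ (fold-preserves
            (λ Y → IsProjection Y × ((_∈ Y) ⊆ U)) 𝑀
          (λ _ Y (p , k) → extend-isProjection 0-isProjection Λ Y ,
            step-least isU projΛ p (λ a∈ y∈ → stable a∈ (k _ y∈)))
          (extend-isProjection 0-isProjection Λ X , h))

      power⊆step : (_∈ power Λ X) ⊆ (_∈ step Λ X)
      power⊆step = power-least (isSubspace-∈ _) (λ _ → id) (step-stable X projX)

      private
        n≤n² : ∀ k → k ℕ.≤ k ℕ.* k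
        n≤n² zero    = z≤n
        n≤n² (suc k) = ℕₚ.m≤m*n (suc k) (suc k)

        Stationary : Op 𝑛ˢ → Set (c ⊔ ℓ₁)
        Stationary Y = (_∈ Y) ⊆ (_∈ step Λ Y)

        -- Either the chain has become stationary, or each of the `k` steps has cost a dimension.
        -- After n² steps the second case leaves only the zero space, which is stationary too.
        Descent : ℕ → Op 𝑛ˢ → Set (c ⊔ ℓ₁)
        Descent k Y = IsProjection Y × Maps Λ (_∈ Y) (_∈ Y) ×
            (Stationary Y ⊎ k ℕ.+ dimension Y ℕ.≤ n)

        descend : ∀ (i : Idx 𝑀) k Y → Descent k Y → Descent (suc k) (step Λ Y)
        descend _ k Y (p , stable , d) = extend-isProjection 0-isProjection Λ Y , step-stable Y p , next d
          where
          next : Stationary Y ⊎ k ℕ.+ dimension Y ℕ.≤ n →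
                 Stationary (step Λ Y) ⊎ suc k ℕ.+ dimension (step Λ Y) ℕ.≤ n
          next (inj₁ h) = inj₁ (step-least (isSubspace-∈ (step Λ (step Λ Y))) projΛ p
            (λ a∈ y∈ → step-maps Λ (step Λ Y) a∈ (h _ y∈)))
          next (inj₂ le) with below? (step Λ Y) p
          ... | inj₁ h = next (inj₁ h)
          ... | inj₂ (y , y∈ , y∉) = inj₂ (ℕₚ.≤-trans (ℕₚ.≤-reflexive (≡.sym (ℕₚ.+-suc k _)))
                  (ℕₚ.≤-trans (ℕₚ.+-monoʳ-≤ k (dimension-strict {Q = Y}
                      (extend-isProjection 0-isProjection Λ Y)
                    (step-least (isSubspace-∈ Y) projΛ p stable) y∈ y∉)) le))

        opaque
          unfolding power

          descent : Descent (card 𝑀 ℕ.+ 0) (power Λ X)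
          descent = fold-counts Descent 𝑀 descend
            (extend-isProjection 0-isProjection Λ X , step-stable X projX , inj₂
                (dimension-≤ (step Λ X)))

      power-stable : Maps Λ (_∈ power Λ X) (_∈ power Λ X)
      power-stable = proj₁ (proj₂ descent)

      power-stationary : (_∈ power Λ X) ⊆ (_∈ step Λ (power Λ X))
      power-stationary = [ id , (λ le x x∈ → 0⊆ (isSubspace-∈ (step Λ (power Λ X))) x
          (exhausted (power-isProjection Λ X) (ℕₚ.≤-trans (n≤n² n) (ℕₚ.m≤m+n _ 0)) le x x∈)) ]′
        (proj₂ (proj₂ descent))

  private
    -- All products of `k` elements of `Λ` send `x` into `D`. As a subspace condition on `x`, it
    -- passes from the columns of a projection to its whole range.
    Kill : Op 𝑀 → Op 𝑛ˢ → ℕ → V → Set (c ⊔ ℓ₁)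
    Kill Λ D zero    x = Lift c (x ∈ D)
    Kill Λ D (suc k) x = ∀ a → a ∈ Λ → Kill Λ D k (ap a x)

    isSubspace-Kill : ∀ Λ D k → IsSubspace (Kill Λ D k)
    isSubspace-Kill Λ D zero = record
      { resp = λ e (lift h) → lift (resp (isSubspace-∈ D) e h)
      ; null = lift (null (isSubspace-∈ D))
      ; add = λ (lift h) (lift k) → lift (add (isSubspace-∈ D) h k)
      ; scale = λ a (lift h) → lift (scale (isSubspace-∈ D) a h)
      }
    isSubspace-Kill Λ D (suc k) = isSubspace-∀ λ a → isSubspace-∀ λ _ →
      preimage (applied a) (isSubspace-Kill Λ D k)

  opaque
    chooseVector : Op 𝑀 → Op 𝑛ˢ → Op 𝑛ˢ → V
    chooseVector Λ D X = chooseLast 𝑛ˢ (λ j → notBelow (power Λ (line (col X j))) D)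
        (λ j → col X j) 0ᵛ

  module _ {Λ : Op 𝑀} (projΛ : IsProjection Λ) (D : Op 𝑛ˢ) where

    private
      K : ℕ
      K = card 𝑀 ℕ.+ 1

      opaque
        unfolding power

        power-kill : ∀ X → (_∈ power Λ X) ⊆ (_∈ D) → (_∈ X) ⊆ Kill Λ D K
        power-kill X h = ≡.subst (λ k → (_∈ X) ⊆ Kill Λ D k) (ℕₚ.+-identityʳ K)
          (fold-counts Q 𝑀 {λ _ → step Λ} (λ _ k Z q j g → ≡.subst (λ l → (_∈ X) ⊆ Kill Λ D l)
              (ℕₚ.+-suc k j)
              (q (suc j) λ x x∈ a a∈ → g _ (step-maps Λ Z a∈ x∈)))
            {1} {step Λ X} (λ j g x x∈ a a∈ → g _ (step-maps Λ X a∈ x∈)) 0 (λ x x∈ → lift (h x x∈)))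
          where
          Q : ℕ → Op 𝑛ˢ → Set (c ⊔ ℓ₁)
          Q k Z = ∀ j → (_∈ Z) ⊆ Kill Λ D j → (_∈ X) ⊆ Kill Λ D (k ℕ.+ j)

      -- Since Y ⊆ Λ Y, each y is a combination of vectors a y′ with a in Λ and y′ in Y; this
      -- supplies one of the `k` factors, and the others go in the same way.
      stationary-kill : ∀ {Y} → IsProjection Y → (_∈ Y) ⊆ (_∈ step Λ Y) →
                        ∀ k → (_∈ Y) ⊆ Kill Λ D k → (_∈ Y) ⊆ (_∈ D)
      stationary-kill proj h zero    g = λ x x∈ → Lift.lower (g x x∈)
      stationary-kill proj h (suc k) g = stationary-kill proj h k λ x x∈ →
        step-least (isSubspace-Kill Λ D k) projΛ proj (λ a∈ y∈ → g _ y∈ _ a∈) x (h x x∈)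

    opaque
      unfolding chooseVector

      -- If Λᴺ y ⊆ D held for every column y of Y, then Λᴺ Y ⊆ D, and Y ⊆ Λ Y would give Y ⊆ D.
      chooseVector-spec : ∀ {Y} → IsProjection Y → (_∈ Y) ⊆ (_∈ step Λ Y) → ¬ ((_∈ Y) ⊆ (_∈ D)) →
                          chooseVector Λ D Y ∈ Y × ¬ ((_∈ power Λ (line (chooseVector Λ D Y))) ⊆
                              (_∈ D))
      chooseVector-spec {Y} proj stationary Y⊈D
        with chooseLast-spec 𝑛ˢ (λ j → notBelow (power Λ (line (col Y j))) D) (λ j → col Y j) 0ᵛ
      ... | inj₂ (j , h , e) rewrite e = column∈ proj j , λ sub → h (below sub)
        where
        below : (_∈ power Λ (line (col Y j))) ⊆ (_∈ D) → notBelow (power Λ (line (col Y j))) D ≈ 0#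
        below sub with notBelow-spec {power Λ (line (col Y j))} D (power-isProjection Λ _)
        ... | inj₁ (_ , z) = z
        ... | inj₂ ((x , x∈ , x∉) , _) = contradiction (sub x x∈) x∉
      ... | inj₁ (h , _) = contradiction
        (stationary-kill proj stationary K (columns⊆ (isSubspace-Kill Λ D K) Y λ j →
          power-kill (line (col Y j)) (sub j) (col Y j) (line-∋ (col Y j)))) Y⊈D
        where
        sub : ∀ j → (_∈ power Λ (line (col Y j))) ⊆ (_∈ D)
        sub j with notBelow-spec {power Λ (line (col Y j))} D (power-isProjection Λ _)
        ... | inj₁ (s , _) = s
        ... | inj₂ (_ , ¬z) = contradiction (h j) ¬z

  findStep : Op 𝑀 → Op 𝑛ˢ → V → V
  findStep Λ D x = if notBelow (line x) (step Λ (line x)) ≈ᵇ 0# then x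
    else chooseVector Λ D (power Λ (line x))

  opaque
    find : Op 𝑀 → Op 𝑛ˢ → V
    find Λ D = fold 𝑛ˢ (λ _ x → findStep Λ D x) (chooseVector Λ D (power Λ 1ᵒ))

  -- As long as x lies outside Λ x, choosing the next x inside the stable part of Λ x shrinks that part.
  module _ {Λ : Op 𝑀} (Λ-closed : Closed Λ) {D : Op 𝑛ˢ} (D-stable : Maps Λ (_∈ D) (_∈ D))
           (nonzero : ¬ ((_∈ power Λ 1ᵒ) ⊆ (_∈ D))) where
    open Closed Λ-closed renaming (isProjection to projΛ)

    private
      Good : V → Set ℓ₁
      Good x = x ∈ step Λ (line x)

      Progress : ℕ → V → Set (c ⊔ ℓ₁)
      Progress k x = ¬ ((_∈ power Λ (line x)) ⊆ (_∈ D)) ×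
                     (Good x ⊎ k ℕ.+ dimension (power Λ (line x)) ℕ.≤ n)

      choice : ∀ X → IsProjection X → ¬ ((_∈ power Λ X) ⊆ (_∈ D)) →
               chooseVector Λ D (power Λ X) ∈ power Λ X ×
               ¬ ((_∈ power Λ (line (chooseVector Λ D (power Λ X)))) ⊆ (_∈ D))
      choice X projX = chooseVector-spec projΛ D (power-isProjection Λ X)
          (power-stationary Λ-closed projX)

      module _ (k : ℕ) (x : V) (h : ¬ ((_∈ power Λ (line x)) ⊆ (_∈ D))) where

        Y Y′ : Op 𝑛ˢ
        x′ : V
        Y = power Λ (line x)
        x′ = chooseVector Λ D Y
        Y′ = power Λ (line x′)

        ch : x′ ∈ Y × ¬ ((_∈ Y′) ⊆ (_∈ D))
        ch = choice (line x) (line-isProjection x) h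

        Y′⊆Y : (_∈ Y′) ⊆ (_∈ Y)
        Y′⊆Y = power-least Λ-closed (line-isProjection x′) (isSubspace-∈ Y)
          (step-least (isSubspace-∈ Y) projΛ (line-isProjection x′)
            (λ {a} a∈ → line-least x′ (preimage (applied a) (isSubspace-∈ Y))
              (power-stable Λ-closed (line-isProjection x) a∈ (proj₁ ch)) _))
          (power-stable Λ-closed (line-isProjection x))

        improve : k ℕ.+ dimension Y ℕ.≤ n → Progress (suc k) x′
        improve bounded = proj₂ ch , progress (below? {U = Y} Y′ (power-isProjection Λ (line x)))
          where
          progress : ((_∈ Y) ⊆ (_∈ Y′)) ⊎ (∃[ y ] y ∈ Y × ¬ y ∈ Y′) →
                     Good x′ ⊎ suc k ℕ.+ dimension Y′ ℕ.≤ n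
          -- When the stable part does not shrink, x′ ∈ Y ⊆ Y′ ⊆ Λ x′, so the search has succeeded.
          progress (inj₁ Y⊆Y′) = inj₁ (power⊆step Λ-closed (line-isProjection x′) x′
              (Y⊆Y′ x′ (proj₁ ch)))
          progress (inj₂ (y , y∈ , y∉)) = inj₂ (ℕₚ.≤-trans (ℕₚ.≤-reflexive (≡.sym (ℕₚ.+-suc k _)))
            (ℕₚ.≤-trans (ℕₚ.+-monoʳ-≤ k
              (dimension-strict {P = Y′} {Q = Y} (power-isProjection Λ
                  (line x′)) Y′⊆Y y∈ y∉)) bounded))

      advance : ∀ k x → Progress k x → Progress (suc k) (findStep Λ D x)
      advance k x (h , g) = by-cases (notBelow-spec {line x} (step Λ (line x))
          (line-isProjection x))
        where
        by-cases : _ → Progress (suc k) (findStep Λ D x)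
        by-cases (inj₁ (sub , z)) = ≡.subst (Progress (suc k))
          (≡.sym (if-≈0 {y = x} {z = x′ k x h} z)) (h , inj₁ (sub x (line-∋ x)))
        by-cases (inj₂ ((y , y∈ , y∉) , ¬z)) = ≡.subst (Progress (suc k))
          (≡.sym (if-≉0 {y = x} {z = x′ k x h} ¬z))
          (improve k x h ([ (λ good → contradiction
              (line-least x (isSubspace-∈ _) good y y∈) y∉) , id ]′ g))

      opaque
        unfolding find

        result : Progress (n ℕ.+ 0) (find Λ D)
        result = fold-counts Progress 𝑛ˢ {λ _ → findStep Λ D}
            (λ _ → advance) {0} {chooseVector Λ D (power Λ 1ᵒ)}
          (proj₂ (choice 1ᵒ 1-isProjection nonzero) , inj₂
              (dimension-≤ (power Λ (line (chooseVector Λ D (power Λ 1ᵒ))))))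

    -- If x were in the stable subspace D, so would be Λᴺ x, which every choice along the way keeps
    -- outside D.
    find-∉ : ¬ find Λ D ∈ D
    find-∉ x∈ = proj₁ result (power-least Λ-closed (line-isProjection _) (isSubspace-∈ D)
      (step-least (isSubspace-∈ D) projΛ (line-isProjection _)
        (λ {a} a∈ → line-least _ (preimage (applied a) (isSubspace-∈ D)) (D-stable a∈ x∈) _))
      D-stable)

    -- After n unsuccessful rounds the stable part of Λ x would have dimension zero and hence lie in
    -- D.
    find-good : find Λ D ∈ step Λ (line (find Λ D))
    find-good = [ id , (λ le → contradiction
        (λ x x∈ → 0⊆ (isSubspace-∈ D) x (exhausted (power-isProjection Λ (line (find Λ D)))
            (ℕₚ.m≤m+n n 0) le x x∈))
        (proj₁ result)) ]′ (proj₂ result)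

  opaque
    -- Among the a in Λ with a x ∈ F x, one that does not kill x; it multiplies x by a nonzero
    -- scalar.
    eigenElement : Op 𝑀 → V → Vec 𝑀
    eigenElement Λ x = chooseLast (𝑀 ⊗ 𝑛ˢ)
      (λ (d , p) → ap (col (transporter Λ (line x) x) d) x p)
      (λ (d , p) → col (transporter Λ (line x) x) d) 0ᵒ

  module _ {Λ : Op 𝑀} (projΛ : IsProjection Λ) {x : V} (good : x ∈ step Λ (line x)) (x≉0 : ¬ x ≋ 0ᵛ) where

    private
      Λ′ = transporter Λ (line x) x

      fixing : ∃[ a ] a ∈ Λ × ap a x ≋ x
      fixing = extend-least 0-isProjection Λ (line x) isI (0⊆ isI)
        (λ d j → line-least x (preimage (applied (col Λ d)) isI)
          (col Λ d , column∈ projΛ d , λ _ → refl) _ (column∈ (line-isProjection x) j)) x good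
        where
        isI = image (applying x) (isSubspace-∈ Λ)

    opaque
      unfolding eigenElement

      eigenElement-spec : eigenElement Λ x ∈ Λ × ∃[ k ] ¬ k ≈ 0# × ap (eigenElement Λ x) x ≋ k ∙ᵛ x
      eigenElement-spec with chooseLast-spec (𝑀 ⊗ 𝑛ˢ) (λ (d , p) → ap (col Λ′ d) x p)
          (λ (d , p) → col Λ′ d) 0ᵒ
      -- Because x ∈ Λ x, some element of `Λ` fixes x. It belongs to the transporter, whose columns
      -- therefore cannot all kill x.
      ... | inj₁ (h , _) = contradiction
        (λ p → trans (sym (proj₂ (proj₂ fixing) p))
          (columns⊆ (preimage (applying x) isSubspace-≋0) Λ′ (λ d q → h (d , q)) (proj₁ fixing)
            (transporter-∋ projΛ (line x) x (proj₁ (proj₂ fixing))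
              (resp (isSubspace-∈ (line x)) (λ q → sym (proj₂ (proj₂ fixing) q)) (line-∋ x))) p))
        x≉0
      ... | inj₂ ((d , p) , h , e) rewrite e = transporter-⊆ projΛ
          (line x) x _ f∈ , proj₁ multiple ,
          (λ k≈0 → h (trans (proj₂ multiple p) (trans (*-congʳ k≈0) (zeroˡ _)))) , proj₂ multiple
        where
        f∈ : col Λ′ d ∈ Λ′
        f∈ = column∈ (transporter-isProjection projΛ (line x) x) d

        multiple : ∃[ k ] ap (col Λ′ d) x ≋ k ∙ᵛ x
        multiple = line-least x (isSubspace-line x) (1# , λ q → sym (*-identityˡ _)) _
          (transporter-maps projΛ (line x) x f∈)

  -- The power n² + 1 of f.
  opaque
    matrixPower : Vec 𝑀 → Vec 𝑀
    matrixPower f = fold 𝑀 (λ _ g → mul f g) f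

  opaque
    kernelIn : Op 𝑛ˢ → Vec 𝑀 → Op 𝑛ˢ
    kernelIn E g = cutAll 𝑛ˢ E λ p q → g (p , q)

  opaque
    unfolding matrixPower

    matrixPower-eigen : ∀ {f x k} → ¬ k ≈ 0# → ap f x ≋ k ∙ᵛ x →
                        ∃[ k′ ] ¬ k′ ≈ 0# × ap (matrixPower f) x ≋ k′ ∙ᵛ x
    matrixPower-eigen {f} {x} {k} k≉0 e = fold-preserves
        (λ g → ∃[ k′ ] ¬ k′ ≈ 0# × ap g x ≋ k′ ∙ᵛ x) 𝑀
      (λ _ g (k′ , k′≉0 , e′) → k′ * k , (λ z → k≉0 (*-cancel-0 k′≉0 z)) , λ p → begin
        ap (mul f g) x p        ≈⟨ ap-mul f g x p ⟩
        ap f (ap g x) p         ≈⟨ ap-cong f e′ p ⟩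
        ap f (k′ ∙ᵛ x) p        ≈⟨ ap-∙ f k′ x p ⟩
        k′ * ap f x p           ≈⟨ *-congˡ (e p) ⟩
        k′ * (k * x p)          ≈⟨ *-assoc _ _ _ ⟨
        k′ * k * x p            ∎)
      (k , k≉0 , e)

  opaque
    unfolding power

    power-induction : ∀ {p} (P : Op 𝑛ˢ → Set p) {Λ X} → P (step Λ X) → (∀ Y → P Y → P (step Λ Y)) →
                      P (power Λ X)
    power-induction P h g = fold-preserves P 𝑀 (λ _ → g) h

    power-related : ∀ {r} (R : Op 𝑛ˢ → Op 𝑛ˢ → Set r) {Λ Λ′ X} → R (step Λ X) (step Λ′ X) →
                    (∀ Y Y′ → R Y Y′ → R (step Λ Y) (step Λ′ Y′)) → R (power Λ X) (power Λ′ X)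
    power-related R {Λ} {Λ′} h g = fold-related R 𝑀 {λ _ → step Λ} {λ _ → step Λ′} (λ _ → g) h

  opaque
    unfolding power matrixPower

    -- The loops of `matrixPower` and `power` have the same length, so fᵏ V ⊆ Λᵏ V can be carried
    -- through both together. `P` records what is needed about Λᵏ V.
    matrixPower-power : ∀ {p} (P : Op 𝑛ˢ → Set p) {Λ f} → P 1ᵒ → (∀ Y → P Y → P (step Λ Y)) →
      (∀ {Y x} → P Y → x ∈ Y → ap f x ∈ step Λ Y) → ∀ x → ap (matrixPower f) x ∈ power Λ 1ᵒ
    matrixPower-power P {Λ} {f} p₁ p-step h = proj₂ (fold-related
      (λ g Y → P Y × (∀ x → ap g x ∈ Y)) 𝑀 {λ _ g → mul f g} {λ _ → step Λ}
      (λ _ g Y (p , k) → p-step Y p , λ x → resp (isSubspace-∈ (step Λ Y))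
          (λ i → sym (ap-mul f g x i)) (h p (k x)))
      {f} {step Λ 1ᵒ} (p-step 1ᵒ p₁ , λ x → h p₁ (ap-1 x)))

    matrixPower-induction : ∀ {p} (P : Vec 𝑀 → Set p) {f} → P f → (∀ g → P g → P (mul f g)) → P
        (matrixPower f)
    matrixPower-induction P h g = fold-preserves P 𝑀 (λ _ → g) h

  -- The right ideals fᵏ A become stationary, so that fᴺ is a multiple fᴺ c of itself with c in fᴺ A.
  module _ {A : Op 𝑀} (A-closed : Closed A) (1∈A : 1ᵒ ∈ A) {f : Vec 𝑀} (f∈ : f ∈ A) where
    open Closed A-closed renaming (isProjection to projA)

    private
      times : Op 𝑀 → Op 𝑀
      times Z = insertAll 𝑀 0ᵒ λ d → mul f (col Z d)

      times-isProjection : ∀ Z → IsProjection (times Z)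
      times-isProjection Z = insertAll-isProjection 𝑀 _ 0-isProjection

      times-∋ : ∀ Z {y} → y ∈ Z → mul f y ∈ times Z
      times-∋ Z y∈ = columns⊆ (preimage (mulˡ f) (isSubspace-∈ (times Z))) Z
        (insertAll-∋ 𝑀 _ 0-isProjection) _ y∈

      times-least : ∀ {ℓ} {X : Pred (Vec 𝑀) ℓ} → IsSubspace X → ∀ {Z} → IsProjection Z →
                    (∀ {y} → y ∈ Z → X (mul f y)) → (_∈ times Z) ⊆ X
      times-least isX proj h = Insertion.least
        (insertAll-spec isX 𝑀 0-isProjection (0⊆ isX) (λ d → h (column∈ proj d)))

      Descent : ℕ → Op 𝑀 → Set (c ⊔ ℓ₁)
      Descent k Z = IsProjection Z × ((_∈ times Z) ⊆ (_∈ Z)) ×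
                    (((_∈ Z) ⊆ (_∈ times Z)) ⊎ k ℕ.+ dimension Z ℕ.≤ card 𝑀)

      descend : ∀ (i : Idx 𝑀) k Z → Descent k Z → Descent (suc k) (times Z)
      descend _ k Z (p , sub , d) = times-isProjection Z ,
        times-least (isSubspace-∈ (times Z)) (times-isProjection Z)
            (λ y∈ → times-∋ Z (sub _ y∈)) , next d
        where
        next : ((_∈ Z) ⊆ (_∈ times Z)) ⊎ k ℕ.+ dimension Z ℕ.≤ card 𝑀 →
               ((_∈ times Z) ⊆ (_∈ times (times Z))) ⊎ suc k ℕ.+ dimension (times Z) ℕ.≤ card 𝑀
        next (inj₁ h) = inj₁ (times-least (isSubspace-∈ _) p (λ y∈ → times-∋ (times Z) (h _ y∈)))
        next (inj₂ le) with below? (times Z) p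
        ... | inj₁ h = next (inj₁ h)
        ... | inj₂ (y , y∈ , y∉) = inj₂ (ℕₚ.≤-trans (ℕₚ.≤-reflexive (≡.sym (ℕₚ.+-suc k _)))
                (ℕₚ.≤-trans (ℕₚ.+-monoʳ-≤ k (dimension-strict {P = times Z} {Q = Z}
                    (times-isProjection Z) sub y∈ y∉)) le))

      opaque
        Z : Op 𝑀
        Z = fold 𝑀 (λ _ → times) (times A)

        Z-descent : Descent (card 𝑀 ℕ.+ 0) Z
        Z-descent = fold-counts Descent 𝑀 {λ _ → times} descend {0} {times A}
          (times-isProjection A ,
           times-least (isSubspace-∈ _) (times-isProjection A)
             (λ y∈ → times-∋ A (times-least (isSubspace-∈ A) projA (closed f∈) _ y∈)) ,
           inj₂ (dimension-≤ (times A)))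

      opaque
        unfolding Z matrixPower

        Z-power : matrixPower f ∈ Z × ((_∈ Z) ⊆ (λ y → ∃[ a ] a ∈ A × mul (matrixPower f) a ≋ y))
        Z-power = proj₂ (fold-related
          (λ g Z → IsProjection Z × g ∈ Z × ((_∈ Z) ⊆ (λ y → ∃[ a ] a ∈ A × mul g a ≋ y))) 𝑀
          {λ _ g → mul f g} {λ _ → times}
          (λ _ g Z (p , g∈ , h) → times-isProjection Z , times-∋ Z g∈ ,
            times-least (image (mulˡ (mul f g)) (isSubspace-∈ A)) p (λ y∈ → let (a , a∈ , e) = h _ y∈ in
              a , a∈ , λ i → trans (mul-assoc f g a i) (Linear.cong (mulˡ f) e i)))
          {f} {times A}
          (times-isProjection A , resp (isSubspace-∈ (times A)) (mul-1ʳ f) (times-∋ A 1∈A) ,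
           times-least (image (mulˡ f) (isSubspace-∈ A)) projA (λ {y} y∈ → y , y∈ , λ _ → refl)))

      Z-stationary : (_∈ Z) ⊆ (_∈ times Z)
      Z-stationary = [ id , (λ le x x∈ → 0⊆ (isSubspace-∈ (times Z)) x
          (exhausted (proj₁ Z-descent) (ℕₚ.m≤m+n (card 𝑀) 0) le x x∈)) ]′
        (proj₂ (proj₂ Z-descent))

      g = matrixPower f

      -- With g = fᴺ, stationarity of the right ideals says that g A = f g A, and g itself belongs
      -- to g A.
      recurrence : ∃[ a ] a ∈ A × mul f (mul g a) ≋ g
      recurrence = times-least {X = λ y → ∃[ a ] a ∈ A × mul f (mul g a) ≋ y}
        (image L (isSubspace-∈ A)) (proj₁ Z-descent)
        (λ {y} y∈ → let (a , a∈ , e) = proj₂ Z-power y y∈ in a , a∈ , Linear.cong (mulˡ f) e)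
        g (Z-stationary g (proj₁ Z-power))
        where
        L : Linear (λ a → mul f (mul g a))
        L = record
          { cong = λ e → Linear.cong (mulˡ f) (Linear.cong (mulˡ g) e)
          ; homo-0 = λ i → trans (Linear.cong (mulˡ f) (Linear.homo-0 (mulˡ g)) i)
              (Linear.homo-0 (mulˡ f) i)
          ; homo-+ = λ x y i → trans (Linear.cong (mulˡ f) (Linear.homo-+ (mulˡ g) x y) i)
              (Linear.homo-+ (mulˡ f) (mul g x) (mul g y) i)
          ; homo-∙ = λ k x i → trans (Linear.cong (mulˡ f) (Linear.homo-∙ (mulˡ g) k x) i)
              (Linear.homo-∙ (mulˡ f) k (mul g x) i)
          }

    fitting : ∃[ b ] b ∈ A × mul (matrixPower f) (mul (matrixPower f) b) ≋ matrixPower f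
    -- The recurrence is extended from f to its powers h: in (f h) g (b a) the factor h g b equals
    -- g, and f g a is g again. At h = g this is the claim.
    fitting = matrixPower-induction (λ h → ∃[ b ] b ∈ A × mul h (mul g b) ≋ g) recurrence
      λ h (b , b∈ , e) → let (a , a∈ , e′) = recurrence in
        mul b a , closed b∈ a∈ , λ i → begin
          mul (mul f h) (mul g (mul b a)) i     ≈⟨ Linear.cong (mulˡ (mul f h))
              (λ j → sym (mul-assoc g b a j)) i ⟩
          mul (mul f h) (mul (mul g b) a) i     ≈⟨ mul-assoc f h (mul (mul g b) a) i ⟩
          mul f (mul h (mul (mul g b) a)) i     ≈⟨ Linear.cong (mulˡ f)
              (λ j → sym (mul-assoc h (mul g b) a j)) i ⟩
          mul f (mul (mul h (mul g b)) a) i     ≈⟨ Linear.cong (mulˡ f) (Linear.cong (mulʳ a) e) i ⟩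
          mul f (mul g a) i                     ≈⟨ e′ i ⟩
          g i                                   ∎

  module _ {E : Op 𝑛ˢ} (projE : IsProjection E) (g : Vec 𝑀) where
    opaque
      unfolding kernelIn

      kernelIn-isProjection : IsProjection (kernelIn E g)
      kernelIn-isProjection = cutAll-isProjection 𝑛ˢ _ projE

      kernelIn-⊆ : (_∈ kernelIn E g) ⊆ (_∈ E)
      kernelIn-⊆ = cutAll-⊆ 𝑛ˢ _ projE

      kernelIn-kills : ∀ {x} → x ∈ kernelIn E g → ap g x ≋ 0ᵛ
      kernelIn-kills x∈ p = cutAll-kills 𝑛ˢ _ projE p x∈

      kernelIn-∋ : ∀ {x} → x ∈ E → ap g x ≋ 0ᵛ → x ∈ kernelIn E g
      kernelIn-∋ x∈ h = cutAll-∋ 𝑛ˢ _ projE x∈ h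

-- The algebra, relations between generators, and the invariant

module GeneratorSearch {c ℓ₁ ℓ₂} (F : DiscreteField c ℓ₁ ℓ₂) (m n : ℕ)
                       (S : Vector (MatrixModule.Matrix F n) m) where
  open Search F m n public

  gen : Idx 𝑚ˢ → Vec 𝑀
  gen k (i , j) = S k i j

  1ᴹ : Vec 𝑀
  1ᴹ = 1ᵒ

  opaque
    algebra : Op 𝑀
    algebra = fold 𝑀 (λ _ P → insertAll (𝑚ˢ ⊗ 𝑀) P λ (k , d) → mul (gen k) (col P d)) (line 1ᴹ)

    algebra-isProjection : IsProjection algebra
    algebra-isProjection = fold-preserves IsProjection 𝑀
      (λ _ P p → insertAll-isProjection (𝑚ˢ ⊗ 𝑀) _ p) (line-isProjection 1ᴹ)

    algebra-1 : 1ᴹ ∈ algebra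
    algebra-1 = proj₂ (fold-preserves (λ P → IsProjection P × _∈_ {𝑀} 1ᴹ P) 𝑀
      (λ _ P (p , h) → insertAll-isProjection (𝑚ˢ ⊗ 𝑀) _ p , insertAll-⊇ (𝑚ˢ ⊗ 𝑀) _ p 1ᴹ h)
      (line-isProjection 1ᴹ , line-∋ 1ᴹ))

    algebra-least : ∀ {ℓ} {X : Pred (Vec 𝑀) ℓ} → IsSubspace X → X 1ᴹ →
        (∀ k {b} → X b → X (mul (gen k) b)) →
                    (_∈ algebra) ⊆ X
    algebra-least {X = X} isX x₁ h = proj₂ (fold-preserves (λ P → IsProjection P × ((_∈ P) ⊆ X)) 𝑀
      (λ _ P (p , P⊆X) → insertAll-isProjection (𝑚ˢ ⊗ 𝑀) _ p ,
        Insertion.least (insertAll-spec isX (𝑚ˢ ⊗ 𝑀) p P⊆X λ (k , d) → h k (P⊆X _ (column∈ p d))))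
      (line-isProjection 1ᴹ , line-least 1ᴹ isX x₁))

    -- Each of the n² rounds enlarges the space unless it is closed already. If it grew every time,
    -- it has dimension n² and is the space of all matrices.
    algebra-gen : ∀ k {b} → b ∈ algebra → mul (gen k) b ∈ algebra
    algebra-gen = finish (fold-counts Ascent 𝑀 {λ _ → grow} (λ _ → ascend) {0} {line 1ᴹ}
        (line-isProjection 1ᴹ , inj₂ z≤n))
      where
      grow : Op 𝑀 → Op 𝑀
      grow P = insertAll (𝑚ˢ ⊗ 𝑀) P λ (k , d) → mul (gen k) (col P d)

      GenClosed : Op 𝑀 → Set (c ⊔ ℓ₁)
      GenClosed P = ∀ k {b} → b ∈ P → mul (gen k) b ∈ P

      Ascent : ℕ → Op 𝑀 → Set (c ⊔ ℓ₁)
      Ascent k P = IsProjection P × (GenClosed P ⊎ k ℕ.≤ dimension P)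

      grow-∋ : ∀ {P} → IsProjection P → ∀ k {b} → b ∈ P → mul (gen k) b ∈ grow P
      grow-∋ {P} p k b∈ = columns⊆ (preimage (mulˡ (gen k)) (isSubspace-∈ (grow P))) P
        (λ d → insertAll-∋ (𝑚ˢ ⊗ 𝑀) _ p (k , d)) _ b∈

      grow-isProjection : ∀ {P} → IsProjection P → IsProjection (grow P)
      grow-isProjection p = insertAll-isProjection (𝑚ˢ ⊗ 𝑀) _ p

      closed-grow : ∀ {P} → IsProjection P → GenClosed P → GenClosed (grow P)
      closed-grow {P} p h k b∈ = grow-∋ p k (Insertion.least
        (insertAll-spec (isSubspace-∈ P) (𝑚ˢ ⊗ 𝑀) p (λ _ → id) λ (k , d) → h k (column∈ p d)) _ b∈)

      ascend : ∀ k P → Ascent k P → Ascent (suc k) (grow P)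
      ascend k P (p , inj₁ h) = grow-isProjection p , inj₁ (closed-grow p h)
      ascend k P (p , inj₂ le) with below? {U = grow P} P (grow-isProjection p)
      ... | inj₁ sub = grow-isProjection p , inj₁ (closed-grow p λ k b∈ → sub _ (grow-∋ p k b∈))
      ... | inj₂ (y , y∈ , y∉) = grow-isProjection p , inj₂ (ℕₚ.≤-<-trans le
              (dimension-strict {P = P} {Q = grow P} p (insertAll-⊇ (𝑚ˢ ⊗ 𝑀) _ p) y∈ y∉))

      finish : ∀ {P} → IsProjection P × (GenClosed P ⊎ card 𝑀 ℕ.+ 0 ℕ.≤ dimension P) → GenClosed P
      finish (p , inj₁ h) = h
      finish {P} (p , inj₂ le) with full? P
      ... | inj₁ h = λ k b∈ → h _
      ... | inj₂ (x , x∉) = contradiction (dimension-< p x∉)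
          (ℕₚ.≤⇒≯ (ℕₚ.≤-trans (ℕₚ.m≤m+n (card 𝑀) 0) le))

  A = algebra
  projA = algebra-isProjection

  algebra-closed : Closed A
  algebra-closed = record
    { isProjection = algebra-isProjection
    -- Only left multiplication by the given matrices is built in. The a with a b in `A` form a
    -- subspace containing 1 and stable under it, hence containing `A`.
    ; closed = λ {a} {b} a∈ b∈ → algebra-least (preimage (mulʳ b) (isSubspace-∈ A))
        (resp (isSubspace-∈ A) (λ i → sym (mul-1ˡ b i)) b∈)
        (λ k {a} h → resp (isSubspace-∈ A) (λ i → sym (mul-assoc (gen k) a b i))
            (algebra-gen k h)) a a∈
    }

  open Closed algebra-closed using () renaming (closed to A-closed) public

  Stable : ∀ {ℓ} → Pred V ℓ → Set (c ⊔ ℓ₁ ⊔ ℓ)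
  Stable X = Maps A X X

  -- The columns of v are the generators found so far, and o is the unit vector of an index i.  With
  -- R = restricted E, relations W E v o consists of the r in R with r vᵢ ∈ W + Σ_{j ≠ i} R vⱼ.

  restricted : Op 𝑛ˢ → Op 𝑀
  restricted E = ranged A E

  masked : Op 𝑛ˢ → V → Op 𝑛ˢ
  masked v o (p , j) = v (p , j) * (1# - o j)

  others : Op 𝑛ˢ → Op 𝑛ˢ → Op 𝑛ˢ → V → Op 𝑛ˢ
  others W E v o = extend W (restricted E) (masked v o)

  relations : Op 𝑛ˢ → Op 𝑛ˢ → Op 𝑛ˢ → V → Op 𝑀
  relations W E v o = transporter (restricted E) (others W E v o) (ap v o)

  generated : Op 𝑛ˢ → Op 𝑛ˢ → Op 𝑛ˢ
  generated W v = extend W A v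

  plus : Op 𝑛ˢ → Op 𝑛ˢ → Op 𝑛ˢ
  plus P Q = insertAll 𝑛ˢ P (col Q)

  module _ {P : Op 𝑛ˢ} (projP : IsProjection P) (Q : Op 𝑛ˢ) where

    plus-isProjection : IsProjection (plus P Q)
    plus-isProjection = insertAll-isProjection 𝑛ˢ _ projP

    plus-⊇ˡ : (_∈ P) ⊆ (_∈ plus P Q)
    plus-⊇ˡ = insertAll-⊇ 𝑛ˢ _ projP

    plus-⊇ʳ : (_∈ Q) ⊆ (_∈ plus P Q)
    plus-⊇ʳ = columns⊆ (isSubspace-∈ (plus P Q)) Q (insertAll-∋ 𝑛ˢ _ projP)

    plus-least : ∀ {ℓ} {X : Pred V ℓ} → IsSubspace X → IsProjection Q → (_∈ P) ⊆ X → (_∈ Q) ⊆ X →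
        (_∈ plus P Q) ⊆ X
    plus-least isX projQ P⊆X Q⊆X = Insertion.least
      (insertAll-spec isX 𝑛ˢ projP P⊆X (λ j → Q⊆X _ (column∈ projQ j)))

  -- The level of `X` admits predicates that quantify over matrices; the dimension count for the
  -- lower bound uses such a one.
  Generates : ∀ {k} → (Fin k → V) → Set (lsuc (c ⊔ ℓ₁))
  Generates w = ∀ (X : Pred V (c ⊔ ℓ₁)) → IsSubspace X → Stable X → (∀ j → X (w j)) → ∀ x → X x

  count : ∀ k → (Fin k → Carrier) → ℕ
  count zero    f = 0
  count (suc k) f = (if f zero ≈ᵇ 0# then 0 else 1) ℕ.+ count k (f ∘ suc)

  -- `v` has n columns from the start, and `act` marks those in use; the others are zero. That
  -- suffices because the standard basis generates V.
  record Invariant (W E v : Op 𝑛ˢ) (act : V) : Set (lsuc (c ⊔ ℓ₁)) where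
    field
      projW    : IsProjection W
      stableW  : Stable (_∈ W)
      small    : ∀ U → IsProjection U → Stable (_∈ U) → (∀ x → x ∈ plus U W) → ∀ x → x ∈ U
      projE    : IsProjection E
      -- This is V = A v + A R V + W, expressed through the submodules that contain all three
      -- summands.
      spanning : ∀ X → IsProjection X → Stable (_∈ X) → (_∈ W) ⊆ (_∈ X) → (∀ j → col v j ∈ X) →
                 (∀ {r} → r ∈ restricted E → ∀ y → ap r y ∈ X) → ∀ x → x ∈ X
      bits     : ∀ j → act j ≈ 0# ⊎ act j ≈ 1#
      idle     : ∀ j → act j ≈ 0# → col v j ≋ 0ᵛ
      lower    : ∀ k (w : Fin k → V) → Generates w → count n act ℕ.≤ k

  module Stage {W E v : Op 𝑛ˢ} {act : V} (inv : Invariant W E v act) where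
    open Invariant inv public

    R : Op 𝑀
    R = restricted E

    projR : IsProjection R
    projR = ranged-isProjection projA E

    R⊆A : (_∈ R) ⊆ (_∈ A)
    R⊆A = ranged-⊆ projA E

    R-maps : ∀ {r} → r ∈ R → ∀ x → ap r x ∈ E
    R-maps = ranged-maps projA E

    R-right : ∀ {r a} → r ∈ R → a ∈ A → mul r a ∈ R
    R-right {r} {a} r∈ a∈ = ranged-∋ projA E (A-closed (R⊆A r r∈) a∈)
      λ x → resp (isSubspace-∈ E) (λ i → sym (ap-mul r a x i)) (R-maps r∈ (ap a x))

    D : Op 𝑛ˢ
    D = generated W v

    projD : IsProjection D
    projD = extend-isProjection projW A v

    W⊆D : (_∈ W) ⊆ (_∈ D)
    W⊆D = extend-⊇ projW A v

    v∈D : ∀ j → col v j ∈ D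
    v∈D j = resp (isSubspace-∈ D) (ap-1 (col v j)) (extend-column projW A v j algebra-1)

    D-least : ∀ {ℓ} {X : Pred V ℓ} → IsSubspace X → Stable X → (_∈ W) ⊆ X → (∀ j → X (col v j)) →
        (_∈ D) ⊆ X
    D-least isX st W⊆X h = extend-least projW A v isX W⊆X (λ d j → st (column∈ projA d) (h j))

  extend-stable : ∀ {W} → IsProjection W → Stable (_∈ W) → ∀ v → Stable (_∈ generated W v)
  extend-stable {W} projW stableW v {a} a∈ = extend-least projW A v
      (preimage (applied a) (isSubspace-∈ _))
    (λ x x∈ → extend-⊇ projW A v _ (stableW a∈ x∈))
    (λ d j → resp (isSubspace-∈ (generated W v)) (ap-mul a (col A d) (col v j))
      (extend-column projW A v j (A-closed a∈ (column∈ projA d)))) _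

  module Relation {W E v : Op 𝑛ˢ} {act : V} (inv : Invariant W E v act) (i : Idx 𝑛ˢ) where
    open Stage inv public

    o : V
    o = unitᵛ i

    B : Op 𝑛ˢ
    B = others W E v o

    T : Op 𝑀
    T = relations W E v o

    projT : IsProjection T
    projT = transporter-isProjection projR B (ap v o)

    T⊆R : (_∈ T) ⊆ (_∈ R)
    T⊆R = transporter-⊆ projR B (ap v o)

    vᵢ : V
    vᵢ = col v i

    T-maps : ∀ {t} → t ∈ T → ap t vᵢ ∈ B
    T-maps {t} t∈ = resp (isSubspace-∈ B) (ap-cong t (ap-unit v i))
        (transporter-maps projR B (ap v o) t∈)

    T-∋ : ∀ {r} → r ∈ R → ap r vᵢ ∈ B → r ∈ T
    T-∋ {r} r∈ h = transporter-∋ projR B (ap v o) r∈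
      (resp (isSubspace-∈ B) (ap-cong r (λ p → sym (ap-unit v i p))) h)

    o-other : ∀ {j} → j ≢ i → o j ≡ 0#
    o-other {j} j≢i with j Finₚ.≟ i
    ... | yes p = contradiction p j≢i
    ... | no _  = ≡.refl

    o-self : o i ≡ 1#
    o-self with i Finₚ.≟ i
    ... | yes _ = ≡.refl
    ... | no q  = contradiction ≡.refl q

    masked-other : ∀ {j} → j ≢ i → col (masked v o) j ≋ col v j
    masked-other j≢i p = trans (*-congˡ (trans (+-congˡ (-‿cong (reflexive (o-other j≢i))))
        (x-0≈x 1#))) (*-identityʳ _)

    masked-self : col (masked v o) i ≋ 0ᵛ
    masked-self p = trans (*-congˡ (trans (+-congˡ (-‿cong (reflexive o-self))) (-‿inverseʳ 1#)))
        (zeroʳ _)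

    B-least : ∀ {ℓ} {X : Pred V ℓ} → IsSubspace X → (_∈ W) ⊆ X →
        (∀ {j r} → j ≢ i → r ∈ R → X (ap r (col v j))) →
              (_∈ B) ⊆ X
    B-least isX W⊆X h = extend-least projW R (masked v o) isX W⊆X member
      where
      member : ∀ d j → _
      member d j with j Finₚ.≟ i
      ... | no j≢i = resp isX (ap-cong (col R d) (λ p → sym (masked-other j≢i p)))
          (h j≢i (column∈ projR d))
      ... | yes ≡.refl = resp isX
              (λ p → sym (trans (ap-cong (col R d) masked-self p) (ap-0 (col R d) p))) (null isX)

    B-∋ : ∀ {j r} → j ≢ i → r ∈ R → ap r (col v j) ∈ B
    B-∋ {j} {r} j≢i r∈ = resp (isSubspace-∈ B) (ap-cong r (masked-other j≢i))
      (extend-column projW R (masked v o) j r∈)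

    W⊆B : (_∈ W) ⊆ (_∈ B)
    W⊆B = extend-⊇ projW R (masked v o)

    B-stable : Maps R (_∈ B) (_∈ B)
    B-stable {r} r∈ = B-least (preimage (applied r) (isSubspace-∈ B))
      (λ x x∈ → W⊆B _ (stableW (R⊆A r r∈) x∈))
      (λ {j} {r′} j≢i r′∈ → resp (isSubspace-∈ B) (ap-mul r r′ (col v j))
        (B-∋ j≢i (R-right r∈ (R⊆A r′ r′∈)))) _

    -- `R` maps `B` into itself, as R R ⊆ R. It follows that (T A)(T A) ⊆ R T A ⊆ T A, although T
    -- need not be an ideal of A.
    T-left : ∀ {r t} → r ∈ R → t ∈ T → mul r t ∈ T
    T-left {r} {t} r∈ t∈ = T-∋ (R-right r∈ (R⊆A t (T⊆R t t∈)))
      (resp (isSubspace-∈ B) (λ p → sym (ap-mul r t vᵢ p)) (B-stable r∈ (T-maps t∈)))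

    AT TA : Op 𝑀
    AT = products A T
    TA = products T A

    TA⊆R : (_∈ TA) ⊆ (_∈ R)
    TA⊆R = products-least (isSubspace-∈ R) projT projA λ t∈ a∈ → R-right (T⊆R _ t∈) a∈

    AT⊆A : (_∈ AT) ⊆ (_∈ A)
    AT⊆A = products-least (isSubspace-∈ A) projA projT λ a∈ t∈ → A-closed a∈ (R⊆A _ (T⊆R _ t∈))

    T⊆AT : (_∈ T) ⊆ (_∈ AT)
    T⊆AT t t∈ = resp (isSubspace-∈ AT) (mul-1ˡ t) (products-∋ algebra-1 t∈)

    AT-left : ∀ {a b} → a ∈ A → b ∈ AT → mul a b ∈ AT
    AT-left {a} a∈ = products-least (preimage (mulˡ a) (isSubspace-∈ AT)) projA projT
      (λ {b} {t} b∈ t∈ → resp (isSubspace-∈ AT) (mul-assoc a b t) (products-∋ (A-closed a∈ b∈) t∈)) _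

    AT-closed : Closed AT
    AT-closed = record
      { isProjection = products-isProjection A T
      ; closed = λ a∈ b∈ → AT-left (AT⊆A _ a∈) b∈
      }

    TA-closed : Closed TA
    TA-closed = record
      { isProjection = products-isProjection T A
      ; closed = λ {a} {b} a∈ b∈ → products-least (preimage (mulˡ a) (isSubspace-∈ TA)) projT projA
          (λ {t} {a′} t∈ a′∈ → resp (isSubspace-∈ TA) (mul-assoc a t a′)
            (products-∋ (T-left (TA⊆R a a∈) t∈) a′∈)) b b∈
      }

    step-AT-stable : ∀ X → Stable (_∈ step AT X)
    step-AT-stable X {a} a∈ = extend-least 0-isProjection AT X
        (preimage (applied a) (isSubspace-∈ (step AT X)))
      (0⊆ (preimage (applied a) (isSubspace-∈ (step AT X))))
      (λ d j → resp (isSubspace-∈ (step AT X)) (ap-mul a (col AT d) (col X j))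
        (extend-column 0-isProjection AT X j (AT-left a∈
            (column∈ (products-isProjection A T) d)))) _

-- The three ways of using a relation that moves V outside W

module GeneratorSteps {c ℓ₁ ℓ₂} (F : DiscreteField c ℓ₁ ℓ₂) (m n : ℕ)
                      (S : Vector (MatrixModule.Matrix F n) m) where
  open GeneratorSearch F m n S public

  weight : Op 𝑛ˢ → Op 𝑛ˢ → V → ℕ
  weight W v act = dimension W ℕ.+ dimension (generated W v) ℕ.+ count n act

  record Improves (W E v : Op 𝑛ˢ) (act : V) (W′ E′ v′ : Op 𝑛ˢ) (act′ : V) : Set
      (lsuc (c ⊔ ℓ₁)) where
    constructor improves
    field
      invariant : Invariant W′ E′ v′ act′
      -- The potential is `weight` minus the dimension of E; the terms are arranged so that natural
      -- numbers suffice.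
      progress  : dimension E′ ℕ.+ weight W v act ℕ.< dimension E ℕ.+ weight W′ v′ act′

  module _ {W E v : Op 𝑛ˢ} {act : V} (inv : Invariant W E v act) (i : Idx 𝑛ˢ) where
    open Relation inv i

    module Superfluous (sub : (_∈ power AT 1ᵒ) ⊆ (_∈ W)) {y : V} (y∈ : y ∈ step T 1ᵒ) (y∉ : ¬ y ∈ W) where

      W′ : Op 𝑛ˢ
      W′ = extend W AT 1ᵒ

      projW′ : IsProjection W′
      projW′ = extend-isProjection projW AT 1ᵒ

      W⊆W′ : (_∈ W) ⊆ (_∈ W′)
      W⊆W′ = extend-⊇ projW AT 1ᵒ

      W′-stable : Stable (_∈ W′)
      W′-stable {a} a∈ = extend-least projW AT 1ᵒ (preimage (applied a) (isSubspace-∈ W′))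
        (λ x x∈ → W⊆W′ _ (stableW a∈ x∈))
        (λ d j → resp (isSubspace-∈ W′) (ap-mul a (col AT d) (col 1ᵒ j))
          (extend-column projW AT 1ᵒ j (AT-left a∈ (column∈ (Closed.isProjection AT-closed) d)))) _

      -- Nakayama's lemma for the ideal generated by T, some power of which maps V into W.
      small′ : ∀ U → IsProjection U → Stable (_∈ U) → (∀ x → x ∈ plus U W′) → ∀ x → x ∈ U
      small′ U projU stableU full = small U projU stableU λ x →
        plus-least U′-proj (power AT 1ᵒ) (isSubspace-∈ U′) (power-isProjection AT 1ᵒ) (λ _ → id)
          (λ y y∈ → plus-⊇ʳ projU W y (sub y y∈)) x (nakayama x)
        where
        U′ = plus U W
        U′-proj = plus-isProjection projU W

        U′-stable : Stable (_∈ U′)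
        U′-stable {a} a∈ = plus-least projU W (preimage (applied a) (isSubspace-∈ U′)) projW
          (λ x x∈ → plus-⊇ˡ projU W _ (stableU a∈ x∈))
              (λ x x∈ → plus-⊇ʳ projU W _ (stableW a∈ x∈)) _

        first : ∀ {ℓ} {X : Pred V ℓ} → IsSubspace X → (_∈ U′) ⊆ X → (_∈ step AT 1ᵒ) ⊆ X → ∀ x → X x
        first {X = X} isX U′⊆X step⊆X x = plus-least projU W′ isX projW′
          (λ y y∈ → U′⊆X y (plus-⊇ˡ projU W y y∈))
          (extend-least projW AT 1ᵒ isX (λ y y∈ → U′⊆X y (plus-⊇ʳ projU W y y∈))
            (λ d j → step⊆X _ (extend-column 0-isProjection AT 1ᵒ j
                (column∈ (Closed.isProjection AT-closed) d))))
          x (full x)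

        -- Substituting V = U + W + A T V into its last summand gives V = U + W + (A T)ᵏ V for every
        -- k ≥ 1.
        nakayama : ∀ x → x ∈ plus U′ (power AT 1ᵒ)
        nakayama = proj₂ (power-induction (λ Y → IsProjection Y × (∀ x → x ∈ plus U′ Y))
          (extend-isProjection 0-isProjection AT 1ᵒ ,
           first (isSubspace-∈ _) (plus-⊇ˡ U′-proj _) (plus-⊇ʳ U′-proj _))
          (λ Y (projY , h) → extend-isProjection 0-isProjection AT Y ,
            first (isSubspace-∈ _) (plus-⊇ˡ U′-proj _)
              (step-least (isSubspace-∈ _) (Closed.isProjection AT-closed) 1-isProjection
                (λ {a} {x} a∈ _ → plus-least U′-proj Y
                  (preimage (applied a) (isSubspace-∈ (plus U′ (step AT Y)))) projY
                  (λ y y∈ → plus-⊇ˡ U′-proj (step AT Y) _ (U′-stable (AT⊆A a a∈) y∈))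
                  (λ y y∈ → plus-⊇ʳ U′-proj (step AT Y) _ (step-maps AT Y a∈ y∈)) x (h x)))))

      improvement : Improves W E v act W′ E v act
      improvement = improves
        (record
          { projW = projW′
          ; stableW = W′-stable
          ; small = small′
          ; projE = projE
          ; spanning = λ X projX stX W′⊆X → spanning X projX stX (λ x → W′⊆X x ∘ W⊆W′ x)
          ; bits = bits
          ; idle = idle
          ; lower = lower
          })
        (ℕₚ.+-monoʳ-< (dimension E) (ℕₚ.+-monoˡ-< (count n act) (ℕₚ.+-mono-<-≤
          (dimension-strict {P = W} {Q = W′} projW W⊆W′ y∈W′ y∉)
          (dimension-mono {P = D} {Q = generated W′ v} projD
            (D-least (isSubspace-∈ _) (extend-stable projW′ W′-stable v)
              (λ x x∈ → extend-⊇ projW′ A v x (W⊆W′ x x∈))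
              (λ j → resp (isSubspace-∈ _) (ap-1 (col v j))
                  (extend-column projW′ A v j algebra-1)))))))
        where
        y∈W′ : y ∈ W′
        y∈W′ = step-least (isSubspace-∈ W′) projT 1-isProjection
          (λ {t} {x} t∈ x∈ → extend-maps projW AT 1ᵒ (T⊆AT t t∈) x∈) y y∈

    -- Since t vᵢ ∈ B for t in T, adding x to vᵢ brings T x, and with it x ∈ A T x and the old vᵢ,
    -- into the submodule generated.
    module Enlarging (h : ¬ ((_∈ power AT 1ᵒ) ⊆ (_∈ D))) (active : ¬ act i ≈ 0#) where

      x : V
      x = find AT D

      v′ : Op 𝑛ˢ
      v′ (p , j) = v (p , j) + x p * o j

      D′ : Op 𝑛ˢ
      D′ = generated W v′

      private
        D-stable : Stable (_∈ D)
        D-stable = extend-stable projW stableW v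

        AT-D : Maps AT (_∈ D) (_∈ D)
        AT-D a∈ = D-stable (AT⊆A _ a∈)

        D′-stable : Stable (_∈ D′)
        D′-stable = extend-stable projW stableW v′

        W⊆D′ : (_∈ W) ⊆ (_∈ D′)
        W⊆D′ = extend-⊇ projW A v′

        v′∈D′ : ∀ j → col v′ j ∈ D′
        v′∈D′ j = resp (isSubspace-∈ D′) (ap-1 (col v′ j)) (extend-column projW A v′ j algebra-1)

        v′-other : ∀ {j} → j ≢ i → col v′ j ≋ col v j
        v′-other j≢i p = trans (+-congˡ (trans (*-congˡ (reflexive (o-other j≢i))) (zeroʳ _)))
            (+-identityʳ _)

        v′-self : col v′ i ≋ vᵢ +ᵛ x
        v′-self p = +-congˡ (trans (*-congˡ (reflexive o-self)) (*-identityʳ _))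

        v-other∈D′ : ∀ {j} → j ≢ i → col v j ∈ D′
        v-other∈D′ {j} j≢i = resp (isSubspace-∈ D′) (v′-other j≢i) (v′∈D′ j)

        B⊆D′ : (_∈ B) ⊆ (_∈ D′)
        B⊆D′ = B-least (isSubspace-∈ D′) W⊆D′ (λ {j} {r} j≢i r∈ → D′-stable (R⊆A r r∈) (v-other∈D′ j≢i))

        Tx⊆D′ : ∀ {t} → t ∈ T → ap t x ∈ D′
        Tx⊆D′ {t} t∈ = resp (isSubspace-∈ D′)
          (λ p → trans (+-congʳ (trans (ap-cong t v′-self p) (ap-+ t vᵢ x p)))
            (solve 2 (λ a b → a ⊹ b :- a := b) refl (ap t vᵢ p) (ap t x p)))
          (minus (isSubspace-∈ D′) (D′-stable (R⊆A t (T⊆R t t∈)) (v′∈D′ i)) (B⊆D′ _ (T-maps t∈)))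

        x∈D′ : x ∈ D′
        x∈D′ = step-least (isSubspace-∈ D′) (Closed.isProjection AT-closed) (line-isProjection x)
          (λ {a} {y} a∈ → line-least x (preimage (applied a) (isSubspace-∈ D′))
            (products-least (preimage (applying x) (isSubspace-∈ D′)) projA projT
              (λ {b} {t} b∈ t∈ → resp (isSubspace-∈ D′) (λ p → sym (ap-mul b t x p)) (D′-stable b∈ (Tx⊆D′ t∈)))
              a a∈) y)
          x (find-good AT-closed AT-D h)

        v∈D′ : ∀ j → col v j ∈ D′
        v∈D′ j with j Finₚ.≟ i
        ... | no j≢i = v-other∈D′ j≢i
        ... | yes ≡.refl = resp (isSubspace-∈ D′)
                (λ p → trans (+-congʳ (v′-self p)) (solve 2 (λ a b → a ⊹ b :- b := a) refl (vᵢ p)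
                    (x p)))
                (minus (isSubspace-∈ D′) (v′∈D′ i) x∈D′)

        idle′ : ∀ j → act j ≈ 0# → col v′ j ≋ 0ᵛ
        idle′ j z p = trans (v′-other (λ { ≡.refl → active z }) p) (idle j z p)

      improvement : Improves W E v act W E v′ act
      improvement = improves
        (record
          { projW = projW
          ; stableW = stableW
          ; small = small
          ; projE = projE
          ; spanning = λ X projX stX W⊆X v′∈X → spanning X projX stX W⊆X
              (λ j → extend-least projW A v′ (isSubspace-∈ X) W⊆X
                  (λ d j → stX (column∈ projA d) (v′∈X j)) _ (v∈D′ j))
          ; bits = bits
          ; idle = idle′
          ; lower = lower
          })
        (ℕₚ.+-monoʳ-< (dimension E) (ℕₚ.+-monoˡ-< (count n act) (ℕₚ.+-monoʳ-< (dimension W)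
          (dimension-strict {P = D} {Q = D′} projD (D-least (isSubspace-∈ D′) D′-stable W⊆D′ v∈D′)
            x∈D′ (find-∉ AT-closed AT-D h)))))

    -- Some d in g A satisfies g d = g.  So each r in R is the sum of d r, whose range lies in D, and
    -- of an element of R whose range lies in the kernel of g.
    module Shrinking (h : ¬ ((_∈ power AT 1ᵒ) ⊆ (_∈ W))) (sub : (_∈ power AT 1ᵒ) ⊆ (_∈ D)) where

      x : V
      x = find TA 0ᵒ

      f g : Vec 𝑀
      f = eigenElement TA x
      g = matrixPower f

      E′ : Op 𝑛ˢ
      E′ = kernelIn E g

      private
        TA-0 : Maps TA (_∈ 0ᵒ) (_∈ 0ᵒ)
        TA-0 {a} _ x∈ = resp (isSubspace-∈ 0ᵒ)
          (λ p → sym (trans (ap-cong a (∈0⇒≋0 x∈) p) (ap-0 a p))) (null (isSubspace-∈ 0ᵒ))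

        -- By induction (A T)ᵏ V ⊆ A (T A)ᵏ V, using V = A V. If (T A)ᴺ V vanished, (A T)ᴺ V would
        -- lie in W.
        nonzero : ¬ ((_∈ power TA 1ᵒ) ⊆ (_∈ 0ᵒ))
        nonzero z = h λ y y∈ → extend-least 0-isProjection A (power TA 1ᵒ) (isSubspace-∈ W)
            (0⊆ (isSubspace-∈ W))
          (λ d j → resp (isSubspace-∈ W) (λ p → sym (trans
            (ap-cong (col A d) (∈0⇒≋0 (z _ (column∈ (power-isProjection TA 1ᵒ) j))) p)
                (ap-0 (col A d) p))) (null (isSubspace-∈ W)))
          y (proj₂ (proj₂ related) y y∈)
          where
          Rel : Op 𝑛ˢ → Op 𝑛ˢ → Set (c ⊔ ℓ₁)
          Rel Y Y′ = IsProjection Y × IsProjection Y′ × ((_∈ Y) ⊆ (_∈ step A Y′))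

          next : ∀ {Y Y′} → IsProjection Y → (∀ {y} → y ∈ Y → y ∈ step A Y′) → IsProjection Y′ →
              Rel (step AT Y) (step TA Y′)
          next {Y} {Y′} projY k projY′ = extend-isProjection 0-isProjection AT Y ,
            extend-isProjection 0-isProjection TA Y′ ,
            step-least isG (Closed.isProjection AT-closed) projY λ {b} {y} b∈ y∈ →
              products-least (preimage (applying y) isG) projA projT
                (λ {a} {t} a∈ t∈ → resp isG (λ p → sym (ap-mul a t y p))
                  (step-maps A (step TA Y′) a∈
                    (step-least (preimage (applied t) (isSubspace-∈ (step TA Y′))) projA projY′
                      (λ {a′} {w} a′∈ w∈ → resp (isSubspace-∈ (step TA Y′)) (ap-mul t a′ w)
                        (step-maps TA Y′ (products-∋ t∈ a′∈) w∈)) y (k y∈)))) b b∈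
            where isG = isSubspace-∈ (step A (step TA Y′))

          related : Rel (power AT 1ᵒ) (power TA 1ᵒ)
          related = power-related Rel
            (next 1-isProjection (λ {y} _ → resp (isSubspace-∈ (step A 1ᵒ)) (ap-1 y) (step-maps A 1ᵒ algebra-1 (ap-1 y))) 1-isProjection)
            (λ Y Y′ (p , p′ , k) → next p (k _) p′)

        good : x ∈ step TA (line x)
        good = find-good TA-closed TA-0 nonzero

        x≉0 : ¬ x ≋ 0ᵛ
        x≉0 e = find-∉ TA-closed TA-0 nonzero (resp (isSubspace-∈ 0ᵒ) (λ p → sym (e p))
            (null (isSubspace-∈ 0ᵒ)))

        spec = eigenElement-spec (Closed.isProjection TA-closed) good x≉0

        f∈TA : f ∈ TA
        f∈TA = proj₁ spec

        f∈R : f ∈ R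
        f∈R = TA⊆R f f∈TA

        eigen = matrixPower-eigen (proj₁ (proj₂ (proj₂ spec))) (proj₂ (proj₂ (proj₂ spec)))

        unscale : ∀ {ℓ} {X : Pred V ℓ} → IsSubspace X → ∀ {k} → ¬ k ≈ 0# → ∀ {y} → X (k ∙ᵛ y) → X y
        unscale isX {k} k≉0 {y} h = resp isX
          (λ p → trans (sym (*-assoc _ _ _)) (trans (*-congʳ (⁻¹-inverseˡ k≉0))
              (*-identityˡ (y p))))
          (scale isX (k ⁻¹) h)

        -- The eigenvector is what E loses: f x lies in E and is a nonzero multiple of x, while g x,
        -- also a nonzero multiple, shows that x is not in the kernel of g.
        x∈E : x ∈ E
        x∈E = unscale (isSubspace-∈ E) (proj₁ (proj₂ (proj₂ spec)))
          (resp (isSubspace-∈ E) (proj₂ (proj₂ (proj₂ spec))) (R-maps f∈R x))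

        x∉E′ : ¬ x ∈ E′
        x∉E′ x∈ = x≉0 (unscale isSubspace-≋0 (proj₁ (proj₂ eigen))
          (λ p → trans (sym (proj₂ (proj₂ eigen) p)) (kernelIn-kills projE g x∈ p)))

        g-maps : ∀ y → ap g y ∈ E
        g-maps = matrixPower-induction (λ h → ∀ y → ap h y ∈ E) (R-maps f∈R)
          (λ h _ y → resp (isSubspace-∈ E) (λ p → sym (ap-mul f h y p)) (R-maps f∈R (ap h y)))

        -- Each (A T)ᵏ V is a submodule, so f ∈ T A maps it into (A T)ᵏ⁺¹ V. Hence g V ⊆ (A T)ᴺ V,
        -- which lies in D by assumption.
        gV⊆D : ∀ y → ap g y ∈ D
        gV⊆D y = sub _ (matrixPower-power (λ Y → IsProjection Y × Stable (_∈ Y))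
          (1-isProjection , λ _ _ → ap-1 _)
          (λ Y _ → extend-isProjection 0-isProjection AT Y , step-AT-stable Y)
          (λ {Y} {y} (p , st) y∈ → products-least (preimage (applying y) (isSubspace-∈ (step AT Y))) projT projA
            (λ {t} {a} t∈ a∈ → resp (isSubspace-∈ (step AT Y)) (λ q → sym (ap-mul t a y q))
              (step-maps AT Y (T⊆AT t t∈) (st a∈ y∈))) f f∈TA) y)

        fit = fitting algebra-closed algebra-1 (R⊆A f f∈R)

        b d : Vec 𝑀
        b = proj₁ fit
        d = mul g b

        b∈A : b ∈ A
        b∈A = proj₁ (proj₂ fit)

        g∈A : g ∈ A
        g∈A = matrixPower-induction (_∈ A) (R⊆A f f∈R) (λ h h∈ → A-closed (R⊆A f f∈R) h∈)

        -- The range of r - d r lies in E since g V does, and it is killed by g since g d = g g b =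
        -- g.
        split : ∀ {r} → r ∈ R → (r -ᵛ mul d r) ∈ restricted E′
        split {r} r∈ = ranged-∋ projA E′
          (minus (isSubspace-∈ A) (R⊆A r r∈) (A-closed (A-closed g∈A b∈A) (R⊆A r r∈)))
          λ y → resp (isSubspace-∈ E′) (λ p → sym (range y p))
            (kernelIn-∋ projE g
              (minus (isSubspace-∈ E) (R-maps r∈ y) (resp (isSubspace-∈ E)
                  (λ p → sym (ap-mul g b (ap r y) p)) (g-maps (ap b (ap r y)))))
              (killed y))
          where
          range : ∀ y → ap (r -ᵛ mul d r) y ≋ ap r y -ᵛ ap d (ap r y)
          range y p = trans (ap-minus r (mul d r) y p) (+-congˡ (-‿cong (ap-mul d r y p)))

          killed : ∀ y → ap g (ap r y -ᵛ ap d (ap r y)) ≋ 0ᵛ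
          killed y p = trans (ap-- g (ap r y) (ap d (ap r y)) p)
            (trans (+-congˡ (-‿cong (trans (sym (ap-mul g d (ap r y) p))
                (ap-congˡ (proj₂ (proj₂ fit)) (ap r y) p))))
              (-‿inverseʳ _))

      improvement : Improves W E v act W E′ v act
      improvement = improves
        (record
          { projW = projW
          ; stableW = stableW
          ; small = small
          ; projE = kernelIn-isProjection projE g
          ; spanning = λ X projX stX W⊆X v∈X R′⊆X → spanning X projX stX W⊆X v∈X (λ {r} r∈ y →
              add⁻ (isSubspace-∈ X)
                (resp (isSubspace-∈ X)
                  (ap-minus r (mul d r) y)
                  (R′⊆X (split r∈) y))
                (resp (isSubspace-∈ X) (λ p → sym (trans (ap-mul d r y p) (ap-mul g b (ap r y) p)))
                  (D-least (isSubspace-∈ X) stX W⊆X v∈X _ (gV⊆D (ap b (ap r y))))))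
          ; bits = bits
          ; idle = idle
          ; lower = lower
          })
        (ℕₚ.+-monoˡ-< (weight W v act)
          (dimension-strict {P = E′} {Q = E} (kernelIn-isProjection projE g)
              (kernelIn-⊆ projE g) x∈E x∉E′))

-- The dimension count: when another generator is unavoidable

module Certificate {c ℓ₁ ℓ₂} (F : DiscreteField c ℓ₁ ℓ₂) (m n : ℕ)
                   (S : Vector (MatrixModule.Matrix F n) m) where
  open GeneratorSteps F m n S public

  actives : ∀ k → (Fin k → Carrier) → List (Fin k)
  actives zero    f = []
  actives (suc k) f = (if f zero ≈ᵇ 0# then id else (zero ∷_)) (map suc (actives k (f ∘ suc)))

  length-actives : ∀ k f → length (actives k f) ≡ count k f
  length-actives zero    f = ≡.refl
  length-actives (suc k) f with f zero ≈ᵇ 0#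
  ... | true  = ≡.trans (Listₚ.length-map suc (actives k (f ∘ suc))) (length-actives k (f ∘ suc))
  ... | false = ≡.cong suc (≡.trans (Listₚ.length-map suc (actives k (f ∘ suc)))
      (length-actives k (f ∘ suc)))

  actives-≉0 : ∀ k f → All (λ j → ¬ f j ≈ 0#) (actives k f)
  actives-≉0 zero    f = []
  actives-≉0 (suc k) f with f zero ≈? 0#
  ... | yes p rewrite ≈ᵇ-true p  = Allₚ.map⁺ (actives-≉0 k (f ∘ suc))
  ... | no ¬p rewrite ≈ᵇ-false ¬p = ¬p ∷ Allₚ.map⁺ (actives-≉0 k (f ∘ suc))

  actives-distinct : ∀ k f → AllPairs _≢_ (actives k f)
  actives-distinct zero    f = []
  actives-distinct (suc k) f with f zero ≈ᵇ 0#
  ... | true  = AllPairsₚ.map⁺ (AllPairs.map (λ i≢j → i≢j ∘ Finₚ.suc-injective)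
      (actives-distinct k (f ∘ suc)))
  ... | false = Allₚ.map⁺ (All.tabulate λ _ ()) ∷
    AllPairsₚ.map⁺ (AllPairs.map (λ i≢j → i≢j ∘ Finₚ.suc-injective) (actives-distinct k (f ∘ suc)))

  count-all : ∀ k f → (∀ j → ¬ f j ≈ 0#) → count k f ≡ k
  count-all zero    f h = ≡.refl
  count-all (suc k) f h rewrite ≈ᵇ-false (h zero) = ≡.cong suc (count-all k (f ∘ suc) (h ∘ suc))

  count-≤ : ∀ k f → count k f ℕ.≤ k
  count-≤ zero    f = z≤n
  count-≤ (suc k) f with f zero ≈ᵇ 0#
  ... | true  = ℕₚ.m≤n⇒m≤1+n (count-≤ k (f ∘ suc))
  ... | false = s≤s (count-≤ k (f ∘ suc))

  count-cong : ∀ k {f f′} → (∀ j → f′ j ≈ f j) → count k f′ ≡ count k f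
  count-cong zero    h = ≡.refl
  count-cong (suc k) {f} {f′} h with f zero ≈? 0#
  ... | yes p rewrite ≈ᵇ-true p | ≈ᵇ-true (trans (h zero) p) = count-cong k (h ∘ suc)
  ... | no ¬p rewrite ≈ᵇ-false ¬p | ≈ᵇ-false (λ q → ¬p (trans (sym (h zero)) q)) = ≡.cong suc
      (count-cong k (h ∘ suc))

  count-flip : ∀ k {f f′} j → f j ≈ 0# → ¬ f′ j ≈ 0# → (∀ i → i ≢ j → f′ i ≈ f i) →
               count k f′ ≡ suc (count k f)
  count-flip (suc k) zero p q h rewrite ≈ᵇ-true p | ≈ᵇ-false q =
    ≡.cong suc (count-cong k λ j → h (suc j) λ ())
  count-flip (suc k) {f} {f′} (suc j) p q h with f zero ≈? 0#
  ... | yes z rewrite ≈ᵇ-true z | ≈ᵇ-true (trans (h zero λ ()) z) =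
          count-flip k j p q (λ i i≢j → h (suc i) (i≢j ∘ Finₚ.suc-injective))
  ... | no ¬z rewrite ≈ᵇ-false ¬z | ≈ᵇ-false (λ w → ¬z (trans (sym (h zero λ ())) w)) =
          ≡.cong suc (count-flip k j p q (λ i i≢j → h (suc i) (i≢j ∘ Finₚ.suc-injective)))

  -- If no relation between the generators acts nontrivially modulo W, then R V / W has the largest
  -- dimension compatible with that number of generators, although it is not all reached.
  module _ {W E v : Op 𝑛ˢ} {act : V} (inv : Invariant W E v act)
           (stuck : ∀ i → ¬ act i ≈ 0# → (_∈ step (Relation.T inv i) 1ᵒ) ⊆ (_∈ W))
           {y : V} (y∉ : ¬ y ∈ generated W v) where
    open Stage inv

    private
      Null : Vec 𝑀 → Set ℓ₁
      Null a = ∀ j → col a j ∈ W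

      isSubspace-Null : IsSubspace Null
      isSubspace-Null = isSubspace-∀ λ j → preimage {f = λ a → col a j}
        (record
          { cong = λ e p → e (p , j)
          ; homo-0 = λ _ → refl
          ; homo-+ = λ _ _ _ → refl
          ; homo-∙ = λ _ _ _ → refl
          })
        (isSubspace-∈ W)

      null-maps : ∀ {a} → Null a → ∀ x → ap a x ∈ W
      null-maps {a} h x = ap-closed (isSubspace-∈ W) a h x

      Null-representation : Representation Null
      Null-representation = record
        { projection = ranged 1ᵒ W
        ; isProjection = ranged-isProjection 1-isProjection W
        ; sound = λ a a∈ j → resp (isSubspace-∈ W) (ap-unit a j)
            (ranged-maps 1-isProjection W a∈ (unitᵛ j))
        ; complete = λ a h → ranged-∋ 1-isProjection W (ap-1 a) (null-maps h)
        }

      module N = Spans isSubspace-Null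
      module M = Spans (isSubspace-∈ W)

      opaque
        R-basis : N.Basis (columns R)
        R-basis = N.basis (λ zs → Representation.member?
            (representation isSubspace-Null Null-representation zs)) (columns R)

      open N.Basis R-basis renaming (vectors to rs; independent to rs-independent; spans to rs-spans; subset to rs-subset)

      rs∈R : All (_∈ R) rs
      rs∈R = All.map (All.lookup (All-columns {X = _∈ R} R (column∈ projR))) rs-subset

      R⊆span : (_∈ R) ⊆ Span Null rs
      R⊆span = columns⊆ (N.isSpan rs) R (columns-∈ R rs-spans)

      products-of : List (Idx 𝑛ˢ) → List V
      products-of is = cartesianProductWith (λ i r → ap r (col v i)) is rs

      -- Gathers the part of a combination that comes from the r vᵢ into a single element of `R`
      -- applied to vᵢ.
      decompose : ∀ i L ts {x} → All (_∈ R) ts → Span (_∈ W)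
          (map (λ r → ap r (col v i)) ts ++ L) x →
                  ∃[ a ] Span Null ts a × a ∈ R × Span (_∈ W) L (x -ᵛ ap a (col v i))
      decompose i L [] {x} _ p = 0ᵛ , base (null isSubspace-Null) , null (isSubspace-∈ R) ,
        resp (M.isSpan L) (λ q → sym (trans (+-congˡ (-‿cong (ap-0ᵒ (col v i) q))) (x-0≈x (x q)))) p
      decompose i L (t ∷ ts) {x} (t∈ ∷ ts∈) (k ∷ p) =
        let (a , a∈ , aR , q) = decompose i L ts ts∈ p in
        a +ᵛ k ∙ᵛ t ,
        add (N.isSpan (t ∷ ts)) (N.Span-∷ a a∈) (scale (N.isSpan (t ∷ ts)) k N.head∈Span) ,
        add (isSubspace-∈ R) aR (scale (isSubspace-∈ R) k t∈) ,
        resp (M.isSpan L) (λ j → trans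
          (solve 3 (λ x b a → (x :- b) :- a := x :- (a ⊹ b)) refl (x j) (k * ap t (col v i) j)
              (ap a (col v i) j))
          (+-congˡ (-‿cong (sym (trans (Linear.homo-+ (applying (col v i)) a (k ∙ᵛ t) j)
            (+-congˡ (Linear.homo-∙ (applying (col v i)) k t j))))))) q

      -- A dependence would put (t - a) vᵢ into W plus the R vⱼ of other entries, where a is a
      -- combination of the basis elements after t. Then t - a is a relation, so it maps V into W by
      -- `stuck`, which contradicts the independence of the basis modulo `Null`.
      independent : ∀ is → All (λ i → ¬ act i ≈ 0#) is → AllPairs _≢_ is → Independent (_∈ W)
          (products-of is)
      independent [] _ _ = []
      independent (i ∷ is) (active ∷ actives) (i≢ ∷ distinct) = extended rs rs-independent rs∈R
        where
        open Relation inv i using (B; T; T-∋; B-∋; W⊆B)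

        L = products-of is

        L⊆B : Span (_∈ W) L ⊆ (_∈ B)
        L⊆B = M.Span-least (isSubspace-∈ B) W⊆B
          (Allₚ.cartesianProductWith⁺ (≡.setoid _) (≡.setoid _) (λ i r → ap r (col v i)) is rs
            (λ {j} j∈ r∈ → B-∋ (All.lookup i≢ j∈ ∘ ≡.sym) (All.lookup rs∈R r∈)))

        extended : ∀ ts → Independent Null ts → All (_∈ R) ts →
                   Independent (_∈ W) (map (λ r → ap r (col v i)) ts ++ L)
        extended [] _ _ = independent is actives distinct
        extended (t ∷ ts) (t∉ ∷ ts-ind) (t∈ ∷ ts∈) = head ∷ extended ts ts-ind ts∈
          where
          head : ¬ Span (_∈ W) (map (λ r → ap r (col v i)) ts ++ L) (ap t (col v i))
          head p = let (a , a∈ , aR , q) = decompose i L ts ts∈ p in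
            t∉ (add⁻ (N.isSpan ts) (N.base⊆Span ts _ (vanishes a aR q)) a∈)
            where
            vanishes : ∀ a → a ∈ R → Span (_∈ W) L (ap t (col v i) -ᵛ ap a (col v i)) → Null
                (t -ᵛ a)
            vanishes a aR q j = stuck i active _ (resp (isSubspace-∈ (step T 1ᵒ))
                (ap-unit (t -ᵛ a) j)
              (step-maps T 1ᵒ (T-∋ (minus (isSubspace-∈ R) t∈ aR)
                (resp (isSubspace-∈ B) (λ p → sym (ap-minus t a (col v i) p)) (L⊆B _ q)))
                    (ap-1 (unitᵛ j))))

      -- If R V were inside D, `spanning` would force D to contain `y`.
      missing : ∃[ x ] x ∈ step R 1ᵒ × ¬ x ∈ D
      missing with below? {U = step R 1ᵒ} D (extend-isProjection 0-isProjection R 1ᵒ)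
      ... | inj₂ h = h
      ... | inj₁ h = contradiction
        (spanning D projD (extend-stable projW stableW v) W⊆D v∈D
            (λ r∈ x → h _ (step-maps R 1ᵒ r∈ (ap-1 x))) y) y∉

    certificate : ∀ k (w : Fin k → V) → Generates w → count n act ℕ.< k
    certificate k w gens = ℕₚ.≰⇒> λ k≤ → ℕₚ.<⇒≱ bound (ℕₚ.≤-trans
        (ℕₚ.≤-reflexive (ℕₚ.*-comm (length rs) k)) (ℕₚ.*-monoˡ-≤ (length rs) k≤))
      where
      ws : List V
      ws = tabulate w

      xs : List V
      xs = cartesianProductWith ap rs ws

      -- The x with R x inside the span form a submodule, because R A ⊆ R. So only the generators w
      -- have to be tested.
      reached : ∀ {r} → r ∈ R → ∀ x → Span (_∈ W) xs (ap r x)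
      reached {r} r∈ x = gens (λ x → ∀ r → r ∈ R → Span (_∈ W) xs (ap r x))
        (isSubspace-∀ λ r → isSubspace-∀ λ _ → preimage (applied r) (M.isSpan xs))
        (λ {a} {x} a∈ h r r∈ → resp (M.isSpan xs) (ap-mul r a x) (h (mul r a) (R-right r∈ a∈)))
        (λ j r r∈ → N.Span-least (preimage (applying (w j)) (M.isSpan xs))
          (λ a h → M.base⊆Span xs _ (null-maps h (w j)))
          (All.tabulate λ {r} r∈ → M.∈-Span (∈ₚ.∈-cartesianProductWith⁺ ap r∈ (∈ₚ.∈-tabulate⁺ j)))
          r (R⊆span r r∈))
        x r r∈

      ys : List V
      ys = products-of (actives n act)

      span-ys⊆D : Span (_∈ W) ys ⊆ (_∈ D)
      span-ys⊆D = M.Span-least (isSubspace-∈ D) W⊆D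
        (Allₚ.cartesianProductWith⁺ (≡.setoid _) (≡.setoid _) (λ i r → ap r (col v i))
            (actives n act) rs
          (λ {j} _ r∈ → extend-stable projW stableW v (R⊆A _ (All.lookup rs∈R r∈)) (v∈D j)))

      bound : count n act ℕ.* length rs ℕ.< length rs ℕ.* k
      bound = ≡.subst₂ ℕ._<_
        (≡.trans (length-product (λ i r → ap r (col v i)) (actives n act) rs)
            (≡.cong (ℕ._* length rs) (length-actives n act)))
        (≡.trans (length-product ap rs ws) (≡.cong (length rs ℕ.*_) (Listₚ.length-tabulate w)))
        -- Modulo W, the missing vector and the products r vᵢ are independent and lie in the span of
        -- the r wⱼ. With q the size of the basis of R modulo `Null`, this reads 1 + count · q ≤ q ·
        -- k.
        (M.steinitz xs {proj₁ missing ∷ ys}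
          ((λ p → proj₂ (proj₂ missing) (span-ys⊆D _ p)) ∷
            independent (actives n act) (actives-≉0 n act) (actives-distinct n act))
          (step-least (M.isSpan xs) projR 1-isProjection (λ r∈ _ → reached r∈ _) _
              (proj₁ (proj₂ missing)) ∷
           Allₚ.cartesianProductWith⁺ (≡.setoid _) (≡.setoid _) (λ i r → ap r (col v i))
               (actives n act) rs
             (λ _ r∈ → reached (All.lookup rs∈R r∈) _)))

    private
      fresh : V
      fresh = chooseLast 𝑛ˢ (λ j → 1# - act j) (λ j → unitᵛ j) 0ᵛ

      activated : V
      activated j = act j + fresh j

      -- The certificate, applied to the n unit vectors, shows that fewer than n columns are active.
      room : ∃[ j ] act j ≈ 0# × fresh ≡ unitᵛ j
      room with chooseLast-spec 𝑛ˢ (λ j → 1# - act j) (λ j → unitᵛ {𝑛ˢ} j) 0ᵛ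
      ... | inj₂ (j , h , e) = j , [ id , (λ q → contradiction
          (trans (+-congˡ (-‿cong q)) (-‿inverseʳ _)) h) ]′ (bits j) , e
      ... | inj₁ (h , _) = contradiction
        (certificate n unitᵛ (λ X isX _ units x → resp isX (ap-1 x) (ap-closed isX 1ᵒ units x)))
        (ℕₚ.≤⇒≯ (ℕₚ.≤-reflexive (≡.sym (count-all n act
            (λ j z → 1≉0 (trans (x-y≈0⇒x≈y (h j)) z))))))

      j₀ : Idx 𝑛ˢ
      j₀ = proj₁ room

      activated-self : activated j₀ ≈ 1#
      activated-self = trans (+-cong (proj₁ (proj₂ room))
        (trans (reflexive (≡.cong (λ f → f j₀) (proj₂ (proj₂ room))))
            (reflexive (Relation.o-self inv j₀)))) (+-identityˡ 1#)

      activated-other : ∀ j → j ≢ j₀ → activated j ≈ act j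
      activated-other j j≢ = trans (+-congˡ
        (trans (reflexive (≡.cong (λ f → f j) (proj₂ (proj₂ room))))
            (reflexive (Relation.o-other inv j₀ j≢)))) (+-identityʳ _)

    -- The new entry is still the zero vector; later enlargements may change it. The gain is in the
    -- number of entries, justified as a lower bound by the certificate.
    activation : Improves W E v act W E v (λ j → act j + chooseLast 𝑛ˢ (λ j → 1# - act j)
        (λ j → unitᵛ j) 0ᵛ j)
    activation = improves
      (record
        { projW = projW
        ; stableW = stableW
        ; small = small
        ; projE = projE
        ; spanning = spanning
        ; bits = bits′
        ; idle = idle′
        ; lower = λ k w gens → ≡.subst (ℕ._≤ k) (≡.sym counted) (certificate k w gens)
        })
      (ℕₚ.+-monoʳ-< (dimension E) (ℕₚ.+-monoʳ-< (dimension W ℕ.+ dimension D)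
        (≡.subst (count n act ℕ.<_) (≡.sym counted) (ℕₚ.n<1+n _))))
      where
      counted : count n activated ≡ suc (count n act)
      counted = count-flip n j₀ (proj₁ (proj₂ room))
          (λ z → 1≉0 (trans (sym activated-self) z)) activated-other

      bits′ : ∀ j → activated j ≈ 0# ⊎ activated j ≈ 1#
      bits′ j with j Finₚ.≟ j₀
      ... | yes ≡.refl = inj₂ activated-self
      ... | no j≢ = [ (λ z → inj₁ (trans (activated-other j j≢) z)) ,
          (λ z → inj₂ (trans (activated-other j j≢) z)) ]′ (bits j)

      idle′ : ∀ j → activated j ≈ 0# → col v j ≋ 0ᵛ
      idle′ j z with j Finₚ.≟ j₀
      ... | yes ≡.refl = contradiction (trans (sym activated-self) z) 1≉0
      ... | no j≢ = idle j (trans (sym (activated-other j j≢)) z)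

-- The algorithm in the language of arrays

𝑀ˢ : Shape
𝑀ˢ = 𝑛ˢ ⊗ 𝑛ˢ

module Procedures where

  private
    pattern #0 = here
    pattern #1 = there here
    pattern #2 = there (there here)
    pattern #3 = there (there (there here))
    pattern #4 = there (there (there (there here)))
    pattern #5 = there #4
    pattern #6 = there #5
    pattern #7 = there #6
    pattern #8 = there #7
    pattern #9 = there #8
    pattern #10 = there #9

  private variable
    Γ Δ : List Shape
    t u : Shape

  copyₑ : Γ ∋ t → Exp Γ Δ t
  copyₑ x = tab (read x (var #0))

  zerosₑ : Exp Γ Δ t
  zerosₑ = tab zeroₑ

  eqₑ : ∀ t → Index Δ t → Index Δ t → Exp Γ Δ unit
  eqₑ unit    i j = oneₑ
  eqₑ (dim d) i j = δ i j
  eqₑ (t ⊗ u) i j = eqₑ t (fst i) (fst j) *ₑ eqₑ u (snd i) (snd j)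

  identityₑ : Exp Γ Δ (t ⊗ t)
  identityₑ {t = t} = tab (eqₑ t (fst (var #0)) (snd (var #0)))

  columnₑ : Γ ∋ (t ⊗ u) → Δ ∋ u → Exp Γ Δ t
  columnₑ x j = tab (read x (var #0 , var (there j)))

  unitₑ : Δ ∋ t → Exp Γ Δ t
  unitₑ {t = t} j = tab (eqₑ t (var #0) (var (there j)))

  insertₑ : ∀ t → Exp (t ⊗ t ∷ t ∷ []) [] (t ⊗ t)
  insertₑ t = iter t (copyₑ #0) (tab
    (read #0 (var #0) +ₑ
     residue (fst (var #0)) (fst (var #1)) *ₑ (eqₑ t (var #1) (snd (var #0)) -ₑ read #0
         (var #1 , snd (var #0)))
       /ₑ residue (var #1) (var #2)))
    where
    residue : Index (t ⊗ t ∷ t ∷ []) t → Index (t ∷ t ⊗ t ∷ t ∷ []) t →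
              Exp (t ⊗ t ∷ t ⊗ t ∷ t ∷ []) (t ⊗ t ∷ t ∷ []) unit
    residue p p′ = read #2 p -ₑ sum t (read #0 (p′ , var #0) *ₑ read #2 (var #0))

  cutₑ : ∀ t → Exp (t ⊗ t ∷ t ∷ []) [] (t ⊗ t)
  cutₑ t = iter t (copyₑ #0) (tab
    (read #0 (var #0) -ₑ
     read #0 (fst (var #0) , var #1) *ₑ
       sum t (read #2 (var #0) *ₑ read #0 (var #0 , snd (var #1))) /ₑ
       sum t (read #2 (var #0) *ₑ read #0 (var #0 , var #2))))

  opaque
    extendₑ : Exp (𝑀ˢ ∷ 𝑀ˢ ⊗ 𝑀ˢ ∷ 𝑀ˢ ∷ []) [] 𝑀ˢ
    extendₑ = iter (𝑛ˢ ⊗ 𝑀ˢ) (copyₑ #0) (bind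
      (tab (sum 𝑛ˢ (read #2 ((var #1 , var #0) , snd (var #2)) *ₑ read #3 (var #0 , fst (var #2)))))
      (call (insertₑ 𝑛ˢ) (#1 ∷ #0 ∷ []) []))

  opaque
    productsₑ : Exp (𝑀ˢ ⊗ 𝑀ˢ ∷ 𝑀ˢ ⊗ 𝑀ˢ ∷ []) [] (𝑀ˢ ⊗ 𝑀ˢ)
    productsₑ = iter (𝑀ˢ ⊗ 𝑀ˢ) zerosₑ (bind
      (tab (sum 𝑛ˢ (read #1 ((fst (var #1) , var #0) , fst (var #2)) *ₑ
                    read #2 ((var #0 , snd (var #1)) , snd (var #2)))))
      (call (insertₑ 𝑀ˢ) (#1 ∷ #0 ∷ []) []))

  opaque
    transporterₑ : Exp (𝑀ˢ ⊗ 𝑀ˢ ∷ 𝑀ˢ ∷ 𝑛ˢ ∷ []) [] (𝑀ˢ ⊗ 𝑀ˢ)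
    transporterₑ = iter 𝑛ˢ (copyₑ #0) (bind
      (tab ((δ (var #1) (fst (var #0)) -ₑ read #2 (var #1 , fst (var #0))) *ₑ read #3
          (snd (var #0))))
      (call (cutₑ 𝑀ˢ) (#1 ∷ #0 ∷ []) []))

  opaque
    rangedₑ : Exp (𝑀ˢ ⊗ 𝑀ˢ ∷ 𝑀ˢ ∷ []) [] (𝑀ˢ ⊗ 𝑀ˢ)
    rangedₑ = iter 𝑛ˢ (copyₑ #0) (bind (unitₑ #0) (call transporterₑ (#1 ∷ #3 ∷ #0 ∷ []) []))

  opaque
    notBelowₑ : Exp (𝑀ˢ ∷ 𝑀ˢ ∷ []) [] unit
    notBelowₑ = choose 𝑀ˢ
      (read #0 (var #0) -ₑ sum 𝑛ˢ (read #1 (fst (var #1) , var #0) *ₑ read #0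
          (var #0 , snd (var #1))))
      oneₑ zeroₑ

  opaque
    lineₑ : ∀ t → Exp (t ∷ []) [] (t ⊗ t)
    lineₑ t = bind zerosₑ (call (insertₑ t) (#0 ∷ #1 ∷ []) [])

  opaque
    stepₑ : Exp (𝑀ˢ ⊗ 𝑀ˢ ∷ 𝑀ˢ ∷ []) [] 𝑀ˢ
    stepₑ = bind zerosₑ (call extendₑ (#0 ∷ #1 ∷ #2 ∷ []) [])

  opaque
    powerₑ : Exp (𝑀ˢ ⊗ 𝑀ˢ ∷ 𝑀ˢ ∷ []) [] 𝑀ˢ
    powerₑ = iter 𝑀ˢ (call stepₑ (#0 ∷ #1 ∷ []) []) (call stepₑ (#1 ∷ #0 ∷ []) [])

  opaque
    chooseVectorₑ : Exp (𝑀ˢ ⊗ 𝑀ˢ ∷ 𝑀ˢ ∷ 𝑀ˢ ∷ []) [] 𝑛ˢ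
    chooseVectorₑ = choose 𝑛ˢ
      (bind (columnₑ #2 #0) (bind (call (lineₑ 𝑛ˢ) (#0 ∷ []) [])
        (bind (call powerₑ (#2 ∷ #0 ∷ []) []) (call notBelowₑ (#0 ∷ #4 ∷ []) []))))
      (columnₑ #2 #0) zerosₑ

  opaque
    findₑ : Exp (𝑀ˢ ⊗ 𝑀ˢ ∷ 𝑀ˢ ∷ []) [] 𝑛ˢ
    findₑ = iter 𝑛ˢ
      (bind identityₑ (bind (call powerₑ (#1 ∷ #0 ∷ []) [])
          (call chooseVectorₑ (#2 ∷ #3 ∷ #0 ∷ []) [])))
      (bind (call (lineₑ 𝑛ˢ) (#0 ∷ []) []) (bind (call stepₑ (#2 ∷ #0 ∷ []) [])
        (choose unit (call notBelowₑ (#1 ∷ #0 ∷ []) [])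
          (bind (call powerₑ (#3 ∷ #1 ∷ []) []) (call chooseVectorₑ (#4 ∷ #5 ∷ #0 ∷ []) []))
          (copyₑ #2))))

  opaque
    eigenElementₑ : Exp (𝑀ˢ ⊗ 𝑀ˢ ∷ 𝑛ˢ ∷ []) [] 𝑀ˢ
    eigenElementₑ = bind (call (lineₑ 𝑛ˢ) (#1 ∷ []) [])
        (bind (call transporterₑ (#1 ∷ #0 ∷ #2 ∷ []) [])
      (choose (𝑀ˢ ⊗ 𝑛ˢ)
        (sum 𝑛ˢ (read #0 ((snd (var #1) , var #0) , fst (var #1)) *ₑ read #3 (var #0)))
        (tab (read #0 (var #0 , fst (var #1)))) zerosₑ))

  opaque
    matrixPowerₑ : Exp (𝑀ˢ ∷ []) [] 𝑀ˢ
    matrixPowerₑ = iter 𝑀ˢ (copyₑ #0)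
      (tab (sum 𝑛ˢ (read #1 (fst (var #1) , var #0) *ₑ read #0 (var #0 , snd (var #1)))))

  opaque
    kernelInₑ : Exp (𝑀ˢ ∷ 𝑀ˢ ∷ []) [] 𝑀ˢ
    kernelInₑ = iter 𝑛ˢ (copyₑ #0) (bind (tab (read #2 (var #1 , var #0)))
        (call (cutₑ 𝑛ˢ) (#1 ∷ #0 ∷ []) []))

  opaque
    algebraₑ : Exp [] [] (𝑀ˢ ⊗ 𝑀ˢ)
    algebraₑ = iter 𝑀ˢ (bind identityₑ (call (lineₑ 𝑀ˢ) (#0 ∷ []) []))
      (iter (𝑚ˢ ⊗ 𝑀ˢ) (copyₑ #0) (bind
        (tab (sum 𝑛ˢ (input (fst (var #2)) (fst (var #1)) (var #0) *ₑ
                      read #1 ((var #0 , snd (var #1)) , snd (var #2)))))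
        (call (insertₑ 𝑀ˢ) (#1 ∷ #0 ∷ []) [])))

  opaque
    relationsₑ : Exp (𝑀ˢ ⊗ 𝑀ˢ ∷ 𝑀ˢ ∷ 𝑀ˢ ∷ 𝑀ˢ ∷ 𝑛ˢ ∷ []) [] (𝑀ˢ ⊗ 𝑀ˢ)
    relationsₑ = bind (call rangedₑ (#0 ∷ #2 ∷ []) [])
      (bind (tab (read #4 (var #0) *ₑ (oneₑ -ₑ read (#5) (snd (var #0)))))
        (bind (call extendₑ (#3 ∷ #1 ∷ #0 ∷ []) [])
          (bind (tab (sum 𝑛ˢ (read (#6) (var #1 , var #0) *ₑ read (#7) (var #0))))
            (call transporterₑ (#3 ∷ #1 ∷ #0 ∷ []) []))))

  opaque
    pickₑ : Exp (𝑀ˢ ⊗ 𝑀ˢ ∷ 𝑀ˢ ∷ 𝑀ˢ ∷ 𝑀ˢ ∷ 𝑛ˢ ∷ []) [] 𝑛ˢ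
    pickₑ = choose 𝑛ˢ
      (read #4 (var #0) *ₑ
        bind (unitₑ #0) (bind (call relationsₑ (#1 ∷ #2 ∷ #3 ∷ #4 ∷ #0 ∷ []) [])
          (bind identityₑ (bind (call stepₑ (#1 ∷ #0 ∷ []) [])
              (call notBelowₑ (#0 ∷ #5 ∷ []) [])))))
      (unitₑ #0) zerosₑ

  opaque
    unfinishedₑ : Exp (𝑀ˢ ⊗ 𝑀ˢ ∷ 𝑀ˢ ∷ 𝑀ˢ ∷ []) [] unit
    unfinishedₑ = bind (call extendₑ (#1 ∷ #0 ∷ #2 ∷ []) [])
        (bind identityₑ (call notBelowₑ (#0 ∷ #1 ∷ []) []))

  -- The algebra, W, E, v and the vector o that picks out a generator.
  Parameters : List Shape
  Parameters = 𝑀ˢ ⊗ 𝑀ˢ ∷ 𝑀ˢ ∷ 𝑀ˢ ∷ 𝑀ˢ ∷ 𝑛ˢ ∷ []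

  parameters : All (Parameters ∋_) Parameters
  parameters = #0 ∷ #1 ∷ #2 ∷ #3 ∷ #4 ∷ []

  opaque
    leftₑ : Exp Parameters [] (𝑀ˢ ⊗ 𝑀ˢ)
    leftₑ = bind (call relationsₑ parameters []) (call productsₑ (#1 ∷ #0 ∷ []) [])

  opaque
    rightₑ : Exp Parameters [] (𝑀ˢ ⊗ 𝑀ˢ)
    rightₑ = bind (call relationsₑ parameters []) (call productsₑ (#0 ∷ #1 ∷ []) [])

  opaque
    saturationₑ : Exp Parameters [] 𝑀ˢ
    saturationₑ = bind (call leftₑ parameters []) (bind identityₑ (call powerₑ (#1 ∷ #0 ∷ []) []))

  opaque
    outsideWₑ : Exp Parameters [] unit
    outsideWₑ = bind (call saturationₑ parameters []) (call notBelowₑ (#0 ∷ #2 ∷ []) [])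

  opaque
    outsideDₑ : Exp Parameters [] unit
    outsideDₑ = bind (call saturationₑ parameters []) (bind (call extendₑ (#2 ∷ #1 ∷ #4 ∷ []) [])
      (call notBelowₑ (#1 ∷ #0 ∷ []) []))

  opaque
    superfluousₑ : Exp Parameters [] 𝑀ˢ
    superfluousₑ = bind (call leftₑ parameters [])
        (bind identityₑ (call extendₑ (#3 ∷ #1 ∷ #0 ∷ []) []))

  opaque
    enlargingₑ : Exp Parameters [] 𝑛ˢ
    enlargingₑ = bind (call leftₑ parameters [])
        (bind (call extendₑ (#2 ∷ #1 ∷ #4 ∷ []) []) (call findₑ (#1 ∷ #0 ∷ []) []))

  opaque
    shrinkingₑ : Exp Parameters [] 𝑀ˢ
    shrinkingₑ = bind (call rightₑ parameters []) (bind zerosₑ (bind (call findₑ (#1 ∷ #0 ∷ []) [])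
      (bind (call eigenElementₑ (#2 ∷ #0 ∷ []) []) (bind (call matrixPowerₑ (#0 ∷ []) [])
        (call kernelInₑ (#7 ∷ #0 ∷ []) [])))))

  infix 5 ifZero_then_else_

  ifZero_then_else_ : Γ ∋ unit → Γ ∋ t → Γ ∋ t → Exp Γ Δ t
  -- Over the shape with a single index `choose` is a conditional, and its default is the branch for
  -- a zero flag.
  ifZero c then x else y = choose unit (read c (var #0)) (copyₑ y) (copyₑ x)

  -- The four tests, then the arrays among which they decide.
  opaque
    decideₑ : Exp (unit ∷ unit ∷ unit ∷ unit ∷ t ∷ t ∷ t ∷ t ∷ t ∷ []) [] t
    decideₑ = bind (ifZero #3 then #7 else #8)
      (bind (ifZero #3 then #7 else #0)
        (bind (ifZero #3 then #7 else #0)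
          (ifZero #3 then #7 else #0)))

  opaque
    -- A loop carries one array, so the four components share it. The vector `act` is repeated along
    -- the columns of its slice and read back from the diagonal.
    packₑ : Exp (𝑀ˢ ∷ 𝑀ˢ ∷ 𝑀ˢ ∷ 𝑛ˢ ∷ []) [] (dim 𝟜 ⊗ 𝑀ˢ)
    packₑ = tab (choose unit (δ (fst (var #1)) (lit zero)) (read #0 (snd (var #1)))
      (choose unit (δ (fst (var #1)) (lit (suc zero))) (read #1 (snd (var #1)))
        (choose unit (δ (fst (var #1)) (lit (suc (suc zero)))) (read #2 (snd (var #1)))
          (read #3 (fst (snd (var #0)))))))

  sliceₑ : Fin 4 → Γ ∋ (dim 𝟜 ⊗ 𝑀ˢ) → Exp Γ Δ 𝑀ˢ
  sliceₑ k x = tab (read x (lit k , var #0))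

  diagonalₑ : Γ ∋ (dim 𝟜 ⊗ 𝑀ˢ) → Exp Γ Δ 𝑛ˢ
  diagonalₑ x = tab (read x (lit (suc (suc (suc zero))) , (var #0 , var #0)))

  opaque
    activatedₑ : Exp (𝑛ˢ ∷ []) [] 𝑛ˢ
    activatedₑ = bind (choose 𝑛ˢ (oneₑ -ₑ read #0 (var #0)) (unitₑ #0) zerosₑ)
      (tab (read #1 (var #0) +ₑ read #0 (var #0)))

  opaque
    anyₑ : Exp (𝑛ˢ ∷ []) [] unit
    anyₑ = choose 𝑛ˢ (read #0 (var #0)) oneₑ zeroₑ

  opaque
    movedₑ : Exp (𝑀ˢ ∷ 𝑛ˢ ∷ 𝑛ˢ ∷ []) [] 𝑀ˢ
    movedₑ = tab (read #0 (var #0) +ₑ read #1 (fst (var #0)) *ₑ read #2 (snd (var #0)))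

  State : List Shape
  State = 𝑀ˢ ⊗ 𝑀ˢ ∷ 𝑀ˢ ∷ 𝑀ˢ ∷ 𝑀ˢ ∷ 𝑛ˢ ∷ 𝑛ˢ ∷ []

  opaque
    nextWₑ : Exp State [] 𝑀ˢ
    nextWₑ =
      bind (call unfinishedₑ (#0 ∷ #1 ∷ #3 ∷ []) [])
      (bind (call anyₑ (#5 ∷ []) [])
      (bind (call outsideWₑ (#2 ∷ #3 ∷ #4 ∷ #5 ∷ #6 ∷ []) [])
      (bind (call outsideDₑ (#3 ∷ #4 ∷ #5 ∷ #6 ∷ #7 ∷ []) [])
      (bind (call superfluousₑ (#4 ∷ #5 ∷ #6 ∷ #7 ∷ #8 ∷ []) [])
        (call decideₑ (#4 ∷ #3 ∷ #2 ∷ #1 ∷ #6 ∷ #6 ∷ #0 ∷ #6 ∷ #6 ∷ []) [])))))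

  opaque
    nextEₑ : Exp State [] 𝑀ˢ
    nextEₑ =
      bind (call unfinishedₑ (#0 ∷ #1 ∷ #3 ∷ []) [])
      (bind (call anyₑ (#5 ∷ []) [])
      (bind (call outsideWₑ (#2 ∷ #3 ∷ #4 ∷ #5 ∷ #6 ∷ []) [])
      (bind (call outsideDₑ (#3 ∷ #4 ∷ #5 ∷ #6 ∷ #7 ∷ []) [])
      (bind (call shrinkingₑ (#4 ∷ #5 ∷ #6 ∷ #7 ∷ #8 ∷ []) [])
        (call decideₑ (#4 ∷ #3 ∷ #2 ∷ #1 ∷ #7 ∷ #7 ∷ #7 ∷ #0 ∷ #7 ∷ []) [])))))

  opaque
    nextVₑ : Exp State [] 𝑀ˢ
    nextVₑ =
      bind (call unfinishedₑ (#0 ∷ #1 ∷ #3 ∷ []) [])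
      (bind (call anyₑ (#5 ∷ []) [])
      (bind (call outsideWₑ (#2 ∷ #3 ∷ #4 ∷ #5 ∷ #6 ∷ []) [])
      (bind (call outsideDₑ (#3 ∷ #4 ∷ #5 ∷ #6 ∷ #7 ∷ []) [])
      (bind (call enlargingₑ (#4 ∷ #5 ∷ #6 ∷ #7 ∷ #8 ∷ []) [])
      (bind (call movedₑ (#8 ∷ #0 ∷ #9 ∷ []) [])
        (call decideₑ (#5 ∷ #4 ∷ #3 ∷ #2 ∷ #9 ∷ #9 ∷ #9 ∷ #9 ∷ #0 ∷ []) []))))))

  opaque
    nextActₑ : Exp State [] 𝑛ˢ
    nextActₑ =
      bind (call unfinishedₑ (#0 ∷ #1 ∷ #3 ∷ []) [])
      (bind (call anyₑ (#5 ∷ []) [])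
      (bind (call outsideWₑ (#2 ∷ #3 ∷ #4 ∷ #5 ∷ #6 ∷ []) [])
      (bind (call outsideDₑ (#3 ∷ #4 ∷ #5 ∷ #6 ∷ #7 ∷ []) [])
      (bind (call activatedₑ (#9 ∷ []) [])
        (call decideₑ (#4 ∷ #3 ∷ #2 ∷ #1 ∷ #10 ∷ #0 ∷ #10 ∷ #10 ∷ #10 ∷ []) [])))))

  opaque
    nextₑ : Exp State [] (dim 𝟜 ⊗ 𝑀ˢ)
    nextₑ =
      bind (call nextWₑ (#0 ∷ #1 ∷ #2 ∷ #3 ∷ #4 ∷ #5 ∷ []) [])
      (bind (call nextEₑ (#1 ∷ #2 ∷ #3 ∷ #4 ∷ #5 ∷ #6 ∷ []) [])
      (bind (call nextVₑ (#2 ∷ #3 ∷ #4 ∷ #5 ∷ #6 ∷ #7 ∷ []) [])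
      (bind (call nextActₑ (#3 ∷ #4 ∷ #5 ∷ #6 ∷ #7 ∷ #8 ∷ []) [])
        (call packₑ (#3 ∷ #2 ∷ #1 ∷ #0 ∷ []) []))))

  opaque
    roundₑ : Exp (dim 𝟜 ⊗ 𝑀ˢ ∷ 𝑀ˢ ⊗ 𝑀ˢ ∷ []) [] (dim 𝟜 ⊗ 𝑀ˢ)
    roundₑ =
      bind (diagonalₑ (#0))
      (bind (sliceₑ (suc (suc zero)) (#1))
      (bind (sliceₑ (suc zero) (#2))
      (bind (sliceₑ zero (#3))
      (bind (call pickₑ (#5 ∷ #0 ∷ #1 ∷ #2 ∷ #3 ∷ []) [])
        (call nextₑ (#6 ∷ #1 ∷ #2 ∷ #3 ∷ #0 ∷ #4 ∷ []) [])))))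

  startₑ : Exp Γ Δ (dim 𝟜 ⊗ 𝑀ˢ)
  startₑ = bind zerosₑ (bind identityₑ (bind zerosₑ (bind zerosₑ
    (call packₑ (#3 ∷ #2 ∷ #1 ∷ #0 ∷ []) []))))

  opaque
    generatorsₑ : Exp [] [] 𝑛ˢ
    -- The shape `dim 𝟜 ⊗ 𝑛ˢ` provides the 4n rounds that the potential allows.
    generatorsₑ = bind algebraₑ (bind (iter (dim 𝟜 ⊗ 𝑛ˢ) startₑ (call roundₑ (#0 ∷ #1 ∷ []) []))
        (diagonalₑ (#0)))

-- Procedures denote the operators studied above

module ProcedureCorrectness {c ℓ₁ ℓ₂} (F : DiscreteField c ℓ₁ ℓ₂) (m n : ℕ)
                            (S : Vector (MatrixModule.Matrix F n) m) where
  open Certificate F m n S public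
  open Denotation F m n S public
  open Procedures public

  opaque
    unfolding extendₑ extend

    -- The procedure follows the operator fold by fold, so the two agree by computation. Identity,
    -- not mere pointwise equality, allows substitution inside larger procedures.
    extend-correct : ∀ P Λ X → ⟦ extendₑ ⟧ (P ∷ Λ ∷ X ∷ []) [] ≡ extend P Λ X
    extend-correct P Λ X = ≡.refl

  opaque
    unfolding productsₑ products

    products-correct : ∀ Λ Λ′ → ⟦ productsₑ ⟧ (Λ ∷ Λ′ ∷ []) [] ≡ products Λ Λ′
    products-correct Λ Λ′ = ≡.refl

  opaque
    unfolding notBelowₑ notBelow

    notBelow-correct : ∀ U X → ⟦ notBelowₑ ⟧ (U ∷ X ∷ []) [] tt ≡ notBelow U X
    notBelow-correct U X = ≡.refl

  opaque
    unfolding extendₑ stepₑ powerₑ extend power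

    power-correct : ∀ Λ X → ⟦ powerₑ ⟧ (Λ ∷ X ∷ []) [] ≡ power Λ X
    power-correct Λ X = ≡.refl

  opaque
    unfolding kernelInₑ kernelIn

    kernelIn-correct : ∀ E g → ⟦ kernelInₑ ⟧ (E ∷ g ∷ []) [] ≡ kernelIn E g
    kernelIn-correct E g = ≡.refl

  opaque
    unfolding matrixPowerₑ matrixPower

    matrixPower-correct : ∀ f → ⟦ matrixPowerₑ ⟧ (f ∷ []) [] ≡ matrixPower f
    matrixPower-correct f = ≡.refl

  opaque
    unfolding lineₑ algebraₑ algebra

    algebra-correct : ⟦ algebraₑ ⟧ [] [] ≡ algebra
    algebra-correct = ≡.refl

  opaque
    unfolding lineₑ transporterₑ eigenElementₑ transporter eigenElement

    eigenElement-correct : ∀ Λ x → ⟦ eigenElementₑ ⟧ (Λ ∷ x ∷ []) [] ≡ eigenElement Λ x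
    eigenElement-correct Λ x = ≡.refl

  opaque
    unfolding lineₑ extendₑ stepₑ powerₑ notBelowₑ chooseVectorₑ findₑ extend power notBelow chooseVector find

    find-correct : ∀ Λ D → ⟦ findₑ ⟧ (Λ ∷ D ∷ []) [] ≡ find Λ D
    find-correct Λ D = ≡.refl

  opaque
    unfolding rangedₑ transporterₑ extendₑ relationsₑ extend transporter ranged

    relations-correct : ∀ W E v o → ⟦ relationsₑ ⟧ (A ∷ W ∷ E ∷ v ∷ o ∷ []) [] ≡ relations W E v o
    relations-correct W E v o = ≡.refl

  -- A selected entry has to be passed on as an array, hence the unit vector. The zero vector
  -- signals that no active entry has T V outside W.
  pick : Op 𝑛ˢ → Op 𝑛ˢ → Op 𝑛ˢ → V → V
  pick W E v act = chooseLast 𝑛ˢ (λ i → act i * notBelow (step (relations W E v (unitᵛ i)) 1ᵒ) W)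
      (λ i → unitᵛ i) 0ᵛ

  opaque
    unfolding rangedₑ transporterₑ extendₑ relationsₑ stepₑ notBelowₑ pickₑ extend transporter ranged notBelow

    pick-correct : ∀ W E v act → ⟦ pickₑ ⟧ (A ∷ W ∷ E ∷ v ∷ act ∷ []) [] ≡ pick W E v act
    pick-correct W E v act = ≡.refl

  opaque
    unfolding unfinishedₑ

    unfinished-correct : ∀ W v → ⟦ unfinishedₑ ⟧ (A ∷ W ∷ v ∷ []) [] tt ≡ notBelow 1ᵒ
        (generated W v)
    unfinished-correct W v = ≡.trans (≡.cong (λ D → ⟦ notBelowₑ ⟧ (1ᵒ ∷ D ∷ []) [] tt)
        (extend-correct W A v))
      (notBelow-correct 1ᵒ (generated W v))

  module _ (W E v : Op 𝑛ˢ) (o : V) where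

    private
      args : Arrays Parameters
      args = A ∷ W ∷ E ∷ v ∷ o ∷ []

      T AT TA : Op 𝑀
      T = relations W E v o
      AT = products A T
      TA = products T A

    opaque
      unfolding leftₑ

      left-correct : ⟦ leftₑ ⟧ args [] ≡ AT
      left-correct = ≡.trans (≡.cong (λ t → ⟦ productsₑ ⟧ (A ∷ t ∷ []) [])
          (relations-correct W E v o)) (products-correct A T)

    opaque
      unfolding rightₑ

      right-correct : ⟦ rightₑ ⟧ args [] ≡ TA
      right-correct = ≡.trans (≡.cong (λ t → ⟦ productsₑ ⟧ (t ∷ A ∷ []) [])
          (relations-correct W E v o)) (products-correct T A)

    opaque
      unfolding saturationₑ

      saturation-correct : ⟦ saturationₑ ⟧ args [] ≡ power AT 1ᵒ
      saturation-correct = ≡.trans (≡.cong (λ Λ → ⟦ powerₑ ⟧ (Λ ∷ 1ᵒ ∷ []) []) left-correct)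
          (power-correct AT 1ᵒ)

    opaque
      unfolding outsideWₑ

      outsideW-correct : ⟦ outsideWₑ ⟧ args [] tt ≡ notBelow (power AT 1ᵒ) W
      outsideW-correct = ≡.trans (≡.cong (λ Y → ⟦ notBelowₑ ⟧
          (Y ∷ W ∷ []) [] tt) saturation-correct)
        (notBelow-correct (power AT 1ᵒ) W)

    opaque
      unfolding outsideDₑ

      outsideD-correct : ⟦ outsideDₑ ⟧ args [] tt ≡ notBelow (power AT 1ᵒ) (generated W v)
      outsideD-correct = ≡.trans (≡.cong₂ (λ Y X → ⟦ notBelowₑ ⟧
          (Y ∷ X ∷ []) [] tt) saturation-correct (extend-correct W A v))
        (notBelow-correct (power AT 1ᵒ) (generated W v))

    opaque
      unfolding superfluousₑ

      superfluous-correct : ⟦ superfluousₑ ⟧ args [] ≡ extend W AT 1ᵒ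
      superfluous-correct = ≡.trans (≡.cong (λ Λ → ⟦ extendₑ ⟧ (W ∷ Λ ∷ 1ᵒ ∷ []) []) left-correct)
          (extend-correct W AT 1ᵒ)

    opaque
      unfolding enlargingₑ

      enlarging-correct : ⟦ enlargingₑ ⟧ args [] ≡ find AT (generated W v)
      enlarging-correct = ≡.trans (≡.cong₂ (λ Λ X → ⟦ findₑ ⟧ (Λ ∷ X ∷ []) []) left-correct
          (extend-correct W A v))
        (find-correct AT (generated W v))

    opaque
      unfolding shrinkingₑ

      shrinking-correct : ⟦ shrinkingₑ ⟧ args [] ≡ kernelIn E
          (matrixPower (eigenElement TA (find TA 0ᵒ)))
      shrinking-correct = ≡.trans
        (≡.cong₂ (λ Λ x → ⟦ kernelInₑ ⟧ (E ∷ ⟦ matrixPowerₑ ⟧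
            (⟦ eigenElementₑ ⟧ (Λ ∷ x ∷ []) [] ∷ []) [] ∷ []) [])
          right-correct
          (≡.trans (≡.cong (λ Λ → ⟦ findₑ ⟧ (Λ ∷ 0ᵒ ∷ []) []) right-correct) (find-correct TA 0ᵒ)))
        (≡.trans (≡.cong (λ f → ⟦ kernelInₑ ⟧ (E ∷ ⟦ matrixPowerₑ ⟧ (f ∷ []) [] ∷ []) [])
            (eigenElement-correct TA (find TA 0ᵒ)))
        (≡.trans (≡.cong (λ g → ⟦ kernelInₑ ⟧ (E ∷ g ∷ []) []) (matrixPower-correct f))
            (kernelIn-correct E (matrixPower f))))
        where
        f : Vec 𝑀
        f = eigenElement TA (find TA 0ᵒ)

-- Rounds of the main loop and the bound on their number

module Arithmetic where
  open +-*-Solver renaming (_:+_ to infixl 6 _⊹_; _:*_ to infixl 7 _⊛_; con to :con)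

  exchange : ∀ k e e′ w w′ n → k ℕ.+ e ℕ.≤ w ℕ.+ n → e′ ℕ.+ w ℕ.< e ℕ.+ w′ →
      suc k ℕ.+ e′ ℕ.≤ w′ ℕ.+ n
  exchange k e e′ w w′ n p q = ℕₚ.+-cancelʳ-≤ (e ℕ.+ w) _ _ (begin
    suc k ℕ.+ e′ ℕ.+ (e ℕ.+ w)        ≡⟨ solve 4
        (λ k e′ e w → :con 1 ⊹ k ⊹ e′ ⊹ (e ⊹ w) := (k ⊹ e) ⊹ (:con 1 ⊹ (e′ ⊹ w))) ≡.refl k e′ e w ⟩
    (k ℕ.+ e) ℕ.+ suc (e′ ℕ.+ w)      ≤⟨ ℕₚ.+-mono-≤ p q ⟩
    (w ℕ.+ n) ℕ.+ (e ℕ.+ w′)          ≡⟨ solve 4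
        (λ w n e w′ → (w ⊹ n) ⊹ (e ⊹ w′) := (w′ ⊹ n) ⊹ (e ⊹ w)) ≡.refl w n e w′ ⟩
    w′ ℕ.+ n ℕ.+ (e ℕ.+ w)            ∎)
    where open ℕₚ.≤-Reasoning

  fourfold : ∀ n → n ℕ.+ n ℕ.+ n ℕ.+ n ≡ 4 ℕ.* n ℕ.+ 0
  fourfold = solve 1 (λ n → n ⊹ n ⊹ n ⊹ n := :con 4 ⊛ n ⊹ :con 0) ≡.refl

module Rounds {c ℓ₁ ℓ₂} (F : DiscreteField c ℓ₁ ℓ₂) (m n : ℕ)
              (S : Vector (MatrixModule.Matrix F n) m) where
  open ProcedureCorrectness F m n S public

  St : Shape
  St = dim 𝟜 ⊗ 𝑀

  slice : Fin 4 → Vec St → Op 𝑛ˢ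
  slice k st p = st (k , p)

  diagonal : Vec St → V
  diagonal st i = st (suc (suc (suc zero)) , (i , i))

  pack : Op 𝑛ˢ → Op 𝑛ˢ → Op 𝑛ˢ → V → Vec St
  pack W E v act = ⟦ packₑ ⟧ (W ∷ E ∷ v ∷ act ∷ []) []

  -- The tests, true when the flag vanishes: V = A v + W; no entry was picked; (A T)ᴺ V ⊆ W; (A T)ᴺ
  -- V ⊆ A v + W. The outcomes are, in order: leave the state, activate an entry, enlarge W, shrink
  -- E, change v.
  decide : ∀ {ℓ} {X : Set ℓ} → Bool → Bool → Bool → Bool → X → X → X → X → X → X
  decide b₁ b₂ b₃ b₄ x₀ x₁ x₂ x₃ x₄ =
    if b₁ then x₀ else if b₂ then x₁ else if b₃ then x₂ else if b₄ then x₃ else x₄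

  activated : V → V
  activated act j = act j + chooseLast 𝑛ˢ (λ j → 1# - act j) (λ j → unitᵛ j) 0ᵛ j

  moved : Op 𝑛ˢ → V → V → Op 𝑛ˢ
  moved v x o (p , j) = v (p , j) + x p * o j

  private
    1≈ᵇ0 : (1# ≈ᵇ 0#) ≡ false
    1≈ᵇ0 = ≈ᵇ-false 1≉0

    0≈ᵇ0 : (0# ≈ᵇ 0#) ≡ true
    0≈ᵇ0 = ≈ᵇ-true refl

  opaque
    unfolding packₑ

    pack-W : ∀ W E v act → slice zero (pack W E v act) ≡ W
    pack-W W E v act rewrite 1≈ᵇ0 = ≡.refl

    pack-E : ∀ W E v act → slice (suc zero) (pack W E v act) ≡ E
    pack-E W E v act rewrite 0≈ᵇ0 | 1≈ᵇ0 = ≡.refl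

    pack-v : ∀ W E v act → slice (suc (suc zero)) (pack W E v act) ≡ v
    pack-v W E v act rewrite 0≈ᵇ0 | 1≈ᵇ0 = ≡.refl

    pack-act : ∀ W E v act → diagonal (pack W E v act) ≡ act
    pack-act W E v act rewrite 0≈ᵇ0 = ≡.refl

  Finished : Op 𝑛ˢ → Op 𝑛ˢ → Set (c ⊔ ℓ₁)
  Finished W v = ∀ x → x ∈ generated W v

  -- Unless V is reached, `k` rounds have raised the potential from at least -n to at least k - n.
  Progress : ℕ → Op 𝑛ˢ → Op 𝑛ˢ → Op 𝑛ˢ → V → Set (lsuc (c ⊔ ℓ₁))
  Progress k W E v act = Invariant W E v act ×
    (Finished W v ⊎ k ℕ.+ dimension E ℕ.≤ weight W v act ℕ.+ n)

  private
    improved : ∀ {k W E v act W′ E′ v′ act′} → k ℕ.+ dimension E ℕ.≤ weight W v act ℕ.+ n →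
               Improves W E v act W′ E′ v′ act′ → Progress (suc k) W′ E′ v′ act′
    improved {k} {W} {E} {v} {act} {W′} {E′} {v′} {act′} le
        (improves invariant progress) = invariant , inj₂
      (Arithmetic.exchange k (dimension E) (dimension E′) (weight W v act)
          (weight W′ v′ act′) n le progress)

  pick-spec : ∀ {W E v act} (inv : Invariant W E v act) →
    (any 𝑛ˢ (pick W E v act) ≈ 0# × (∀ i → ¬ act i ≈ 0# → (_∈ step (Relation.T inv i) 1ᵒ) ⊆
        (_∈ W))) ⊎
    (¬ any 𝑛ˢ (pick W E v act) ≈ 0# ×
     ∃[ i ] pick W E v act ≡ unitᵛ i × ¬ act i ≈ 0# × ∃[ y ] y ∈ step (Relation.T inv i) 1ᵒ
         × ¬ y ∈ W)
  pick-spec {W} {E} {v} {act} inv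
    with chooseLast-spec 𝑛ˢ (λ i → act i * notBelow (step (relations W E v (unitᵛ i)) 1ᵒ) W)
        (λ i → unitᵛ {𝑛ˢ} i) 0ᵛ
  ... | inj₁ (h , e) = inj₁ (none , stuck)
    where
    none : any 𝑛ˢ (pick W E v act) ≈ 0#
    none with any-spec 𝑛ˢ (pick W E v act)
    ... | inj₁ (_ , z) = z
    ... | inj₂ ((i , i≉0) , _) = contradiction (reflexive (≡.cong (λ f → f i) e)) i≉0

    stuck : ∀ i → ¬ act i ≈ 0# → (_∈ step (Relation.T inv i) 1ᵒ) ⊆ (_∈ W)
    stuck i active with notBelow-spec {step (Relation.T inv i) 1ᵒ} W
        (extend-isProjection 0-isProjection (Relation.T inv i) 1ᵒ)
    ... | inj₁ (sub , _) = sub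
    ... | inj₂ (_ , ¬z) = contradiction (*-cancel-0 active (h i)) ¬z
  ... | inj₂ (i , h , e) = inj₂ (some , i , e , (λ z → h (trans (*-congʳ z) (zeroˡ _))) , witness)
    where
    some : ¬ any 𝑛ˢ (pick W E v act) ≈ 0#
    some with any-spec 𝑛ˢ (pick W E v act)
    ... | inj₂ (_ , ¬z) = ¬z
    ... | inj₁ (z , _) = contradiction
      (trans (sym (reflexive (Relation.o-self inv i)))
          (trans (sym (reflexive (≡.cong (λ f → f i) e))) (z i))) 1≉0

    witness : ∃[ y ] y ∈ step (Relation.T inv i) 1ᵒ × ¬ y ∈ W
    witness with notBelow-spec {step (Relation.T inv i) 1ᵒ} W
        (extend-isProjection 0-isProjection (Relation.T inv i) 1ᵒ)
    ... | inj₁ (_ , z) = contradiction (trans (*-congˡ z) (zeroʳ _)) h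
    ... | inj₂ (w , _) = w

  module Next (W E v : Op 𝑛ˢ) (act o : V) where

    T AT TA : Op 𝑀
    T  = relations W E v o
    AT = products A T
    TA = products T A

    W₁ E₁ v₁ : Op 𝑛ˢ
    W₁ = extend W AT 1ᵒ
    E₁ = kernelIn E (matrixPower (eigenElement TA (find TA 0ᵒ)))
    v₁ = moved v (find AT (generated W v)) o

    b₁ b₂ b₃ b₄ : Bool
    b₁ = notBelow 1ᵒ (generated W v) ≈ᵇ 0#
    b₂ = any 𝑛ˢ o ≈ᵇ 0#
    b₃ = notBelow (power AT 1ᵒ) W ≈ᵇ 0#
    b₄ = notBelow (power AT 1ᵒ) (generated W v) ≈ᵇ 0#

    W′ E′ v′ : Bool → Bool → Bool → Bool → Op 𝑛ˢ
    act′ : Bool → Bool → Bool → Bool → V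
    W′ a b c d = decide a b c d W W W₁ W W
    E′ a b c d = decide a b c d E E E E₁ E
    v′ a b c d = decide a b c d v v v v v₁
    act′ a b c d = decide a b c d act (activated act) act act act

    NextProgress : ℕ → Bool → Bool → Bool → Bool → Set (lsuc (c ⊔ ℓ₁))
    NextProgress k a b c d = Progress k (W′ a b c d) (E′ a b c d) (v′ a b c d) (act′ a b c d)

  advance : ∀ k W E v act → Progress k W E v act →
            let open Next W E v act (pick W E v act) in NextProgress (suc k) b₁ b₂ b₃ b₄
  advance k W E v act (inv , g) = test₁ (notBelow-spec {1ᵒ} (generated W v) 1-isProjection)
    where
    open Next W E v act hiding (T; AT; TA)

    -- Formulated for the unit vector of `i` in place of the picked array, since the improvements
    -- refer to a column index. The identity of the two is substituted afterwards.
    chosen : ∀ i a → ¬ act i ≈ 0# → ∃[ y ] y ∈ step (Relation.T inv i) 1ᵒ × ¬ y ∈ W →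
             k ℕ.+ dimension E ℕ.≤ weight W v act ℕ.+ n → a ≡ false →
             NextProgress (unitᵛ i) (suc k) a false (b₃ (unitᵛ i)) (b₄ (unitᵛ i))
    chosen i _ active (y , y∈ , y∉) le ≡.refl =
      [ (λ (sub , z) → ≡.subst (λ b → NextProgress (unitᵛ i) (suc k) false false b (b₄ (unitᵛ i)))
          (≡.sym (≈ᵇ-true z))
          (improved le (Superfluous.improvement inv i sub y∈ y∉)))
      , (λ ((y′ , y′∈ , y′∉) , ¬z) → ≡.subst (λ b → NextProgress (unitᵛ i) (suc k) false false b
          (b₄ (unitᵛ i))) (≡.sym (≈ᵇ-false ¬z))
          ([ (λ (sub , z) → ≡.subst (NextProgress (unitᵛ i) (suc k) false false false)
              (≡.sym (≈ᵇ-true z))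
               (improved le (Shrinking.improvement inv i (λ h → y′∉ (h y′ y′∈)) sub)))
           , (λ ((y″ , y″∈ , y″∉) , ¬z) → ≡.subst (NextProgress (unitᵛ i)
               (suc k) false false false) (≡.sym (≈ᵇ-false ¬z))
               (improved le (Enlarging.improvement inv i (λ h → y″∉ (h y″ y″∈)) active)))
           ]′ (notBelow-spec {power AT 1ᵒ} (generated W v) (power-isProjection AT 1ᵒ)))) ]′
      (notBelow-spec {power AT 1ᵒ} W (power-isProjection AT 1ᵒ))
      where open Relation inv i using (AT)

    test₁ : _ → _
    test₁ (inj₁ (sub , z)) = ≡.subst (λ a → NextProgress o₀ (suc k) a (b₂ o₀) (b₃ o₀) (b₄ o₀))
        (≡.sym (≈ᵇ-true z))
      (inv , inj₁ (λ x → sub x (ap-1 x)))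
      where o₀ = pick W E v act
    test₁ (inj₂ ((y , _ , y∉) , ¬z)) = test₂ (pick-spec inv)
      where
      o₀ = pick W E v act

      le : k ℕ.+ dimension E ℕ.≤ weight W v act ℕ.+ n
      le = [ (λ fin → contradiction (fin y) y∉) , id ]′ g

      test₂ : _ → NextProgress o₀ (suc k) (b₁ o₀) (b₂ o₀) (b₃ o₀) (b₄ o₀)
      test₂ (inj₁ (z , stuck)) = ≡.subst₂ (λ a b → NextProgress o₀ (suc k) a b (b₃ o₀) (b₄ o₀))
        (≡.sym (≈ᵇ-false ¬z)) (≡.sym (≈ᵇ-true z)) (improved le (activation inv stuck y∉))
      test₂ (inj₂ (some , i , e , active , w)) = ≡.subst
          (λ b → NextProgress o₀ (suc k) (b₁ o₀) b (b₃ o₀) (b₄ o₀))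
        (≡.sym (≈ᵇ-false some))
        (≡.subst (λ o → NextProgress o (suc k) (b₁ o) false (b₃ o) (b₄ o)) (≡.sym e)
          (chosen i _ active w le (≈ᵇ-false ¬z)))

  opaque
    unfolding decideₑ

    decide-correct : ∀ {t} (c₁ c₂ c₃ c₄ : Vec unit) (x₀ x₁ x₂ x₃ x₄ : Vec t) →
      ⟦ decideₑ ⟧ (c₁ ∷ c₂ ∷ c₃ ∷ c₄ ∷ x₀ ∷ x₁ ∷ x₂ ∷ x₃ ∷ x₄ ∷ []) [] ≡
      decide (c₁ tt ≈ᵇ 0#) (c₂ tt ≈ᵇ 0#) (c₃ tt ≈ᵇ 0#) (c₄ tt ≈ᵇ 0#) x₀ x₁ x₂ x₃ x₄
    decide-correct c₁ c₂ c₃ c₄ x₀ x₁ x₂ x₃ x₄ = ≡.refl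

  opaque
    unfolding anyₑ activatedₑ movedₑ

    any-correct : ∀ o → ⟦ anyₑ ⟧ (o ∷ []) [] tt ≡ any 𝑛ˢ o
    any-correct o = ≡.refl

    activated-correct : ∀ act → ⟦ activatedₑ ⟧ (act ∷ []) [] ≡ activated act
    activated-correct act = ≡.refl

    moved-correct : ∀ v x o → ⟦ movedₑ ⟧ (v ∷ x ∷ o ∷ []) [] ≡ moved v x o
    moved-correct v x o = ≡.refl

  next : Op 𝑛ˢ → Op 𝑛ˢ → Op 𝑛ˢ → V → V → Vec St
  next W E v act o = pack (W′ b₁ b₂ b₃ b₄) (E′ b₁ b₂ b₃ b₄) (v′ b₁ b₂ b₃ b₄) (act′ b₁ b₂ b₃ b₄)
    where open Next W E v act o

  private
    pack-cong : ∀ {W W′ E E′ v v′ act act′} → W ≡ W′ → E ≡ E′ → v ≡ v′ → act ≡ act′ →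
                pack W E v act ≡ pack W′ E′ v′ act′
    pack-cong ≡.refl ≡.refl ≡.refl ≡.refl = ≡.refl

    decide-cong : ∀ {ℓ} {X : Set ℓ} {a a′ b b′ d d′ e e′} {x₀ x₁ x₁′ x₂ x₂′ x₃ x₃′ x₄ x₄′ : X} →
      a ≡ a′ → b ≡ b′ → d ≡ d′ → e ≡ e′ → x₁ ≡ x₁′ → x₂ ≡ x₂′ → x₃ ≡ x₃′ → x₄ ≡ x₄′ →
      decide a b d e x₀ x₁ x₂ x₃ x₄ ≡ decide a′ b′ d′ e′ x₀ x₁′ x₂′ x₃′ x₄′
    decide-cong ≡.refl ≡.refl ≡.refl ≡.refl ≡.refl ≡.refl ≡.refl ≡.refl = ≡.refl

  module _ (W E v : Op 𝑛ˢ) (act o : V) where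
    open Next W E v act o

    private
      args : Arrays State
      args = A ∷ W ∷ E ∷ v ∷ o ∷ act ∷ []

      c₁ c₂ c₃ c₄ : Vec unit
      c₁ = ⟦ unfinishedₑ ⟧ (A ∷ W ∷ v ∷ []) []
      c₂ = ⟦ anyₑ ⟧ (o ∷ []) []
      c₃ = ⟦ outsideWₑ ⟧ (A ∷ W ∷ E ∷ v ∷ o ∷ []) []
      c₄ = ⟦ outsideDₑ ⟧ (A ∷ W ∷ E ∷ v ∷ o ∷ []) []

      decided : ∀ {t} (x₀ : Vec t) {x₁ x₁′ x₂ x₂′ x₃ x₃′ x₄ x₄′ : Vec t} → x₁ ≡ x₁′ → x₂ ≡ x₂′ →
          x₃ ≡ x₃′ → x₄ ≡ x₄′ →
                ⟦ decideₑ ⟧ (c₁ ∷ c₂ ∷ c₃ ∷ c₄ ∷ x₀ ∷ x₁ ∷ x₂ ∷ x₃ ∷ x₄ ∷ []) [] ≡ decide b₁ b₂ b₃ b₄ x₀ x₁′ x₂′ x₃′ x₄′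
      decided x₀ p₁ p₂ p₃ p₄ = ≡.trans (decide-correct c₁ c₂ c₃ c₄ _ _ _ _ _) (decide-cong
        (≡.cong (_≈ᵇ 0#) (unfinished-correct W v)) (≡.cong (_≈ᵇ 0#) (any-correct o))
        (≡.cong (_≈ᵇ 0#) (outsideW-correct W E v o))
            (≡.cong (_≈ᵇ 0#) (outsideD-correct W E v o)) p₁ p₂ p₃ p₄)

    opaque
      unfolding nextWₑ

      nextW-correct : ⟦ nextWₑ ⟧ args [] ≡ W′ b₁ b₂ b₃ b₄
      nextW-correct = decided W {W} {_} {⟦ superfluousₑ ⟧
          (A ∷ W ∷ E ∷ v ∷ o ∷ []) []} {_} {W} {_} {W} ≡.refl
          (superfluous-correct W E v o) ≡.refl ≡.refl

    opaque
      unfolding nextEₑ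

      nextE-correct : ⟦ nextEₑ ⟧ args [] ≡ E′ b₁ b₂ b₃ b₄
      nextE-correct = decided E {E} {_} {E} {_} {⟦ shrinkingₑ ⟧
          (A ∷ W ∷ E ∷ v ∷ o ∷ []) []} {_} {E} ≡.refl ≡.refl (shrinking-correct W E v o) ≡.refl

    opaque
      unfolding nextVₑ

      nextV-correct : ⟦ nextVₑ ⟧ args [] ≡ v′ b₁ b₂ b₃ b₄
      nextV-correct = decided v {v} {_} {v} {_} {v} {_} {⟦ movedₑ ⟧
          (v ∷ ⟦ enlargingₑ ⟧ (A ∷ W ∷ E ∷ v ∷ o ∷ []) [] ∷ o ∷ []) []} ≡.refl ≡.refl ≡.refl
        (≡.trans (moved-correct v _ o) (≡.cong (λ x → moved v x o) (enlarging-correct W E v o)))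

    opaque
      unfolding nextActₑ

      nextAct-correct : ⟦ nextActₑ ⟧ args [] ≡ act′ b₁ b₂ b₃ b₄
      nextAct-correct = decided act {⟦ activatedₑ ⟧ (act ∷ []) []} {_} {act} {_} {act} {_} {act}
          (activated-correct act) ≡.refl ≡.refl ≡.refl

    opaque
      unfolding nextₑ

      next-correct : ⟦ nextₑ ⟧ args [] ≡ next W E v act o
      next-correct = pack-cong nextW-correct nextE-correct nextV-correct nextAct-correct

  opaque
    unfolding roundₑ

    round-correct : ∀ st → ⟦ roundₑ ⟧ (st ∷ A ∷ []) [] ≡
      next (slice zero st) (slice (suc zero) st) (slice (suc (suc zero)) st) (diagonal st)
        (pick (slice zero st) (slice (suc zero) st) (slice (suc (suc zero)) st) (diagonal st))
    round-correct st = ≡.trans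
      (≡.cong (λ o → ⟦ nextₑ ⟧ (A ∷ W ∷ E ∷ v ∷ o ∷ act ∷ []) []) (pick-correct W E v act))
      (next-correct W E v act (pick W E v act))
      where
      W E v : Op 𝑛ˢ
      act : V
      W = slice zero st
      E = slice (suc zero) st
      v = slice (suc (suc zero)) st
      act = diagonal st

  ProgressOf : ℕ → Vec St → Set (lsuc (c ⊔ ℓ₁))
  ProgressOf k st = Progress k (slice zero st) (slice (suc zero) st) (slice (suc (suc zero)) st)
      (diagonal st)

  progress-pack : ∀ {k W E v act} → Progress k W E v act → ProgressOf k (pack W E v act)
  progress-pack {k} {W} {E} {v} {act} h
    rewrite pack-W W E v act | pack-E W E v act | pack-v W E v act | pack-act W E v act = h

  count-zero : ∀ k → count k (λ _ → 0#) ≡ 0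
  count-zero zero    = ≡.refl
  count-zero (suc k) rewrite ≈ᵇ-true {0#} refl = count-zero k

  -- With E = V the right ideal is all of A and contains 1, so A R V = V with nothing generated yet.
  start : Progress 0 0ᵒ 1ᵒ 0ᵒ 0ᵛ
  start = record
    { projW = 0-isProjection
    ; stableW = λ {a} _ x∈ → resp (isSubspace-∈ 0ᵒ) (λ p → sym (trans (ap-cong a (∈0⇒≋0 x∈) p) (ap-0 a p))) (null (isSubspace-∈ 0ᵒ))
    ; small = λ U projU _ h x → plus-least projU 0ᵒ (isSubspace-∈ U) 0-isProjection (λ _ → id)
        (0⊆ (isSubspace-∈ U)) x (h x)
    ; projE = 1-isProjection
    ; spanning = λ X _ _ _ _ h x → resp (isSubspace-∈ X) (ap-1 x)
        (h (ranged-∋ projA 1ᵒ algebra-1 (λ y → ap-1 (ap 1ᵒ y))) x)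
    ; bits = λ _ → inj₁ refl
    ; idle = λ _ _ _ → refl
    ; lower = λ k _ _ → ≡.subst (ℕ._≤ k) (≡.sym (count-zero n)) z≤n
    } , inj₂ (ℕₚ.≤-trans (dimension-≤ 1ᵒ) (ℕₚ.m≤n+m n _))

  final : Vec St
  final = fold (dim 𝟜 ⊗ 𝑛ˢ) (λ _ st → ⟦ roundₑ ⟧ (st ∷ ⟦ algebraₑ ⟧ [] [] ∷ []) [])
      (pack 0ᵒ 1ᵒ 0ᵒ 0ᵛ)

  W∞ E∞ v∞ : Op 𝑛ˢ
  act∞ : V
  W∞ = slice zero final
  E∞ = slice (suc zero) final
  v∞ = slice (suc (suc zero)) final
  act∞ = diagonal final

  private
    final-progress : ProgressOf (4 ℕ.* n ℕ.+ 0) final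
    final-progress = fold-counts ProgressOf (dim 𝟜 ⊗ 𝑛ˢ) {λ _ st → ⟦ roundₑ ⟧
        (st ∷ ⟦ algebraₑ ⟧ [] [] ∷ []) []}
      (λ _ k st h → ≡.subst (ProgressOf (suc k))
        (≡.sym (≡.trans (≡.cong (λ a → ⟦ roundₑ ⟧ (st ∷ a ∷ []) []) algebra-correct)
            (round-correct st)))
        (progress-pack (advance k _ _ _ _ h)))
      {0} {pack 0ᵒ 1ᵒ 0ᵒ 0ᵛ} (progress-pack start)

  final-invariant : Invariant W∞ E∞ v∞ act∞
  final-invariant = proj₁ final-progress

  finished : Finished W∞ v∞
  finished with full? (generated W∞ v∞)
  ... | inj₁ h = h
  ... | inj₂ (y , y∉) = [ id , (λ le → contradiction le (ℕₚ.<⇒≱ (begin-strict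
        -- Strictness comes from the middle summand: an unreached vector keeps the dimension of A v
        -- + W below n.
        weight W∞ v∞ act∞ ℕ.+ n       <⟨ ℕₚ.+-monoˡ-< n
            (ℕₚ.+-mono-<-≤ (ℕₚ.+-mono-≤-< (dimension-≤ W∞)
                                        (dimension-< (Stage.projD final-invariant) y∉))
                                            (count-≤ n act∞)) ⟩
        n ℕ.+ n ℕ.+ n ℕ.+ n        ≡⟨ Arithmetic.fourfold n ⟩
        4 ℕ.* n ℕ.+ 0              ≤⟨ ℕₚ.m≤m+n _ (dimension E∞) ⟩
        4 ℕ.* n ℕ.+ 0 ℕ.+ dimension E∞ ∎))) ]′ (proj₂ final-progress)
    where open ℕₚ.≤-Reasoning

  opaque
    unfolding generatorsₑ

    generators-correct : ⟦ generatorsₑ ⟧ [] [] ≡ act∞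
    generators-correct = ≡.refl

-- The number of active entries is the minimum number of generators

module Answer {c ℓ₁ ℓ₂} (F : DiscreteField c ℓ₁ ℓ₂) (m n : ℕ)
              (S : Vector (MatrixModule.Matrix F n) m) where
  open Rounds F m n S
  private module M = MatrixModule F
  open M using (𝒜)

  private
    matrix : Vec 𝑀 → M.Matrix n
    matrix a i j = a (i , j)

    vector : M.Matrix n → Vec 𝑀
    vector a (i , j) = a i j

    -- The two matrix products differ in the order of summation.
    ap≋*ⱽ : ∀ a (x : V) → ap a x ≋ matrix a M.*ⱽ x
    ap≋*ⱽ a x i = ∑≈sum 𝑛 λ j → a (i , j) * x j

    mul≋*ᴹ : ∀ a b → mul a b ≋ vector (matrix a M.*ᴹ matrix b)
    mul≋*ᴹ a b (i , j) = ∑≈sum 𝑛 λ k → a (i , k) * b (k , j)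

    algebra⊆𝒜 : (_∈ A) ⊆ (λ a → 𝒜 S (matrix a))
    algebra⊆𝒜 = algebra-least
      (record
        { resp = λ e → 𝒜.respects (λ i j → e (i , j))
        ; null = 𝒜.null
        ; add = λ {a} {b} → 𝒜.add {a = matrix a} {b = matrix b}
        ; scale = λ x {a} → 𝒜.scale x {a = matrix a}
        })
      𝒜.identity
      (λ k {b} h → 𝒜.respects (λ i j → sym (mul≋*ᴹ (gen k) b (i , j))) (𝒜.mul (𝒜.generator k) h))

    𝒜⊆algebra : ∀ {a} → 𝒜 S a → vector a ∈ A
    𝒜⊆algebra (𝒜.generator k) = resp (isSubspace-∈ A) (mul-1ʳ (gen k)) (algebra-gen k algebra-1)
    𝒜⊆algebra 𝒜.identity = algebra-1
    𝒜⊆algebra 𝒜.null = null (isSubspace-∈ A)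
    𝒜⊆algebra (𝒜.add p q) = add (isSubspace-∈ A) (𝒜⊆algebra p) (𝒜⊆algebra q)
    𝒜⊆algebra (𝒜.scale x p) = scale (isSubspace-∈ A) x (𝒜⊆algebra p)
    𝒜⊆algebra (𝒜.mul {a} {b} p q) = resp (isSubspace-∈ A) (mul≋*ᴹ (vector a) (vector b))
        (A-closed (𝒜⊆algebra p) (𝒜⊆algebra q))
    𝒜⊆algebra (𝒜.respects e p) = resp (isSubspace-∈ A) (λ (i , j) → e i j) (𝒜⊆algebra p)

    open Stage final-invariant using (small; lower; idle; D-least; stableW; projW)

    U : Op 𝑛ˢ
    U = generated 0ᵒ v∞

    projU : IsProjection U
    projU = extend-isProjection 0-isProjection A v∞

    0-stable : Stable (_∈ 0ᵒ {𝑛ˢ})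
    0-stable {a} _ x∈ = resp (isSubspace-∈ 0ᵒ)
        (λ p → sym (trans (ap-cong a (∈0⇒≋0 x∈) p) (ap-0 a p)))
      (null (isSubspace-∈ 0ᵒ))

    stableU : Stable (_∈ U)
    stableU = extend-stable 0-isProjection 0-stable v∞

    U-full : ∀ x → x ∈ U
    U-full = small U projU stableU λ x → D-least (isSubspace-∈ (plus U W∞))
      (λ {a} a∈ → plus-least projU W∞ (preimage (applied a) (isSubspace-∈ (plus U W∞))) projW
        (λ y y∈ → plus-⊇ˡ projU W∞ _ (stableU a∈ y∈))
            (λ y y∈ → plus-⊇ʳ projU W∞ _ (stableW a∈ y∈)) _)
      (plus-⊇ʳ projU W∞)
      (λ j → plus-⊇ˡ projU W∞ _ (resp (isSubspace-∈ U) (ap-1 (col v∞ j))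
          (extend-column 0-isProjection A v∞ j algebra-1)))
      x (finished x)

    js : List (Fin n)
    js = actives n act∞

    t : Fin (length js) → V
    t i = col v∞ (lookupˡ js i)

    actives-∋ : ∀ k f j → ¬ f j ≈ 0# → j ∈ˡ actives k f
    actives-∋ (suc k) f zero    h rewrite ≈ᵇ-false h = here ≡.refl
    actives-∋ (suc k) f (suc j) h with f zero ≈ᵇ 0#
    ... | true  = ∈ₚ.∈-map⁺ suc (actives-∋ k (f ∘ suc) j h)
    ... | false = there (∈ₚ.∈-map⁺ suc (actives-∋ k (f ∘ suc) j h))

    position-of : ∀ {j} {is : List (Fin n)} → j ∈ˡ is → ∃[ i ] lookupˡ is i ≡ j
    position-of (here e)  = zero , ≡.sym e
    position-of (there p) = let (i , e) = position-of p in suc i , e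

    column : ∀ j → col v∞ j ≋ 0ᵛ ⊎ (∃[ i ] lookupˡ js i ≡ j)
    column j with act∞ j ≈? 0#
    ... | yes z = inj₁ (idle j z)
    ... | no ¬z = inj₂ (position-of (actives-∋ n act∞ j ¬z))

    spanned : ∀ {ℓ} {X : Pred V ℓ} → IsSubspace X → (∀ {a} i → a ∈ A → X (ap a (t i))) → ∀ x → X x
    spanned {X = X} isX h x = extend-least 0-isProjection A v∞ isX (0⊆ isX)
        (λ d j → member d j (column j)) x (U-full x)
      where
      member : ∀ d j → col v∞ j ≋ 0ᵛ ⊎ (∃[ i ] lookupˡ js i ≡ j) → X (ap (col A d) (col v∞ j))
      member d j (inj₁ e) = resp isX (λ p → sym (trans (ap-cong (col A d) e p) (ap-0 (col A d) p)))
          (null isX)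
      member d j (inj₂ (i , ≡.refl)) = h i (column∈ projA d)

    lower′ : ∀ k (w : Fin k → V) → Generates w → length js ℕ.≤ k
    lower′ k w g = ≡.subst (ℕ._≤ k) (≡.sym (length-actives n act∞)) (lower k w g)

    -- If two entries coincided, one could be dropped, leaving a generating family shorter than the
    -- lower bound allows. Thus the entries form a set of exactly that many vectors.
    distinct : ∀ {k} (t : Fin k → V) → (∀ {ℓ} {X : Pred V ℓ} → IsSubspace X →
        (∀ {a} i → a ∈ A → X (ap a (t i))) → ∀ x → X x) →
               (∀ k′ (w : Fin k′ → V) → Generates w → k ℕ.≤ k′) → ∀ {i j} → t i ≋ t j → i ≡ j
    distinct {suc k} t spans minimal {i} {j} e with i Finₚ.≟ j
    ... | yes p = p
    ... | no i≢j = contradiction (minimal k (t ∘ Fin.punchIn i) generates) (ℕₚ.<⇒≱ (ℕₚ.n<1+n k))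
      where
      generates : Generates (t ∘ Fin.punchIn i)
      generates X isX stable h = spans isX λ l a∈ → stable a∈ (every l)
        where
        other : ∀ {l} → i ≢ l → X (t l)
        other {l} i≢l = ≡.subst (X ∘ t) (Finₚ.punchIn-punchOut i≢l) (h (Fin.punchOut i≢l))

        every : ∀ l → X (t l)
        every l with i Finₚ.≟ l
        ... | no i≢l     = other i≢l
        ... | yes ≡.refl = resp isX (λ p → sym (e p)) (other i≢j)

    isSubspace-span : ∀ {ℓ} (P : Pred V ℓ) → IsSubspace (M.Span P)
    isSubspace-span P = record
      { resp = M.Span.respects ; null = M.Span.null ; add = M.Span.add ; scale = M.Span.scale }

    span-least : ∀ {ℓ p} {P : Pred V ℓ} {X : Pred V p} → IsSubspace X → P ⊆ X → M.Span P ⊆ X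
    span-least isX h x (M.Span.member p)     = h x p
    span-least isX h x M.Span.null           = null isX
    span-least isX h x (M.Span.add p q)      = add isX (span-least isX h _ p) (span-least isX h _ q)
    span-least isX h x (M.Span.scale a p)    = scale isX a (span-least isX h _ p)
    span-least isX h x (M.Span.respects e p) = resp isX e (span-least isX h _ p)

  minimum : M.IsMinimumNumberOfGenerators S (count n act∞)
  minimum = ≡.subst (M.IsMinimumNumberOfGenerators S) (length-actives n act∞)
    ((T , (t , distinct t spanned lower′ , λ v → mk⇔ id id) , generating) , smallest)
    where
    T : Pred V ℓ₁
    T v = ∃[ i ] v ≋ t i

    generating : M.IsSystemOfGenerators S T
    generating = spanned (isSubspace-span _) λ {a} i a∈ → M.Span.member
      (matrix a , t i , algebra⊆𝒜 a a∈ , (i , λ _ → refl) , ap≋*ⱽ a (t i))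

    smallest : ∀ (T : Pred V ℓ₁) k → M.HasCardinality T k → M.IsSystemOfGenerators S T →
        length js ℕ.≤ k
    smallest T k (w , _ , T⇔w) gens = lower′ k w λ X isX stable h x → span-least isX
      (λ y (a , s , a∈ , s∈ , e) → let (i , s≋w) = Equivalence.to (T⇔w s) s∈ in
        resp isX (λ p → trans (ap≋*ⱽ (vector a) s p) (sym (e p)))
          (stable (𝒜⊆algebra a∈) (resp isX (λ p → sym (s≋w p)) (h i))))
      x (gens x)

-- The complete program

module Main where
  open Compilation
  open Procedures using (generatorsₑ)

  -- Register 0 receives the result only at the end, because until then it holds m, on which the
  -- addresses of arrays depend.
  countₜ : Timed
  countₜ = assign 2 (lit 0) ⨾ₜ
    for 3 (reg (lit 1)) 𝐧 (address 𝑛ˢ (reg (lit 3)) 4 ⨾ₜ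
      condₜ (cell (array 0) (reg (lit 4)) (lit 0) ≈ᵗ 𝟘) skipₜ (assign 2 (reg (lit 2) ⊕ lit 1))) ⨾ₜ
    assign 0 (reg (lit 2))

  mainₜ : Timed
  mainₜ = compile generatorsₑ [] [] 0 2 ⨾ₜ countₜ

module MainCorrectness {c ℓ₁ ℓ₂} (F : DiscreteField c ℓ₁ ℓ₂) (m n : ℕ)
                       (S : Vector (MatrixModule.Matrix F n) m) where
  open LinearAlgebra F m n using (Carrier; 0#; _≈ᵇ_; Vec; foldFin)
  open Execution F m n
  open CompilationCorrectness F m n S
  open Certificate F m n S using (count)
  open Compilation
  open Main

  foldFin-count : ∀ k (f : Fin k → Carrier) x →
                  foldFin k (λ i x → if f i ≈ᵇ 0# then x else suc x) x ≡ count k f ℕ.+ x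
  foldFin-count zero    f x = ≡.refl
  foldFin-count (suc k) f x with f zero ≈ᵇ 0#
  ... | true  = foldFin-count k (f ∘ suc) x
  ... | false = ≡.trans (foldFin-count k (f ∘ suc) (suc x)) (ℕₚ.+-suc (count k (f ∘ suc)) x)

  run-count : ∀ {act : Vec 𝑛ˢ} {σ} → Sized σ → Holds 𝑛ˢ 0 act σ → Runs countₜ σ
      (λ τ → output τ ≡ count n act)
  run-count {act} {σ} sz h = run-⨾ (run-assign (run-⨾ {P = loop} (run-mono finish
    (run-for J {e = reg (lit 1)} {size = 𝐧} ≡.refl stable limit
        (λ i x → if act i ≈ᵇ 0# then x else suc x) body
      (SameRegs-set σ ℕₚ.≤-refl , ≡.refl , register-set 2 σ)))))
    where
    step : Timed
    step = address 𝑛ˢ (reg (lit 3)) 4 ⨾ₜ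
      condₜ (cell (array 0) (reg (lit 4)) (lit 0) ≈ᵗ 𝟘) skipₜ (assign 2 (reg (lit 2) ⊕ lit 1))

    loop : Timed
    loop = for 3 (reg (lit 1)) 𝐧 step

    J : ℕ → State → Set c
    J x τ = SameRegs 2 σ τ × cells τ ≡ cells σ × registers τ 2 ≡ x

    stable : ∀ {x v τ} → J x τ → J x (setRegister 3 v τ)
    stable {τ = τ} (p , q , r) = SameRegs-trans p (SameRegs-set τ (s≤s (s≤s z≤n))) , q , r

    limit : ∀ {x τ} → J x τ → registers τ 1 ≡ n
    limit (p , _) = proj₂ (sized ℕₚ.≤-refl p sz)

    body : ∀ i {x τ} → J x τ → registers τ 3 ≡ toℕ i →
           Runs step τ (λ υ → J (if act i ≈ᵇ 0# then x else suc x) υ × registers υ 3 ≡ toℕ i)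
    body i {x} {τ} (p , q , r) e = run-⨾ (run-address 𝑛ˢ {i = i} (s≤s (s≤s z≤n))
        (sized ℕₚ.≤-refl p sz)
      (λ υ s → ≡.trans (SameRegs.same s 3 (s≤s (s≤s (s≤s (s≤s z≤n))))) e)
      λ {υ} s c≡ pos → branch s c≡ (≡.trans
        (≡.cong₂ (λ a b → cells υ (a ℕ.+ 0) b 0) (proj₁
            (sized ℕₚ.≤-refl (SameRegs-trans p (SameRegs-≤ (s≤s (s≤s z≤n)) s)) sz)) pos)
        (≡.trans (≡.cong (λ f → f (m ℕ.+ 0) (position 𝑛ˢ i) 0) (≡.trans c≡ q)) (h i)))
            (act i ≈ᵇ 0#) ≡.refl)
      where
      branch : ∀ {υ} → SameRegs 4 τ υ → cells υ ≡ cells τ → evalF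
          (cell (array 0) (reg (lit 4)) (lit 0)) υ ≡ act i →
               ∀ b → (act i ≈ᵇ 0#) ≡ b →
               Runs (condₜ (cell (array 0) (reg (lit 4)) (lit 0) ≈ᵗ 𝟘) skipₜ
                   (assign 2 (reg (lit 2) ⊕ lit 1))) υ
                 (λ υ → J (if b then x else suc x) υ × registers υ 3 ≡ toℕ i)
      branch {υ} s c≡ v true eb = run-cond-true (≡.trans (≡.cong (_≈ᵇ 0#) v) eb)
        (run-skip ((SameRegs-trans p (SameRegs-≤ (s≤s (s≤s z≤n)) s) , ≡.trans c≡ q ,
          ≡.trans (SameRegs.same s 2 (s≤s (s≤s (s≤s z≤n)))) r) , ≡.trans
              (SameRegs.same s 3 ℕₚ.≤-refl) e))
      branch {υ} s c≡ v false eb = run-cond-false (≡.trans (≡.cong (_≈ᵇ 0#) v) eb)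
        (run-assign ((SameRegs-trans p (SameRegs-trans (SameRegs-≤ (s≤s (s≤s z≤n)) s)
            (SameRegs-set υ ℕₚ.≤-refl)) , ≡.trans c≡ q ,
          ≡.trans (ℕₚ.+-comm _ 1) (≡.cong suc (≡.trans
              (SameRegs.same s 2 (s≤s (s≤s (s≤s z≤n)))) r))) ,
          ≡.trans (SameRegs.same s 3 ℕₚ.≤-refl) e))

    finish : ∀ {τ} → J (foldFin n (λ i x → if act i ≈ᵇ 0# then x else suc x) 0) τ →
             Runs (assign 0 (reg (lit 2))) τ (λ τ → output τ ≡ count n act)
    finish (_ , _ , r) = run-assign (≡.trans r (≡.trans (foldFin-count n act 0) (ℕₚ.+-identityʳ _)))

  initial-input : ∀ k i j → cells (initial S) (toℕ k) (toℕ i) (toℕ j) ≡ S k i j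
  initial-input k i j with toℕ k ℕₚ.<? m | toℕ i ℕₚ.<? n | toℕ j ℕₚ.<? n
  ... | yes p | yes q | yes r rewrite Finₚ.fromℕ<-toℕ k p | Finₚ.fromℕ<-toℕ i q | Finₚ.fromℕ<-toℕ j r = ≡.refl
  ... | no p  | _     | _     = contradiction (Finₚ.toℕ<n k) p
  ... | yes _ | no q  | _     = contradiction (Finₚ.toℕ<n i) q
  ... | yes _ | yes _ | no r  = contradiction (Finₚ.toℕ<n j) r

  open Rounds F m n S using (act∞; generators-correct)

  run-main : Runs mainₜ (initial S) (λ τ → output τ ≡ count n act∞)
  run-main = run-⨾ (run-mono
    (λ (r , _ , h) → run-count (sized ℕₚ.≤-refl r (≡.refl , ≡.refl))
      (λ i → ≡.trans (h i) (≡.cong (λ f → f i) generators-correct)))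
    (compile-correct Procedures.generatorsₑ {ρ = []} {η = []}
        (context ℕₚ.≤-refl (≡.refl , ≡.refl) initial-input (λ ()) (λ ()))))

theorem1p3 : ∀ c ℓ₁ ℓ₂ →
    Σ[ P ∈ Program ] Σ[ p ∈ Polynomial ] ((F : DiscreteField c ℓ₁ ℓ₂) →
    FindsMinimumNumberOfGenerators F P p)
theorem1p3 c ℓ₁ ℓ₂ = Timed.program Main.mainₜ , Timed.bound Main.mainₜ , correct
  where
  correct : (F : DiscreteField c ℓ₁ ℓ₂) →
            FindsMinimumNumberOfGenerators F (Timed.program Main.mainₜ) (Timed.bound Main.mainₜ)
  correct F m n S = τ , t , run , in-time ,
    ≡.subst (MatrixModule.IsMinimumNumberOfGenerators F S) (≡.sym holds) (Answer.minimum F m n S)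
    where open Execution.Runs (MainCorrectness.run-main F m n S)
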